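{- Let $\omega=e^{2\pi i/3}$. Every $3$-and-$3$ form of prime index $\ell$ is equivalent, up to orthogonal transformations and homotheties, to $(L,M)=(\mathbb{Z}[\omega],\mathfrak{p}_\ell)$, where $\mathfrak{p}_\ell$ is a prime ideal of $\mathbb{Z}[\omega]$ over $\ell$ and $\ell=3$ or $\ell\equiv1\bmod6$.
   Context: A lattice in $\mathbb{R}^2\cong\mathbb{C}$ is the $\mathbb{Z}$-span of an $\mathbb{R}$-basis; $\langle\,,\rangle$ is the standard dot product; a homothety is multiplication by a positive real scalar. Let $\ell$ be a prime, $L$ a lattice and $M\subset L$ a sublattice of index $\ell$. The pair $(L,M)$ is a tempered perfect lattice (or form) of index $\ell$ if, after rescaling $L$ and $M$ by a common positive scalar, there exist non-empty sets $S\subset L-M$ and $S'\subset M-\{0\}$ such that, with $A(v)=\langle v,v\rangle$: (i) $A(v)=1$ for all $v\in S$; (ii) $A(v)>1$ for all $v\in L-M$ with $v\notin S$; (iii) $A(v)$ has a common value $u\geqslant 1$ for all $v\in S'$; (iv) $A(v)>u$ for all $v\in M-\{0\}$ with $v\notin S'$; (v) if $B$ is any positive definite quadratic form on $\mathbb{R}^2$ satisfying (i)--(iv) in place of $A$ with the same $S,S'$ and with common value $u'$ on $S'$, then $B=A$ and $u'=u$. It is called an $s$-and-$s'$ form if $S$ consists of $s$ pairs $\pm v$ and $S'$ consists of $s'$ pairs $\pm v$. -}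

module Defs where

open import Data.Fin using (Fin)
open import Data.Integer as ℤ using (ℤ; +_)
import Data.Integer.Divisibility as ℤ
import Data.Integer.Properties as ℤ
open import Data.Nat as ℕ using (ℕ; zero; suc)
import Data.Nat.Properties as ℕ
open import Data.Product using (∃₂; ∃-syntax; Σ-syntax; _×_; _,_; proj₁)
open import Data.Rational as ℚ using (ℚ; mkℚ; 0ℚ; 1ℚ; ½; ∣_∣; *<*)
open import Data.Rational.Literals using () renaming (fromℤ to ℤ→ℚ)
import Data.Rational.Properties as ℚ
open import Data.Rational.Solver
import Data.Rational.Unnormalised as ℚᵘ
import Data.Rational.Unnormalised.Properties as ℚᵘ
open import Data.Sum using (_⊎_; inj₁; inj₂)
open import Function using (_⇔_)
open import Level using (0ℓ)
open import Relation.Binary.Core using (Rel)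
open import Relation.Binary.Definitions using (_Respects_)
open import Relation.Binary.PropositionalEquality
  using (_≡_; refl; sym; trans; cong; cong₂; subst; subst₂)
open import Relation.Nullary using (¬_)
open import Relation.Unary using (Pred; _∈_; _∉_; _⊆_; _≐_; Satisfiable)

-- Real numbers are Cauchy sequences of rationals; equality of reals is _≈_ below.
IsCauchy : (ℕ → ℚ) → Set
IsCauchy x = ∀ ε → 0ℚ ℚ.< ε →
  ∃[ N ] ∀ m n → N ℕ.≤ m → N ℕ.≤ n → ∣ x m ℚ.- x n ∣ ℚ.< ε

record ℝ : Set where
  constructor mkℝ
  field
    seq      : ℕ → ℚ
    isCauchy : IsCauchy seq

open ℝ public

private
  open +-*-Solver using (solve; con; _:=_; _:+_; _:*_; _:-_; :-_)

  ½-pos : ∀ {ε} → 0ℚ ℚ.< ε → 0ℚ ℚ.< ½ ℚ.* ε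
  ½-pos {ε} ε>0 = subst (ℚ._< ½ ℚ.* ε) (ℚ.*-zeroʳ ½) (ℚ.*-monoʳ-<-pos ½ ε>0)

  ½+½ : ∀ ε → ½ ℚ.* ε ℚ.+ ½ ℚ.* ε ≡ ε
  ½+½ = solve 1 (λ e → con ½ :* e :+ con ½ :* e := e) refl

  abstract
    +-isCauchy : ∀ {x y} → IsCauchy x → IsCauchy y → IsCauchy (λ n → x n ℚ.+ y n)
    +-isCauchy {x} {y} cx cy ε ε>0
      with cx (½ ℚ.* ε) (½-pos ε>0) | cy (½ ℚ.* ε) (½-pos ε>0)
    ... | N , p | N′ , q = N ℕ.⊔ N′ , λ m n m≥ n≥ → begin-strict
      ∣ (x m ℚ.+ y m) ℚ.- (x n ℚ.+ y n) ∣
        ≡⟨ cong ∣_∣ (solve 4 (λ a b c d → (a :+ b) :- (c :+ d) := (a :- c) :+ (b :- d))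
                           refl (x m) (y m) (x n) (y n)) ⟩
      ∣ (x m ℚ.- x n) ℚ.+ (y m ℚ.- y n) ∣
        ≤⟨ ℚ.∣p+q∣≤∣p∣+∣q∣ (x m ℚ.- x n) (y m ℚ.- y n) ⟩
      ∣ x m ℚ.- x n ∣ ℚ.+ ∣ y m ℚ.- y n ∣
        <⟨ ℚ.+-mono-< (p m n (ℕ.m⊔n≤o⇒m≤o N N′ m≥) (ℕ.m⊔n≤o⇒m≤o N N′ n≥))
                      (q m n (ℕ.m⊔n≤o⇒n≤o N N′ m≥) (ℕ.m⊔n≤o⇒n≤o N N′ n≥)) ⟩
      ½ ℚ.* ε ℚ.+ ½ ℚ.* ε
        ≡⟨ ½+½ ε ⟩
      ε ∎
      where open ℚ.≤-Reasoning

    neg-isCauchy : ∀ {x} → IsCauchy x → IsCauchy (λ n → ℚ.- x n)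
    neg-isCauchy {x} cx ε ε>0 with cx ε ε>0
    ... | N , p = N , λ m n m≥ n≥ → subst (ℚ._< ε)
      (trans (sym (ℚ.∣-p∣≡∣p∣ (x m ℚ.- x n)))
             (cong ∣_∣ (solve 2 (λ a b → :- (a :- b) := :- a :- :- b) refl (x m) (x n))))
      (p m n m≥ n≥)

  -- An eventual upper bound for ∣ x n ∣, with its reciprocal
  bound : ∀ {x} → IsCauchy x →
    Σ[ K ∈ ℚ ] Σ[ K⁻¹ ∈ ℚ ] 0ℚ ℚ.< K × 0ℚ ℚ.< K⁻¹ × K ℚ.* K⁻¹ ≡ 1ℚ ×
    (∃[ N ] ∀ n → N ℕ.≤ n → ∣ x n ∣ ℚ.≤ K)
  bound {x} cx with cx 1ℚ (ℚ.positive⁻¹ 1ℚ)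
  ... | N , p = K , K⁻¹ , K>0 , ℚ.positive⁻¹ K⁻¹ , ℚ.*-inverseʳ K , N , λ n n≥ → begin
    ∣ x n ∣
      ≡⟨ cong ∣_∣ (solve 2 (λ a b → a := (a :- b) :+ b) refl (x n) (x N)) ⟩
    ∣ (x n ℚ.- x N) ℚ.+ x N ∣
      ≤⟨ ℚ.∣p+q∣≤∣p∣+∣q∣ (x n ℚ.- x N) (x N) ⟩
    ∣ x n ℚ.- x N ∣ ℚ.+ ∣ x N ∣
      ≤⟨ ℚ.+-monoˡ-≤ ∣ x N ∣ (ℚ.<⇒≤ (p n N n≥ ℕ.≤-refl)) ⟩
    K ∎
    where
    open ℚ.≤-Reasoning
    K = 1ℚ ℚ.+ ∣ x N ∣
    K>0 : 0ℚ ℚ.< K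
    K>0 = ℚ.+-mono-<-≤ (ℚ.positive⁻¹ 1ℚ) (ℚ.0≤∣p∣ (x N))
    instance
      posK : ℚ.Positive K
      posK = ℚ.positive K>0
      nzK : ℚ.NonZero K
      nzK = ℚ.pos⇒nonZero K
    K⁻¹ = ℚ.1/ K
    instance
      posK⁻¹ : ℚ.Positive K⁻¹
      posK⁻¹ = ℚ.1/pos⇒pos K

  *-pos : ∀ {p q} → 0ℚ ℚ.< p → 0ℚ ℚ.< q → 0ℚ ℚ.< p ℚ.* q
  *-pos {p} {q} p>0 q>0 =
    ℚ.positive⁻¹ (p ℚ.* q) {{ℚ.pos*pos⇒pos p {{ℚ.positive p>0}} q {{ℚ.positive q>0}}}}

  bounded-* : ∀ {p q K δ} → 0ℚ ℚ.< K → ∣ p ∣ ℚ.≤ K → ∣ q ∣ ℚ.< δ → ∣ p ℚ.* q ∣ ℚ.< K ℚ.* δ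
  bounded-* {p} {q} {K} {δ} K>0 p≤K q<δ = begin-strict
    ∣ p ℚ.* q ∣
      ≡⟨ ℚ.∣p*q∣≡∣p∣*∣q∣ p q ⟩
    ∣ p ∣ ℚ.* ∣ q ∣
      ≤⟨ ℚ.*-monoʳ-≤-nonNeg ∣ q ∣ {{ℚ.∣-∣-nonNeg q}} p≤K ⟩
    K ℚ.* ∣ q ∣
      <⟨ ℚ.*-monoʳ-<-pos K {{ℚ.positive K>0}} q<δ ⟩
    K ℚ.* δ ∎
    where open ℚ.≤-Reasoning

  *-diff : ∀ a b c d → a ℚ.* b ℚ.- c ℚ.* d ≡ a ℚ.* (b ℚ.- d) ℚ.+ d ℚ.* (a ℚ.- c)
  *-diff = solve 4 (λ a b c d → a :* b :- c :* d := a :* (b :- d) :+ d :* (a :- c)) refl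

  abstract
    *-isCauchy : ∀ {x y} → IsCauchy x → IsCauchy y → IsCauchy (λ n → x n ℚ.* y n)
    *-isCauchy {x} {y} cx cy ε ε>0 =
      let K , K⁻¹ , K>0 , K⁻¹>0 , KK⁻¹ , N₁ , b₁ = bound {x} cx
          L , L⁻¹ , L>0 , L⁻¹>0 , LL⁻¹ , N₂ , b₂ = bound {y} cy
          N₃ , p = cx (L⁻¹ ℚ.* (½ ℚ.* ε)) (*-pos L⁻¹>0 (½-pos ε>0))
          N₄ , q = cy (K⁻¹ ℚ.* (½ ℚ.* ε)) (*-pos K⁻¹>0 (½-pos ε>0))
          N₁₂ = N₁ ℕ.⊔ N₂
          N₃₄ = N₃ ℕ.⊔ N₄
      in N₁₂ ℕ.⊔ N₃₄ , λ m n m≥ n≥ →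
      let m₁₂ = ℕ.m⊔n≤o⇒m≤o N₁₂ N₃₄ m≥
          n₁₂ = ℕ.m⊔n≤o⇒m≤o N₁₂ N₃₄ n≥
          m₃₄ = ℕ.m⊔n≤o⇒n≤o N₁₂ N₃₄ m≥
          n₃₄ = ℕ.m⊔n≤o⇒n≤o N₁₂ N₃₄ n≥
      in estimate (x m) (y m) (x n) (y n) {K} {K⁻¹} {L} {L⁻¹} K>0 L>0 KK⁻¹ LL⁻¹
           (b₁ m (ℕ.m⊔n≤o⇒m≤o N₁ N₂ m₁₂))
           (b₂ n (ℕ.m⊔n≤o⇒n≤o N₁ N₂ n₁₂))
           (p m n (ℕ.m⊔n≤o⇒m≤o N₃ N₄ m₃₄) (ℕ.m⊔n≤o⇒m≤o N₃ N₄ n₃₄))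
           (q m n (ℕ.m⊔n≤o⇒n≤o N₃ N₄ m₃₄) (ℕ.m⊔n≤o⇒n≤o N₃ N₄ n₃₄))
      where
      open ℚ.≤-Reasoning
      cancel : ∀ a b c → a ℚ.* b ≡ 1ℚ → a ℚ.* (b ℚ.* c) ≡ c
      cancel a b c ab≡1 =
        trans (sym (ℚ.*-assoc a b c)) (trans (cong (ℚ._* c) ab≡1) (ℚ.*-identityˡ c))

      estimate : ∀ a b c d {K K⁻¹ L L⁻¹} → 0ℚ ℚ.< K → 0ℚ ℚ.< L →
        K ℚ.* K⁻¹ ≡ 1ℚ → L ℚ.* L⁻¹ ≡ 1ℚ → ∣ a ∣ ℚ.≤ K → ∣ d ∣ ℚ.≤ L →
        ∣ a ℚ.- c ∣ ℚ.< L⁻¹ ℚ.* (½ ℚ.* ε) → ∣ b ℚ.- d ∣ ℚ.< K⁻¹ ℚ.* (½ ℚ.* ε) →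
        ∣ a ℚ.* b ℚ.- c ℚ.* d ∣ ℚ.< ε
      estimate a b c d {K} {K⁻¹} {L} {L⁻¹} K>0 L>0 KK⁻¹ LL⁻¹ a≤K d≤L ac bd = begin-strict
        ∣ a ℚ.* b ℚ.- c ℚ.* d ∣
          ≡⟨ cong ∣_∣ (*-diff a b c d) ⟩
        ∣ a ℚ.* (b ℚ.- d) ℚ.+ d ℚ.* (a ℚ.- c) ∣
          ≤⟨ ℚ.∣p+q∣≤∣p∣+∣q∣ (a ℚ.* (b ℚ.- d)) (d ℚ.* (a ℚ.- c)) ⟩
        ∣ a ℚ.* (b ℚ.- d) ∣ ℚ.+ ∣ d ℚ.* (a ℚ.- c) ∣
          <⟨ ℚ.+-mono-< (bounded-* {a} {b ℚ.- d} K>0 a≤K bd)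
                        (bounded-* {d} {a ℚ.- c} L>0 d≤L ac) ⟩
        K ℚ.* (K⁻¹ ℚ.* (½ ℚ.* ε)) ℚ.+ L ℚ.* (L⁻¹ ℚ.* (½ ℚ.* ε))
          ≡⟨ cong₂ ℚ._+_ (cancel K K⁻¹ (½ ℚ.* ε) KK⁻¹) (cancel L L⁻¹ (½ ℚ.* ε) LL⁻¹) ⟩
        ½ ℚ.* ε ℚ.+ ½ ℚ.* ε
          ≡⟨ ½+½ ε ⟩
        ε ∎

    const-isCauchy : ∀ q → IsCauchy (λ _ → q)
    const-isCauchy q ε ε>0 =
      0 , λ _ _ _ _ → subst (ℚ._< ε) (cong ∣_∣ (sym (ℚ.+-inverseʳ q))) ε>0

infixl 6 _+_ _-_
infixl 7 _*_
infix  8 -_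
infix  4 _≈_ _<_ _≤_ _#_

fromℚ : ℚ → ℝ
fromℚ q = mkℝ (λ _ → q) (const-isCauchy q)

fromℤ : ℤ → ℝ
fromℤ k = fromℚ (ℤ→ℚ k)

0ℝ 1ℝ : ℝ
0ℝ = fromℚ 0ℚ
1ℝ = fromℚ 1ℚ

_+_ : ℝ → ℝ → ℝ
x + y = mkℝ (λ n → seq x n ℚ.+ seq y n) (+-isCauchy {seq x} {seq y} (isCauchy x) (isCauchy y))

-_ : ℝ → ℝ
- x = mkℝ (λ n → ℚ.- seq x n) (neg-isCauchy {seq x} (isCauchy x))

_-_ : ℝ → ℝ → ℝ
x - y = x + (- y)

_*_ : ℝ → ℝ → ℝ
x * y = mkℝ (λ n → seq x n ℚ.* seq y n) (*-isCauchy {seq x} {seq y} (isCauchy x) (isCauchy y))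

_≈_ _<_ _≤_ _#_ : Rel ℝ 0ℓ

x ≈ y = ∀ ε → 0ℚ ℚ.< ε → ∃[ N ] ∀ n → N ℕ.≤ n → ∣ seq x n ℚ.- seq y n ∣ ℚ.< ε

x < y = Σ[ ε ∈ ℚ ] 0ℚ ℚ.< ε × ∃[ N ] ∀ n → N ℕ.≤ n → seq x n ℚ.+ ε ℚ.< seq y n

x ≤ y = ¬ (y < x)

x # y = x < y ⊎ y < x

-- √3 is the limit of the contracting iteration sₙ₊₁ = sₙ + (3 - sₙ²) / 4, s₀ = 1

private
  ¼ 2ℚ 3ℚ : ℚ
  ¼ = + 1 ℚ./ 4
  2ℚ = + 2 ℚ./ 1
  3ℚ = + 3 ℚ./ 1

  iterate : ℚ → ℚ
  iterate s = s ℚ.+ ¼ ℚ.* (3ℚ ℚ.- s ℚ.* s)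

√3-seq : ℕ → ℚ
√3-seq zero    = 1ℚ
√3-seq (suc n) = iterate (√3-seq n)

private
  2⁻ : ℕ → ℚ
  2⁻ zero    = 1ℚ
  2⁻ (suc n) = ½ ℚ.* 2⁻ n

  ι : ℕ → ℚ
  ι n = ℤ→ℚ (+ n)

  ι-suc : ∀ n → ι (suc n) ≡ 1ℚ ℚ.+ ι n
  ι-suc n = ℚ.toℚᵘ-injective (ℚᵘ.≃-trans (ℚᵘ.*≡* eq)
    (ℚᵘ.≃-sym (ℚ.toℚᵘ-homo-+ 1ℚ (ι n))))
    where
    eq : + suc n ℤ.* + 1 ≡ (+ 1 ℤ.* + 1 ℤ.+ + n ℤ.* + 1) ℤ.* + 1
    eq = cong (ℤ._* + 1) (cong (ℤ._+_ (+ 1)) (sym (ℤ.*-identityʳ (+ n))))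

  ι≥0 : ∀ n → 0ℚ ℚ.≤ ι n
  ι≥0 n = ℚ.nonNegative⁻¹ (ι n)

  p≤q+ : ∀ {p q r} → p ℚ.≤ q → 0ℚ ℚ.≤ r → p ℚ.≤ q ℚ.+ r
  p≤q+ {p} p≤q r≥0 = subst (ℚ._≤ _) (ℚ.+-identityʳ p) (ℚ.+-mono-≤ p≤q r≥0)

  2⁻≥0 : ∀ n → 0ℚ ℚ.≤ 2⁻ n
  2⁻≥0 zero    = ℚ.nonNegative⁻¹ 1ℚ
  2⁻≥0 (suc n) = subst (ℚ._≤ 2⁻ (suc n)) (ℚ.*-zeroʳ ½) (ℚ.*-monoˡ-≤-nonNeg ½ (2⁻≥0 n))

  *-nonNeg : ∀ {p q} → 0ℚ ℚ.≤ p → 0ℚ ℚ.≤ q → 0ℚ ℚ.≤ p ℚ.* q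
  *-nonNeg {p} {q} p≥0 q≥0 = ℚ.nonNegative⁻¹ (p ℚ.* q)
    {{ℚ.nonNeg*nonNeg⇒nonNeg p {{ℚ.nonNegative p≥0}} q {{ℚ.nonNegative q≥0}}}}

  2⁻-bound : ∀ n → 2⁻ n ℚ.* ι (suc n) ℚ.≤ 1ℚ
  2⁻-bound zero    = ℚ.≤-refl
  2⁻-bound (suc n) = begin
    ½ ℚ.* 2⁻ n ℚ.* ι (suc (suc n))
      ≡⟨ cong (½ ℚ.* 2⁻ n ℚ.*_) (trans (ι-suc (suc n)) (cong (1ℚ ℚ.+_) (ι-suc n))) ⟩
    ½ ℚ.* 2⁻ n ℚ.* (1ℚ ℚ.+ (1ℚ ℚ.+ ι n))
      ≤⟨ p≤q+ ℚ.≤-refl (*-nonNeg (*-nonNeg (ℚ.nonNegative⁻¹ ½) (2⁻≥0 n)) (ι≥0 n)) ⟩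
    ½ ℚ.* 2⁻ n ℚ.* (1ℚ ℚ.+ (1ℚ ℚ.+ ι n)) ℚ.+ ½ ℚ.* 2⁻ n ℚ.* ι n
      ≡⟨ solve 2 (λ p i → con ½ :* p :* (con 1ℚ :+ (con 1ℚ :+ i)) :+ con ½ :* p :* i
                        := p :* (con 1ℚ :+ i)) refl (2⁻ n) (ι n) ⟩
    2⁻ n ℚ.* (1ℚ ℚ.+ ι n)
      ≡⟨ cong (2⁻ n ℚ.*_) (sym (ι-suc n)) ⟩
    2⁻ n ℚ.* ι (suc n)
      ≤⟨ 2⁻-bound n ⟩
    1ℚ ∎
    where open ℚ.≤-Reasoning

  archimedean : ∀ ε → 0ℚ ℚ.< ε → ∃[ N ] 1ℚ ℚ.≤ ε ℚ.* ι N
  archimedean (mkℚ (+ zero) d c) (*<* (ℤ.+<+ ()))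
  archimedean ε@(mkℚ (+ suc p) d c) _ = suc d , ℚ.toℚᵘ-cancel-≤
    (ℚᵘ.≤-respʳ-≃ (ℚᵘ.≃-sym (ℚ.toℚᵘ-homo-* ε (ι (suc d)))) (ℚᵘ.*≤* le))
    where
    le : + 1 ℤ.* + (suc d ℕ.* 1) ℤ.≤ (+ suc p ℤ.* + suc d) ℤ.* + 1
    le rewrite ℕ.*-identityʳ d | ℕ.*-identityʳ (d ℕ.+ p ℕ.* suc d) | ℕ.+-identityʳ d =
      ℤ.+≤+ (ℕ.s≤s (ℕ.m≤m+n d _))
  archimedean (mkℚ (ℤ.-[1+ _ ]) d c) (*<* ())

  2⁻-small : ∀ ε → 0ℚ ℚ.< ε → ∃[ N ] 2⁻ N ℚ.< ε
  2⁻-small ε ε>0 with archimedean ε ε>0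
  ... | N , 1≤ = N , ℚ.*-cancelʳ-<-nonNeg (ι (suc N)) (begin-strict
    2⁻ N ℚ.* ι (suc N)    ≤⟨ 2⁻-bound N ⟩
    1ℚ                    ≤⟨ 1≤ ⟩
    ε ℚ.* ι N             ≡⟨ sym (ℚ.+-identityˡ _) ⟩
    0ℚ ℚ.+ ε ℚ.* ι N      <⟨ ℚ.+-monoˡ-< (ε ℚ.* ι N) ε>0 ⟩
    ε ℚ.+ ε ℚ.* ι N       ≡⟨ solve 2 (λ e i → e :+ e :* i := e :* (con 1ℚ :+ i)) refl ε (ι N) ⟩
    ε ℚ.* (1ℚ ℚ.+ ι N)    ≡⟨ cong (ε ℚ.*_) (sym (ι-suc N)) ⟩
    ε ℚ.* ι (suc N)       ∎)
    where open ℚ.≤-Reasoning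

  0≤q-p : ∀ {p q} → p ℚ.≤ q → 0ℚ ℚ.≤ q ℚ.- p
  0≤q-p {p} {q} p≤q = subst (ℚ._≤ q ℚ.- p) (ℚ.+-inverseʳ p) (ℚ.+-monoˡ-≤ (ℚ.- p) p≤q)

  0≤q-p⁻¹ : ∀ {p q} → 0ℚ ℚ.≤ q ℚ.- p → p ℚ.≤ q
  0≤q-p⁻¹ {p} {q} h = subst₂ ℚ._≤_ (ℚ.+-identityˡ p)
    (solve 2 (λ p q → (q :- p) :+ p := q) refl p q) (ℚ.+-monoˡ-≤ p h)

  +-nonNeg : ∀ {p q} → 0ℚ ℚ.≤ p → 0ℚ ℚ.≤ q → 0ℚ ℚ.≤ p ℚ.+ q
  +-nonNeg {p} {q} = ℚ.+-mono-≤ {0ℚ} {p} {0ℚ} {q}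

  InRange : ℚ → Set
  InRange s = 0ℚ ℚ.≤ s ℚ.- 1ℚ × 0ℚ ℚ.≤ 2ℚ ℚ.- s

  iterate-range : ∀ {s} → InRange s → InRange (iterate s)
  iterate-range {s} (lo , hi) =
      subst (0ℚ ℚ.≤_)
        (solve 1 (λ s → con ¼ :* ((s :- con 1ℚ) :* (con 2ℚ :- s :+ con 1ℚ) :+ con 2ℚ)
                      := s :+ con ¼ :* (con 3ℚ :- s :* s) :- con 1ℚ) refl s)
        (*-nonNeg (ℚ.nonNegative⁻¹ ¼)
          (+-nonNeg (*-nonNeg lo (+-nonNeg hi (ℚ.nonNegative⁻¹ 1ℚ))) (ℚ.nonNegative⁻¹ 2ℚ)))
    , subst (0ℚ ℚ.≤_)
        (solve 1 (λ s → con ¼ :* ((con 2ℚ :- s) :* (con 2ℚ :- s) :+ con 1ℚ)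
                      := con 2ℚ :- (s :+ con ¼ :* (con 3ℚ :- s :* s))) refl s)
        (*-nonNeg (ℚ.nonNegative⁻¹ ¼)
          (+-nonNeg (*-nonNeg hi hi) (ℚ.nonNegative⁻¹ 1ℚ)))

  √3-range : ∀ n → InRange (√3-seq n)
  √3-range zero    = ℚ.nonNegative⁻¹ _ , ℚ.nonNegative⁻¹ _
  √3-range (suc n) = iterate-range {√3-seq n} (√3-range n)

  ∣∣-≤ : ∀ {p q} → p ℚ.≤ q → ℚ.- p ℚ.≤ q → ∣ p ∣ ℚ.≤ q
  ∣∣-≤ {p} p≤q -p≤q with ℚ.∣p∣≡p∨∣p∣≡-p p
  ... | inj₁ eq = subst (ℚ._≤ _) (sym eq) p≤q
  ... | inj₂ eq = subst (ℚ._≤ _) (sym eq) -p≤q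

  range-diff : ∀ {s t} → InRange s → InRange t → ∣ s ℚ.- t ∣ ℚ.≤ 1ℚ
  range-diff {s} {t} (ls , hs) (lt , ht) = ∣∣-≤
    (0≤q-p⁻¹ (subst (0ℚ ℚ.≤_)
      (solve 2 (λ s t → (con 2ℚ :- s) :+ (t :- con 1ℚ) := con 1ℚ :- (s :- t)) refl s t)
      (+-nonNeg hs lt)))
    (0≤q-p⁻¹ (subst (0ℚ ℚ.≤_)
      (solve 2 (λ s t → (con 2ℚ :- t) :+ (s :- con 1ℚ) := con 1ℚ :- :- (s :- t)) refl s t)
      (+-nonNeg ht ls)))

  contract : ∀ {s t} → InRange s → InRange t →
             ∣ iterate s ℚ.- iterate t ∣ ℚ.≤ ½ ℚ.* ∣ s ℚ.- t ∣
  contract {s} {t} (ls , hs) (lt , ht) = begin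
    ∣ iterate s ℚ.- iterate t ∣
      ≡⟨ cong ∣_∣ (solve 2 (λ s t →
           (s :+ con ¼ :* (con 3ℚ :- s :* s)) :- (t :+ con ¼ :* (con 3ℚ :- t :* t))
           := (con ¼ :* ((con 2ℚ :- s) :+ (con 2ℚ :- t))) :* (s :- t)) refl s t) ⟩
    ∣ k ℚ.* (s ℚ.- t) ∣
      ≡⟨ ℚ.∣p*q∣≡∣p∣*∣q∣ k (s ℚ.- t) ⟩
    ∣ k ∣ ℚ.* ∣ s ℚ.- t ∣
      ≡⟨ cong (ℚ._* ∣ s ℚ.- t ∣) (ℚ.0≤p⇒∣p∣≡p k≥0) ⟩
    k ℚ.* ∣ s ℚ.- t ∣
      ≤⟨ ℚ.*-monoʳ-≤-nonNeg ∣ s ℚ.- t ∣ {{ℚ.∣-∣-nonNeg (s ℚ.- t)}} k≤½ ⟩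
    ½ ℚ.* ∣ s ℚ.- t ∣ ∎
    where
    open ℚ.≤-Reasoning
    k = ¼ ℚ.* ((2ℚ ℚ.- s) ℚ.+ (2ℚ ℚ.- t))
    k≥0 : 0ℚ ℚ.≤ k
    k≥0 = *-nonNeg (ℚ.nonNegative⁻¹ ¼) (+-nonNeg hs ht)
    k≤½ : k ℚ.≤ ½
    k≤½ = 0≤q-p⁻¹ (subst (0ℚ ℚ.≤_)
      (solve 2 (λ s t → con ¼ :* ((s :- con 1ℚ) :+ (t :- con 1ℚ))
                      := con ½ :- con ¼ :* ((con 2ℚ :- s) :+ (con 2ℚ :- t))) refl s t)
      (*-nonNeg (ℚ.nonNegative⁻¹ ¼) (+-nonNeg ls lt)))

  √3-diff : ∀ N m n → N ℕ.≤ m → N ℕ.≤ n → ∣ √3-seq m ℚ.- √3-seq n ∣ ℚ.≤ 2⁻ N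
  √3-diff zero    m n _ _ = range-diff {√3-seq m} {√3-seq n} (√3-range m) (√3-range n)
  √3-diff (suc N) (suc m) (suc n) (ℕ.s≤s m≥) (ℕ.s≤s n≥) =
    ℚ.≤-trans (contract {√3-seq m} {√3-seq n} (√3-range m) (√3-range n))
              (ℚ.*-monoˡ-≤-nonNeg ½ (√3-diff N m n m≥ n≥))

  abstract
    √3-isCauchy : IsCauchy √3-seq
    √3-isCauchy ε ε>0 = let N , small = 2⁻-small ε ε>0 in
      N , λ m n m≥ n≥ → ℚ.≤-<-trans (√3-diff N m n m≥ n≥) small

√3 : ℝ
√3 = mkℝ √3-seq √3-isCauchy

√3-square : √3 * √3 ≈ fromℤ (+ 3)
√3-square ε ε>0 = let N , p = √3-isCauchy (¼ ℚ.* ε) (*-pos (ℚ.positive⁻¹ ¼) ε>0) in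
  N , λ n n≥ → begin-strict
  ∣ √3-seq n ℚ.* √3-seq n ℚ.- 3ℚ ∣
    ≡⟨ cong ∣_∣ (residual (√3-seq n)) ⟩
  ∣ 4ℚ ℚ.* (√3-seq n ℚ.- iterate (√3-seq n)) ∣
    ≡⟨ ℚ.∣p*q∣≡∣p∣*∣q∣ 4ℚ (√3-seq n ℚ.- iterate (√3-seq n)) ⟩
  4ℚ ℚ.* ∣ √3-seq n ℚ.- iterate (√3-seq n) ∣
    <⟨ ℚ.*-monoʳ-<-pos 4ℚ (p n (suc n) n≥ (ℕ.m≤n⇒m≤1+n n≥)) ⟩
  4ℚ ℚ.* (¼ ℚ.* ε)
    ≡⟨ solve 1 (λ e → con 4ℚ :* (con ¼ :* e) := e) refl ε ⟩
  ε ∎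
  where
  open ℚ.≤-Reasoning
  4ℚ = + 4 ℚ./ 1
  residual : ∀ s → s ℚ.* s ℚ.- 3ℚ ≡ 4ℚ ℚ.* (s ℚ.- iterate s)
  residual = solve 1 (λ s → s :* s :- con 3ℚ
    := con 4ℚ :* (s :- (s :+ con ¼ :* (con 3ℚ :- s :* s)))) refl

√3-positive : 0ℝ < √3
√3-positive = ½ , ℚ.positive⁻¹ ½ , 0 , λ n _ →
  ℚ.<-≤-trans (*<* (ℤ.+<+ (ℕ.s≤s (ℕ.s≤s ℕ.z≤n)))) (0≤q-p⁻¹ {1ℚ} {√3-seq n} (proj₁ (√3-range n)))

infix 5 _+i_

record ℂ : Set where
  constructor _+i_
  field
    re im : ℝ

open ℂ public

infixl 6 _⊕_ _⊖_
infixl 7 _⊗_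
infixr 7 _·_
infix  8 ⊖_
infix  4 _≋_ _♯_

_≋_ _♯_ : Rel ℂ 0ℓ
v ≋ w = re v ≈ re w × im v ≈ im w
v ♯ w = re v # re w ⊎ im v # im w

_⊕_ : ℂ → ℂ → ℂ
v ⊕ w = (re v + re w) +i (im v + im w)

⊖_ : ℂ → ℂ
⊖ v = (- re v) +i (- im v)

_⊖_ : ℂ → ℂ → ℂ
v ⊖ w = v ⊕ (⊖ w)

_⊗_ : ℂ → ℂ → ℂ
v ⊗ w = (re v * re w - im v * im w) +i (re v * im w + im v * re w)

_·_ : ℝ → ℂ → ℂ
c · v = (c * re v) +i (c * im v)

⟨_,_⟩ : ℂ → ℂ → ℝ
⟨ v , w ⟩ = re v * re w + im v * im w

0ℂ 1ℂ : ℂ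
0ℂ = 0ℝ +i 0ℝ
1ℂ = 1ℝ +i 0ℝ

-- e^{2πi/3} = -1/2 + (√3/2) i
ω : ℂ
ω = fromℚ ℚ.-½ +i (fromℚ ½ * √3)

record IsBasis (b₁ b₂ : ℂ) : Set where
  field
    independent : ∀ x y → x · b₁ ⊕ y · b₂ ≋ 0ℂ → x ≈ 0ℝ × y ≈ 0ℝ
    spanning    : ∀ v → ∃₂ λ x y → v ≋ x · b₁ ⊕ y · b₂

ℤ-span : ℂ → ℂ → Pred ℂ 0ℓ
ℤ-span b₁ b₂ v = ∃₂ λ m n → v ≋ fromℤ m · b₁ ⊕ fromℤ n · b₂

IsLattice : Pred ℂ 0ℓ → Set
IsLattice L = ∃₂ λ b₁ b₂ → IsBasis b₁ b₂ × L ≐ ℤ-span b₁ b₂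

infixr 7 _·ₛ_

_·ₛ_ : ℝ → Pred ℂ 0ℓ → Pred ℂ 0ℓ
(c ·ₛ X) v = ∃[ w ] w ∈ X × v ≋ c · w

-- The index is the number of cosets of M in L, counted by a complete
-- irredundant family of coset representatives.
HasIndex : (L M : Pred ℂ 0ℓ) → ℕ → Set
HasIndex L M k = Σ[ r ∈ (Fin k → ℂ) ]
  (∀ i → r i ∈ L) ×
  (∀ v → v ∈ L → ∃[ i ] (v ⊖ r i) ∈ M) ×
  (∀ i j → (r i ⊖ r j) ∈ M → i ≡ j)

record QuadraticForm : Set where
  constructor quadraticForm
  field
    a b c : ℝ

⟦_⟧ : QuadraticForm → ℂ → ℝ
⟦ quadraticForm a b c ⟧ v = a * (re v * re v) + b * (re v * im v) + c * (im v * im v)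

-- v ♯ 0ℂ rather than ¬ (v ≋ 0ℂ): without Markov's principle the latter does
-- not yield 0 < ⟨ v , v ⟩ even for the standard dot product.
PositiveDefinite : QuadraticForm → Set
PositiveDefinite B = ∀ v → v ♯ 0ℂ → 0ℝ < ⟦ B ⟧ v

-- Q is the form being tested (the dot product, or a competing form B) and
-- u its common value on S′.
record Tempers (L M S S′ : Pred ℂ 0ℓ) (Q : ℂ → ℝ) (u : ℝ) : Set where
  field
    on-S   : ∀ v → v ∈ S → Q v ≈ 1ℝ
    off-S  : ∀ v → v ∈ L → v ∉ M → v ∉ S → 1ℝ < Q v
    1≤u    : 1ℝ ≤ u
    on-S′  : ∀ v → v ∈ S′ → Q v ≈ u
    off-S′ : ∀ v → v ∈ M → ¬ (v ≋ 0ℂ) → v ∉ S′ → u < Q v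

-- Here L and M have already been rescaled.
record Tempered (L M S S′ : Pred ℂ 0ℓ) : Set where
  field
    S-resp      : S Respects _≋_
    S′-resp     : S′ Respects _≋_
    S-nonempty  : Satisfiable S
    S′-nonempty : Satisfiable S′
    S⊆L-M       : ∀ v → v ∈ S → v ∈ L × v ∉ M
    S′⊆M-0      : ∀ v → v ∈ S′ → v ∈ M × ¬ (v ≋ 0ℂ)
    u           : ℝ
    tempers     : Tempers L M S S′ (λ v → ⟨ v , v ⟩) u
    perfect     : ∀ B u′ → PositiveDefinite B → Tempers L M S S′ ⟦ B ⟧ u′ →
                  (∀ v → ⟦ B ⟧ v ≈ ⟨ v , v ⟩) × u′ ≈ u

-- S is the disjoint union of the s two-element sets {p i, -p i}.
ConsistsOfPairs : ℕ → Pred ℂ 0ℓ → Set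
ConsistsOfPairs s S = Σ[ p ∈ (Fin s → ℂ) ]
  (∀ v → v ∈ S ⇔ (∃[ i ] (v ≋ p i ⊎ v ≋ ⊖ p i))) ×
  (∀ i → ¬ (p i ≋ ⊖ p i)) ×
  (∀ i j → p i ≋ p j ⊎ p i ≋ ⊖ p j → i ≡ j)

-- Tempered perfect lattices of index ℓ that are s-and-s′ forms: S and S′ are
-- attached to the rescaled pair (scale L, scale M).
record IsForm (s s′ ℓ : ℕ) (L M : Pred ℂ 0ℓ) : Set₁ where
  field
    L-lattice : IsLattice L
    M-lattice : IsLattice M
    M⊆L       : M ⊆ L
    hasIndex  : HasIndex L M ℓ
    scale     : ℝ
    scale>0   : 0ℝ < scale
    S S′      : Pred ℂ 0ℓ
    tempered  : Tempered (scale ·ₛ L) (scale ·ₛ M) S S′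
    S-pairs   : ConsistsOfPairs s S
    S′-pairs  : ConsistsOfPairs s′ S′

record OrthogonalTransformation : Set where
  field
    T           : ℂ → ℂ
    T-cong      : ∀ v w → v ≋ w → T v ≋ T w
    T-⊕         : ∀ v w → T (v ⊕ w) ≋ T v ⊕ T w
    T-·         : ∀ c v → T (c · v) ≋ c · T v
    T-preserves : ∀ v w → ⟨ T v , T w ⟩ ≈ ⟨ v , w ⟩

open OrthogonalTransformation using (T)

image : OrthogonalTransformation → Pred ℂ 0ℓ → Pred ℂ 0ℓ
image τ X v = ∃[ w ] w ∈ X × v ≋ T τ w

Equivalent : (L M L′ M′ : Pred ℂ 0ℓ) → Set
Equivalent L M L′ M′ = Σ[ τ ∈ OrthogonalTransformation ] Σ[ c ∈ ℝ ]
  0ℝ < c × c ·ₛ image τ L ≐ L′ × c ·ₛ image τ M ≐ M′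

ℤ[ω] : Pred ℂ 0ℓ
ℤ[ω] = ℤ-span 1ℂ ω

record IsIdeal (P : Pred ℂ 0ℓ) : Set where
  field
    respects : P Respects _≋_
    ⊆ℤ[ω]    : P ⊆ ℤ[ω]
    0-closed : 0ℂ ∈ P
    +-closed : ∀ x y → x ∈ P → y ∈ P → (x ⊕ y) ∈ P
    *-closed : ∀ x y → x ∈ ℤ[ω] → y ∈ P → (x ⊗ y) ∈ P

record IsPrimeIdeal (P : Pred ℂ 0ℓ) : Set where
  field
    isIdeal : IsIdeal P
    proper  : 1ℂ ∉ P
    prime   : ∀ x y → x ∈ ℤ[ω] → y ∈ ℤ[ω] → (x ⊗ y) ∈ P → x ∈ P ⊎ y ∈ P

-- P ∩ ℤ = ℓℤ
LiesOver : Pred ℂ 0ℓ → ℕ → Set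
LiesOver P ℓ = ∀ k → (fromℤ k · 1ℂ) ∈ P ⇔ (+ ℓ) ℤ.∣ k

{-# OPTIONS --safe #-}

-- All nonzero vectors of L have length at least 1, attained on S, and all nonzero vectors of M have
-- length at least √u, attained on S′. A plane lattice with three pairs ±v of minimal vectors is
-- hexagonal: two of these vectors form a basis by reduction, and the length of the third one gives
-- 2⟨p,q⟩ = ∓|p|². So L becomes ℤ[ω] under an isometry, and M has a basis α, β with
-- |α|² = |β|² = u and 2⟨α,β⟩ = -u, whence β = ωα or α = ωβ by integer arithmetic, and M is the ideal
-- generated by α or β. The norm a² - ab + b² of the generator divides ℓ and is divisible by ℓ,
-- which forces ℓ = 3 or ℓ ≡ 1 mod 6.
module Submission where

open import Algebra.Bundles using (CommutativeRing)
import Algebra.Properties.CommutativeMonoid.Sum as Sum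
import Algebra.Solver.Ring as RingSolver
import Algebra.Solver.Ring.AlmostCommutativeRing as AlmostCommutativeRing
open import Algebra.Structures using (IsCommutativeRing)
open import Data.Empty using (⊥; ⊥-elim)
open import Data.Fin as Fin using (Fin; toℕ)
import Data.Fin.Permutation as Perm
import Data.Fin.Properties as Fin
open import Data.Integer as ℤ using (ℤ; +_; -[1+_]; 0ℤ; 1ℤ; -1ℤ)
import Data.Integer.DivMod as ℤ
import Data.Integer.Divisibility as ℤᵘ using (_∣_)
import Data.Integer.Divisibility.Signed as ℤ using (divides; ∣ᵤ⇒∣)
import Data.Integer.Properties as ℤ
open import Data.Integer.Tactic.RingSolver using () renaming (solve-∀ to ℤ-ring-∀)
open import Data.List using (List; []; _∷_)
open import Data.Maybe using (map)
open import Data.Nat as ℕ using (ℕ; zero; suc; _%_)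
import Data.Nat.Coprimality as ℕ
import Data.Nat.Divisibility as ℕ
import Data.Nat.DivMod as ℕ
import Data.Nat.GCD as ℕ
open import Data.Nat.Primality
  using (Prime; euclidsLemma; prime⇒irreducible; prime⇒nonTrivial; prime⇒nonZero)
import Data.Nat.Properties as ℕ
open import Data.Nat.Tactic.RingSolver using () renaming (solve-∀ to ℕ-ring-∀)
open import Data.Product using (∃₂; ∃-syntax; Σ-syntax; _×_; _,_; proj₁; proj₂)
open import Data.Rational as ℚ using (ℚ; 0ℚ; 1ℚ; ½; ∣_∣)
open import Data.Rational.Literals using () renaming (fromℤ to ℤ→ℚ)
import Data.Rational.Properties as ℚ
import Data.Rational.Unnormalised as ℚᵘ
import Data.Rational.Unnormalised.Properties as ℚᵘ
open import Data.Sum using (_⊎_; inj₁; inj₂)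
open import Data.Unit using (⊤; tt)
open import Function using (_∘_; mk⇔; Equivalence)
open import Level using (0ℓ)
open import Relation.Binary.Definitions using (_Respects_)
open import Relation.Binary.PropositionalEquality as ≡
  using (_≡_; _≢_; cong; cong₂; subst; subst₂)
open import Relation.Nullary using (¬_; Dec; yes; no)
open import Relation.Nullary.Decidable using (dec⇒maybe; _×-dec_)
open import Relation.Unary using (Pred; _∈_; _⊆_; _≐_)
open import Tactic.RingSolver using () renaming (solve-∀ to ring-∀)
import Tactic.RingSolver.Core.AlmostCommutativeRing as TacticRing

-- Integers

-- The order of the constructive reals is undecidable, so lattice vectors cannot be compared in
-- length and shortened step by step. The given minimal vectors take the place of such an algorithm:
-- two of them have an integer determinant `D`, and the rounding of the Cramer coefficients takes
-- place in ℤ. Weak inequality is the negation `NonNeg`, and the length estimates for integer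
-- combinations are brought to the form `k u ≥ 0` with `k` an integer and `u > 0`, which is an
-- inequality in ℤ. Once L is identified, `u` is itself the norm of an Eisenstein integer, so that
-- the shape of M becomes a question about four integers. That the ideal is prime comes from an
-- integer `t` congruent to ω: it exists by the pigeonhole principle on the ℓ cosets, the quotient
-- is then ℤ/ℓ, and Euclid's lemma applies to residues.

∣i∣≡±i : ∀ i → ∃[ s ] + ℤ.∣ i ∣ ≡ s ℤ.* i
∣i∣≡±i (+ n)      = 1ℤ , ≡.sym (ℤ.*-identityˡ (+ n))
∣i∣≡±i -[1+ n ]   = -1ℤ , ≡.sym (ℤ.-1*i≡-i -[1+ n ])

-- The Euclidean remainder can be almost `|d|`, too large for `reduced-norm`. A remainder above
-- `|d|/2` is lowered by `|d| = s d`, with `s` the sign of `d`, while the quotient grows by `s`.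
centred-division : ∀ d → d ≢ 0ℤ → ∀ x →
  ∃₂ λ q r → x ≡ q ℤ.* d ℤ.+ r × 2 ℕ.* ℤ.∣ r ∣ ℕ.≤ ℤ.∣ d ∣
centred-division d d≢0 x = centre (2 ℕ.* r ℕ.≤? ℤ.∣ d ∣)
  where
  instance _ = ℤ.≢-nonZero d≢0
  r = x ℤ.% d
  q = x ℤ./ d
  x≡qd+r : x ≡ q ℤ.* d ℤ.+ + r
  x≡qd+r = ≡.trans (ℤ.a≡a%n+[a/n]*n x d) (ℤ.+-comm (+ r) (q ℤ.* d))
  s = proj₁ (∣i∣≡±i d)
  shift : ∀ q d r s → q ℤ.* d ℤ.+ r ≡ (q ℤ.+ s) ℤ.* d ℤ.+ (r ℤ.- s ℤ.* d)
  shift = ℤ-ring-∀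
  centre : Dec (2 ℕ.* r ℕ.≤ ℤ.∣ d ∣) →
    ∃₂ λ q r → x ≡ q ℤ.* d ℤ.+ r × 2 ℕ.* ℤ.∣ r ∣ ℕ.≤ ℤ.∣ d ∣
  centre (yes 2r≤d) = q , + r , x≡qd+r , 2r≤d
  centre (no 2r≰d) = q ℤ.+ s , r ℤ.⊖ ℤ.∣ d ∣ , eq , le
    where
    eq : x ≡ (q ℤ.+ s) ℤ.* d ℤ.+ (r ℤ.⊖ ℤ.∣ d ∣)
    eq = ≡.trans x≡qd+r (≡.trans (shift q d (+ r) s) (cong (ℤ._+_ ((q ℤ.+ s) ℤ.* d))
      (≡.trans (cong (λ t → + r ℤ.- t) (≡.sym (proj₂ (∣i∣≡±i d)))) (ℤ.m-n≡m⊖n r ℤ.∣ d ∣))))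
    le : 2 ℕ.* ℤ.∣ r ℤ.⊖ ℤ.∣ d ∣ ∣ ℕ.≤ ℤ.∣ d ∣
    le = begin
      2 ℕ.* ℤ.∣ r ℤ.⊖ ℤ.∣ d ∣ ∣    ≡⟨ cong (2 ℕ.*_) (ℤ.∣⊖∣-≤ (ℕ.<⇒≤ (ℤ.n%d<d x d))) ⟩
      2 ℕ.* (ℤ.∣ d ∣ ℕ.∸ r)        ≡⟨ ℕ.*-distribˡ-∸ 2 ℤ.∣ d ∣ r ⟩
      2 ℕ.* ℤ.∣ d ∣ ℕ.∸ 2 ℕ.* r    ≤⟨ ℕ.∸-monoʳ-≤ (2 ℕ.* ℤ.∣ d ∣) (ℕ.<⇒≤ (ℕ.≰⇒> 2r≰d)) ⟩
      2 ℕ.* ℤ.∣ d ∣ ℕ.∸ ℤ.∣ d ∣    ≡⟨ ℕ.m+n∸m≡n ℤ.∣ d ∣ _ ⟩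
      ℤ.∣ d ∣ ℕ.+ 0                ≡⟨ ℕ.+-identityʳ ℤ.∣ d ∣ ⟩
      ℤ.∣ d ∣                      ∎
      where open ℕ.≤-Reasoning

i*i≡∣i∣*∣i∣ : ∀ i → i ℤ.* i ≡ + (ℤ.∣ i ∣ ℕ.* ℤ.∣ i ∣)
i*i≡∣i∣*∣i∣ (+ n)    = ≡.sym (ℤ.pos-* n n)
i*i≡∣i∣*∣i∣ -[1+ n ] = ≡.refl

-- 4(x² + y² + xy) ≤ 3d² < 4d²
reduced-norm : ∀ d x y → 0 ℕ.< d → 2 ℕ.* x ℕ.≤ d → 2 ℕ.* y ℕ.≤ d →
  4 ℕ.* (x ℕ.* x ℕ.+ y ℕ.* y ℕ.+ x ℕ.* y) ℕ.< 4 ℕ.* (d ℕ.* d)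
reduced-norm d x y d>0 2x≤d 2y≤d = begin-strict
  4 ℕ.* (x ℕ.* x ℕ.+ y ℕ.* y ℕ.+ x ℕ.* y)
    ≡⟨ doubles x y ⟩
  (2 ℕ.* x) ℕ.* (2 ℕ.* x) ℕ.+ (2 ℕ.* y) ℕ.* (2 ℕ.* y) ℕ.+ (2 ℕ.* x) ℕ.* (2 ℕ.* y)
    ≤⟨ ℕ.+-mono-≤ (ℕ.+-mono-≤ (ℕ.*-mono-≤ 2x≤d 2x≤d) (ℕ.*-mono-≤ 2y≤d 2y≤d)) (ℕ.*-mono-≤ 2x≤d 2y≤d) ⟩
  d ℕ.* d ℕ.+ d ℕ.* d ℕ.+ d ℕ.* d
    <⟨ ℕ.m<m+n _ (ℕ.*-mono-< d>0 d>0) ⟩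
  d ℕ.* d ℕ.+ d ℕ.* d ℕ.+ d ℕ.* d ℕ.+ d ℕ.* d
    ≡⟨ quadruple d ⟩
  4 ℕ.* (d ℕ.* d) ∎
  where
  open ℕ.≤-Reasoning
  doubles : ∀ x y → 4 ℕ.* (x ℕ.* x ℕ.+ y ℕ.* y ℕ.+ x ℕ.* y) ≡
    (2 ℕ.* x) ℕ.* (2 ℕ.* x) ℕ.+ (2 ℕ.* y) ℕ.* (2 ℕ.* y) ℕ.+ (2 ℕ.* x) ℕ.* (2 ℕ.* y)
  doubles = ℕ-ring-∀
  quadruple : ∀ d → d ℕ.* d ℕ.+ d ℕ.* d ℕ.+ d ℕ.* d ℕ.+ d ℕ.* d ≡ 4 ℕ.* (d ℕ.* d)
  quadruple = ℕ-ring-∀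

-- This is `(x - y)² ≥ 0` without subtraction: the larger number is the smaller plus `k`, and `k²`
-- is the slack.
2xy≤x²+y² : ∀ x y → 2 ℕ.* (x ℕ.* y) ℕ.≤ x ℕ.* x ℕ.+ y ℕ.* y
2xy≤x²+y² x y = unordered (ℕ.≤-total x y)
  where
  expand : ∀ x k → 2 ℕ.* (x ℕ.* (x ℕ.+ k)) ℕ.+ k ℕ.* k ≡ x ℕ.* x ℕ.+ (x ℕ.+ k) ℕ.* (x ℕ.+ k)
  expand = ℕ-ring-∀
  ordered : ∀ {x y} → x ℕ.≤ y → 2 ℕ.* (x ℕ.* y) ℕ.≤ x ℕ.* x ℕ.+ y ℕ.* y
  ordered {x} x≤y with ℕ.m≤n⇒∃[o]m+o≡n x≤y
  ... | k , ≡.refl = subst (2 ℕ.* (x ℕ.* (x ℕ.+ k)) ℕ.≤_) (expand x k) (ℕ.m≤m+n _ (k ℕ.* k))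
  unordered : x ℕ.≤ y ⊎ y ℕ.≤ x → 2 ℕ.* (x ℕ.* y) ℕ.≤ x ℕ.* x ℕ.+ y ℕ.* y
  unordered (inj₁ x≤y) = ordered x≤y
  unordered (inj₂ y≤x) = subst₂ ℕ._≤_ (cong (2 ℕ.*_) (ℕ.*-comm y x)) (ℕ.+-comm (y ℕ.* y) (x ℕ.* x)) (ordered y≤x)

-- With `s = x² + y²`, doubling the hypothesis gives `2s ≤ 2xy + 2 ≤ s + 2`, hence `s ≤ 2`.
short-coefficients : ∀ x y → x ℕ.* x ℕ.+ y ℕ.* y ℕ.≤ x ℕ.* y ℕ.+ 1 → x ℕ.≤ 1 × y ℕ.≤ 1
short-coefficients x y h = small (ℕ.m+n≤o⇒m≤o (x ℕ.* x) s≤2) , small (ℕ.m+n≤o⇒n≤o (x ℕ.* x) s≤2)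
  where
  s = x ℕ.* x ℕ.+ y ℕ.* y
  s≤2 : s ℕ.≤ 2
  s≤2 = ℕ.+-cancelˡ-≤ s s 2 (begin
    s ℕ.+ s                          ≡⟨ double s ⟩
    2 ℕ.* s                          ≤⟨ ℕ.*-monoʳ-≤ 2 h ⟩
    2 ℕ.* (x ℕ.* y ℕ.+ 1)            ≡⟨ ℕ.*-distribˡ-+ 2 (x ℕ.* y) 1 ⟩
    2 ℕ.* (x ℕ.* y) ℕ.+ 2            ≤⟨ ℕ.+-monoˡ-≤ 2 (2xy≤x²+y² x y) ⟩
    s ℕ.+ 2                          ∎)
    where
    open ℕ.≤-Reasoning
    double : ∀ s → s ℕ.+ s ≡ 2 ℕ.* s
    double = ℕ-ring-∀
  small : ∀ {x} → x ℕ.* x ℕ.≤ 2 → x ℕ.≤ 1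
  small {zero}        _ = ℕ.z≤n
  small {suc zero}    _ = ℕ.s≤s ℕ.z≤n
  small {suc (suc x)} le = ⊥-elim (ℕ.<⇒≱ (ℕ.*-mono-≤ {2} {suc (suc x)} {2} {suc (suc x)} 2≤ 2≤) (ℕ.≤-trans le (ℕ.s≤s (ℕ.s≤s ℕ.z≤n))))
    where 2≤ = ℕ.s≤s (ℕ.s≤s (ℕ.z≤n {x}))

-- Minimal vectors of binary quadratic forms

-- Exactly the order structure that constructive reals provide: strict positivity without
-- trichotomy, and the tightness law `≯0∧≮0⇒≈0` as the way from order back to equality. The
-- computations with forms then see ring operations only, not Cauchy sequences.
record OrderedRing : Set₁ where
  field
    commutativeRing : CommutativeRing 0ℓ 0ℓ
  open CommutativeRing commutativeRing public
  field
    Pos         : Carrier → Set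
    Pos-resp    : ∀ {x y} → x ≈ y → Pos x → Pos y
    Pos-+       : ∀ {x y} → Pos x → Pos y → Pos (x + y)
    Pos-*       : ∀ {x y} → Pos x → Pos y → Pos (x * y)
    Pos-irrefl  : ∀ {x} → x ≈ 0# → ¬ Pos x
    ≯0∧≮0⇒≈0    : ∀ {x} → ¬ Pos x → ¬ Pos (- x) → x ≈ 0#
    ι           : ℤ → Carrier
    ι-+         : ∀ i j → ι (i ℤ.+ j) ≈ ι i + ι j
    ι-*         : ∀ i j → ι (i ℤ.* j) ≈ ι i * ι j
    ι-neg       : ∀ i → ι (ℤ.- i) ≈ - ι i
    ι-0         : ι 0ℤ ≈ 0#
    ι-1         : ι 1ℤ ≈ 1#
    Pos-ι       : ∀ n → Pos (ι (+ suc n))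

module OrderedRingProperties (R : OrderedRing) where
  open OrderedRing R

  private
    almostCommutativeRing = AlmostCommutativeRing.fromCommutativeRing commutativeRing

    ι-morphism : CommutativeRing.rawRing ℤ.+-*-commutativeRing
                   AlmostCommutativeRing.-Raw-AlmostCommutative⟶ almostCommutativeRing
    ι-morphism = record
      { ⟦_⟧ = ι ; +-homo = ι-+ ; *-homo = ι-* ; -‿homo = ι-neg ; 0-homo = ι-0 ; 1-homo = ι-1 }

  -- The coefficients are integers because the solver must compare coefficients, and equality in the
  -- ring itself need not be decidable.
  open RingSolver (CommutativeRing.rawRing ℤ.+-*-commutativeRing) almostCommutativeRing ι-morphism
    (λ i j → map (λ eq → reflexive (cong ι eq)) (dec⇒maybe (i ℤ.≟ j))) public
    using (solve; con; _:=_; _:+_; _:*_; _:-_; :-_)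

  -- Turns a hypothesis into a goal for the ring solver: only the two differences have to agree
  -- identically.
  lin : ∀ {a b x y} → a ≈ b → x - y ≈ a - b → x ≈ y
  lin {a} {b} {x} {y} h eq = trans (solve 2 (λ x y → x := x :- y :+ y) refl x y)
    (trans (+-congʳ (trans eq (trans (+-congʳ h) (-‿inverseʳ b)))) (+-identityˡ y))

  -- Being a negation, it can be proved by case distinctions on signs that hold only up to double
  -- negation.
  NonNeg : Carrier → Set
  NonNeg x = ¬ Pos (- x)

  NonNeg-resp : ∀ {x y} → x ≈ y → NonNeg x → NonNeg y
  NonNeg-resp h x≥0 p = x≥0 (Pos-resp (-‿cong (sym h)) p)

  Pos⇒NonNeg : ∀ {x} → Pos x → NonNeg x
  Pos⇒NonNeg {x} p q = Pos-irrefl (-‿inverseʳ x) (Pos-+ p q)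

  open import Algebra.Properties.Ring ring using (-0#≈0#)

  ≈0⇒NonNeg : ∀ {x} → x ≈ 0# → NonNeg x
  ≈0⇒NonNeg h = Pos-irrefl (trans (-‿cong h) -0#≈0#)

  -- Let `-(x + y)` be positive. If `x` were positive, so would be `-y`; hence `x ≈ 0` by tightness,
  -- and `-y` is positive all the same.
  NonNeg-+ : ∀ {x y} → NonNeg x → NonNeg y → NonNeg (x + y)
  NonNeg-+ {x} {y} x≥0 y≥0 p = y≥0 (Pos-resp (-‿cong (trans (+-congʳ x≈0) (+-identityˡ y))) p)
    where
    x≈0 : x ≈ 0#
    x≈0 = ≯0∧≮0⇒≈0 (λ x>0 → y≥0 (Pos-resp
      (solve 2 (λ x y → :- (x :+ y) :+ x := :- y) refl x y) (Pos-+ p x>0))) x≥0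

  -- The goal is a negation, so each factor may be taken to be either zero or positive.
  NonNeg-* : ∀ {x y} → NonNeg x → NonNeg y → NonNeg (x * y)
  NonNeg-* {x} {y} x≥0 y≥0 p = ¬¬Pos x≥0
    (λ x≈0 → zero-product (trans (*-congʳ x≈0) (zeroˡ y)))
    λ x>0 → ¬¬Pos y≥0 (λ y≈0 → zero-product (trans (*-congˡ y≈0) (zeroʳ x)))
    λ y>0 → Pos⇒NonNeg (Pos-* x>0 y>0) p
    where
    ¬¬Pos : ∀ {z} → NonNeg z → ¬ z ≈ 0# → ¬ ¬ Pos z
    ¬¬Pos z≥0 z≉0 z≯0 = z≉0 (≯0∧≮0⇒≈0 z≯0 z≥0)
    zero-product : ¬ x * y ≈ 0#
    zero-product h = ≈0⇒NonNeg h p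

  NonNeg-ι : ∀ n → NonNeg (ι (+ n))
  NonNeg-ι zero    = ≈0⇒NonNeg ι-0
  NonNeg-ι (suc n) = Pos⇒NonNeg (Pos-ι n)

  -- Brings real estimates back to ℤ without dividing by `u`: a negative `k` would make `-(k u)`
  -- positive.
  ι-0≤ : ∀ {u} → Pos u → ∀ k → NonNeg (ι k * u) → 0ℤ ℤ.≤ k
  ι-0≤ u>0 (+ n)    _ = ℤ.+≤+ ℕ.z≤n
  ι-0≤ {u} u>0 -[1+ n ] h = ⊥-elim (h (Pos-resp
    (trans (*-congʳ (ι-neg -[1+ n ])) (solve 2 (λ k u → :- k :* u := :- (k :* u)) refl (ι -[1+ n ]) u))
    (Pos-* (Pos-ι n) u>0)))

  -- Neither sign is possible for `x - y`, since multiplication by `c` would preserve it; tightness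
  -- then replaces division by `c`.
  *-cancelˡ-Pos : ∀ {c} → Pos c → ∀ x y → c * x ≈ c * y → x ≈ y
  *-cancelˡ-Pos {c} c>0 x y h = trans (solve 2 (λ x y → x := x :- y :+ y) refl x y)
    (trans (+-congʳ (≯0∧≮0⇒≈0
      (λ x>y → Pos-irrefl c[x-y]≈0 (Pos-* c>0 x>y))
      (λ x<y → Pos-irrefl c[x-y]≈0′ (Pos-* c>0 x<y)))) (+-identityˡ y))
    where
    c[x-y]≈0 : c * (x - y) ≈ 0#
    c[x-y]≈0 = trans (solve 3 (λ c x y → c :* (x :- y) := c :* x :- c :* y) refl c x y)
      (trans (+-congʳ h) (-‿inverseʳ (c * y)))
    c[x-y]≈0′ : c * - (x - y) ≈ 0#
    c[x-y]≈0′ = trans (solve 3 (λ c x y → c :* :- (x :- y) := :- (c :* (x :- y))) refl c x y)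
      (trans (-‿cong c[x-y]≈0) -0#≈0#)

  NonNeg-trans : ∀ x y z → NonNeg (x - y) → NonNeg (y - z) → NonNeg (x - z)
  NonNeg-trans x y z x≥y y≥z = NonNeg-resp
    (solve 3 (λ x y z → (x :- y) :+ (y :- z) := x :- z) refl x y z) (NonNeg-+ x≥y y≥z)

  ι-≡0 : ∀ k → ι k ≈ 0# → k ≡ 0ℤ
  ι-≡0 (+ zero)  _ = ≡.refl
  ι-≡0 (+ suc n) h = ⊥-elim (Pos-irrefl h (Pos-ι n))
  ι-≡0 -[1+ n ]  h = ⊥-elim (Pos-irrefl
    (trans (ι-neg -[1+ n ]) (trans (-‿cong h) -0#≈0#)) (Pos-ι n))

  ι-- : ∀ i j → ι (i ℤ.- j) ≈ ι i - ι j
  ι-- i j = trans (ι-+ i (ℤ.- j)) (+-congˡ (ι-neg j))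

  ι-injective : ∀ j k → ι j ≈ ι k → j ≡ k
  ι-injective j k h = ℤ.i-j≡0⇒i≡j j k (ι-≡0 (j ℤ.- k)
    (trans (ι-- j k) (trans (+-congʳ h) (-‿inverseʳ (ι k)))))

  module Form (A B C : Carrier) where

    form′ : Carrier → Carrier → Carrier
    form′ x y = A * (x * x) + B * (x * y) + C * (y * y)

    form : ℤ → ℤ → Carrier
    form x y = form′ (ι x) (ι y)

    -- The polarisation `form (p + q) - form p - form q`, that is, twice the bilinear form; this
    -- normalisation avoids halves.
    polar : ℤ → ℤ → ℤ → ℤ → Carrier
    polar p₁ p₂ q₁ q₂ = ι (+ 2) * A * (ι p₁ * ι q₁) + B * (ι p₁ * ι q₂ + ι p₂ * ι q₁)
                      + ι (+ 2) * C * (ι p₂ * ι q₂)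

    form′-cong : ∀ {x x′ y y′} → x ≈ x′ → y ≈ y′ → form′ x y ≈ form′ x′ y′
    form′-cong h k = +-cong (+-cong (*-congˡ (*-cong h h)) (*-congˡ (*-cong h k))) (*-congˡ (*-cong k k))

    ι-combination : ∀ k l p q → ι (k ℤ.* p ℤ.+ l ℤ.* q) ≈ ι k * ι p + ι l * ι q
    ι-combination k l p q = trans (ι-+ (k ℤ.* p) (l ℤ.* q)) (+-cong (ι-* k p) (ι-* l q))

    form-combination : ∀ k l p₁ p₂ q₁ q₂ →
      form (k ℤ.* p₁ ℤ.+ l ℤ.* q₁) (k ℤ.* p₂ ℤ.+ l ℤ.* q₂)
      ≈ ι k * ι k * form p₁ p₂ + ι k * ι l * polar p₁ p₂ q₁ q₂ + ι l * ι l * form q₁ q₂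
    form-combination k l p₁ p₂ q₁ q₂ = trans
      (form′-cong (ι-combination k l p₁ q₁) (ι-combination k l p₂ q₂))
      (solve 9 (λ A B C k l p₁ p₂ q₁ q₂ →
        let F = λ x y → A :* (x :* x) :+ B :* (x :* y) :+ C :* (y :* y) in
        F (k :* p₁ :+ l :* q₁) (k :* p₂ :+ l :* q₂)
        := k :* k :* F p₁ p₂
           :+ k :* l :* (con (+ 2) :* A :* (p₁ :* q₁) :+ B :* (p₁ :* q₂ :+ p₂ :* q₁) :+ con (+ 2) :* C :* (p₂ :* q₂))
           :+ l :* l :* F q₁ q₂)
        refl A B C (ι k) (ι l) (ι p₁) (ι p₂) (ι q₁) (ι q₂))

    form-scale : ∀ d x y → form (d ℤ.* x) (d ℤ.* y) ≈ ι d * ι d * form x y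
    form-scale d x y = trans (form′-cong (ι-* d x) (ι-* d y))
      (solve 6 (λ A B C d x y →
        A :* (d :* x :* (d :* x)) :+ B :* (d :* x :* (d :* y)) :+ C :* (d :* y :* (d :* y))
        := d :* d :* (A :* (x :* x) :+ B :* (x :* y) :+ C :* (y :* y))) refl A B C (ι d) (ι x) (ι y))

    -- The Gram determinant changes by the square of the determinant of the coordinates; both sides
    -- carry the factor 4 that comes from `polar`.
    discriminant : ∀ p₁ p₂ q₁ q₂ →
      ι (+ 4) * (form p₁ p₂ * form q₁ q₂) - polar p₁ p₂ q₁ q₂ * polar p₁ p₂ q₁ q₂
      ≈ (ι (+ 4) * A * C - B * B) * (ι (p₁ ℤ.* q₂ ℤ.- p₂ ℤ.* q₁) * ι (p₁ ℤ.* q₂ ℤ.- p₂ ℤ.* q₁))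
    discriminant p₁ p₂ q₁ q₂ = trans
      (solve 7 (λ A B C p₁ p₂ q₁ q₂ →
        let F = λ x y → A :* (x :* x) :+ B :* (x :* y) :+ C :* (y :* y)
            G = con (+ 2) :* A :* (p₁ :* q₁) :+ B :* (p₁ :* q₂ :+ p₂ :* q₁) :+ con (+ 2) :* C :* (p₂ :* q₂)
            D = p₁ :* q₂ :- p₂ :* q₁ in
        con (+ 4) :* (F p₁ p₂ :* F q₁ q₂) :- G :* G
        := (con (+ 4) :* A :* C :- B :* B) :* (D :* D))
        refl A B C (ι p₁) (ι p₂) (ι q₁) (ι q₂))
      (*-congˡ (*-cong D≈ D≈))
      where
      D≈ : ι p₁ * ι q₂ - ι p₂ * ι q₁ ≈ ι (p₁ ℤ.* q₂ ℤ.- p₂ ℤ.* q₁)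
      D≈ = sym (trans (ι-- (p₁ ℤ.* q₂) (p₂ ℤ.* q₁)) (+-cong (ι-* p₁ q₂) (-‿cong (ι-* p₂ q₁))))

    record HexagonalBasis (u : Carrier) : Set where
      field
        p₁ p₂ q₁ q₂ : ℤ
        form-p    : form p₁ p₂ ≈ u
        form-q    : form q₁ q₂ ≈ u
        polar-p-q : polar p₁ p₂ q₁ q₂ ≈ - u
        generates : ∀ v₁ v₂ → ∃₂ λ k l →
          v₁ ≡ k ℤ.* p₁ ℤ.+ l ℤ.* q₁ × v₂ ≡ k ℤ.* p₂ ℤ.+ l ℤ.* q₂

    -- Minimality and the condition that `p` differs from `q` and `-q` are stated for integer
    -- coordinates, where being zero is decidable.
    module MinimalPair {u : Carrier} (u>0 : Pos u)
      (minimal : ∀ x y → ¬ (x ≡ 0ℤ × y ≡ 0ℤ) → NonNeg (form x y - u))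
      (p₁ p₂ q₁ q₂ : ℤ) (form-p : form p₁ p₂ ≈ u) (form-q : form q₁ q₂ ≈ u)
      (p≢q : ¬ (p₁ ≡ q₁ × p₂ ≡ q₂)) (p≢-q : ¬ (p₁ ≡ ℤ.- q₁ × p₂ ≡ ℤ.- q₂)) where

      G : Carrier
      G = polar p₁ p₂ q₁ q₂

      D : ℤ
      D = p₁ ℤ.* q₂ ℤ.- p₂ ℤ.* q₁

      combination : ∀ k l → form (k ℤ.* p₁ ℤ.+ l ℤ.* q₁) (k ℤ.* p₂ ℤ.+ l ℤ.* q₂)
                          ≈ (ι k * ι k + ι l * ι l) * u + ι k * ι l * G
      combination k l = trans (form-combination k l p₁ p₂ q₁ q₂)
        (trans (+-cong (+-congʳ (*-congˡ form-p)) (*-congˡ form-q))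
          (solve 4 (λ k l u G → k :* k :* u :+ k :* l :* G :+ l :* l :* u
                             := (k :* k :+ l :* l) :* u :+ k :* l :* G) refl (ι k) (ι l) u G))

      -- Minimality at the nonzero vector `p - q`, where the form takes the value `2u - G`. The
      -- companion `u+G≥0` is minimality at `p + q`; together they say that `G` lies between `-u`
      -- and `u`.
      u-G≥0 : NonNeg (u - G)
      u-G≥0 = NonNeg-resp (trans (+-congʳ (combination 1ℤ -1ℤ)) (solve 2 (λ u G →
          (con 1ℤ :* con 1ℤ :+ con -1ℤ :* con -1ℤ) :* u :+ con 1ℤ :* con -1ℤ :* G :- u := u :- G)
          refl u G))
        (minimal _ _ λ (e₁ , e₂) → p≢q (difference p₁ q₁ e₁ , difference p₂ q₂ e₂))
        where
        cancel : ∀ p q → p ≡ (1ℤ ℤ.* p ℤ.+ -1ℤ ℤ.* q) ℤ.+ q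
        cancel = ℤ-ring-∀
        difference : ∀ p q → 1ℤ ℤ.* p ℤ.+ -1ℤ ℤ.* q ≡ 0ℤ → p ≡ q
        difference p q e = ≡.trans (cancel p q) (≡.trans (cong (ℤ._+ q) e) (ℤ.+-identityˡ q))

      u+G≥0 : NonNeg (u + G)
      u+G≥0 = NonNeg-resp (trans (+-congʳ (combination 1ℤ 1ℤ)) (solve 2 (λ u G →
          (con 1ℤ :* con 1ℤ :+ con 1ℤ :* con 1ℤ) :* u :+ con 1ℤ :* con 1ℤ :* G :- u := u :+ G)
          refl u G))
        (minimal _ _ λ (e₁ , e₂) → p≢-q (difference p₁ q₁ e₁ , difference p₂ q₂ e₂))
        where
        cancel : ∀ p q → p ≡ (1ℤ ℤ.* p ℤ.+ 1ℤ ℤ.* q) ℤ.- q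
        cancel = ℤ-ring-∀
        difference : ∀ p q → 1ℤ ℤ.* p ℤ.+ 1ℤ ℤ.* q ≡ 0ℤ → p ≡ ℤ.- q
        difference p q e = ≡.trans (cancel p q) (≡.trans (cong (ℤ._- q) e) (ℤ.+-identityˡ (ℤ.- q)))

      -- The bound `|zG| ≤ |z|u` without an absolute value of the real number `G`, whose sign is
      -- undecidable: the case distinction is on the sign of the integer `z`.
      ∣z∣u+zG≥0 : ∀ z → NonNeg (ι (+ ℤ.∣ z ∣) * u + ι z * G)
      ∣z∣u+zG≥0 (+ n) = NonNeg-resp (distribˡ (ι (+ n)) u G) (NonNeg-* (NonNeg-ι n) u+G≥0)
      ∣z∣u+zG≥0 -[1+ n ] = NonNeg-resp
        (trans (solve 3 (λ n u G → n :* (u :- G) := n :* u :+ :- n :* G) refl (ι (+ suc n)) u G)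
               (+-congˡ (*-congʳ (sym (ι-neg (+ suc n))))))
        (NonNeg-* (NonNeg-ι (suc n)) u-G≥0)

      ∣z∣u-zG≥0 : ∀ z → NonNeg (ι (+ ℤ.∣ z ∣) * u - ι z * G)
      ∣z∣u-zG≥0 z = NonNeg-resp
        (+-cong (*-congʳ (reflexive (cong (λ n → ι (+ n)) (ℤ.∣-i∣≡∣i∣ z))))
          (trans (*-congʳ (ι-neg z)) (solve 2 (λ z G → :- z :* G := :- (z :* G)) refl (ι z) G)))
        (∣z∣u+zG≥0 (ℤ.- z))

      -- Otherwise 4u² = G² by the discriminant, whereas G² ≤ u².
      D≢0 : D ≢ 0ℤ
      D≢0 D≡0 = NonNeg-* u-G≥0 u+G≥0 (Pos-resp
        (lin 4u²-G²≈0 (solve 2 (λ u G →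
          con (+ 3) :* (u :* u) :- :- ((u :- G) :* (u :+ G))
          := (con (+ 4) :* (u :* u) :- G :* G) :- con 0ℤ) refl u G))
        (Pos-* (Pos-ι 2) (Pos-* u>0 u>0)))
        where
        ιD≈0 : ι D ≈ ι 0ℤ
        ιD≈0 = reflexive (cong ι D≡0)
        4u²-G²≈0 : ι (+ 4) * (u * u) - G * G ≈ ι 0ℤ
        4u²-G²≈0 = trans (+-congʳ (*-congˡ (*-cong (sym form-p) (sym form-q))))
          (trans (discriminant p₁ p₂ q₁ q₂) (trans (*-congˡ (*-cong ιD≈0 ιD≈0))
            (solve 1 (λ x → x :* (con 0ℤ :* con 0ℤ) := con 0ℤ) refl (ι (+ 4) * A * C - B * B))))

      -- If Dw = xp + yq with 2|x|, 2|y| ≤ |D|, then 4D²|w|² ≤ 3D²u, so w is shorter than the minimum.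
      reduced⇒zero : ∀ w₁ w₂ x y →
        D ℤ.* w₁ ≡ x ℤ.* p₁ ℤ.+ y ℤ.* q₁ → D ℤ.* w₂ ≡ x ℤ.* p₂ ℤ.+ y ℤ.* q₂ →
        2 ℕ.* ℤ.∣ x ∣ ℕ.≤ ℤ.∣ D ∣ → 2 ℕ.* ℤ.∣ y ∣ ℕ.≤ ℤ.∣ D ∣ → w₁ ≡ 0ℤ × w₂ ≡ 0ℤ
      reduced⇒zero w₁ w₂ x y Dw₁ Dw₂ 2x≤D 2y≤D with w₁ ℤ.≟ 0ℤ ×-dec w₂ ℤ.≟ 0ℤ
      ... | yes w≡0 = w≡0
      ... | no w≢0 = ⊥-elim (ℕ.<⇒≱
          (reduced-norm ℤ.∣ D ∣ ℤ.∣ x ∣ ℤ.∣ y ∣ (ℕ.n≢0⇒n>0 λ e → D≢0 (ℤ.∣i∣≡0⇒i≡0 e)) 2x≤D 2y≤D)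
          (ℤ.drop‿+≤+ (subst₂ ℤ._≤_ lower upper
            (ℤ.0≤i-j⇒j≤i (ι-0≤ u>0 N (NonNeg-resp scaled
              (NonNeg-+ (NonNeg-* 4D²≥0 (minimal w₁ w₂ w≢0))
                (NonNeg-* (NonNeg-ι 4) (∣z∣u-zG≥0 (x ℤ.* y))))))))))
        where
        -- The sum of `4D²(form w - u)` and `4(|xy|u - xyG)` is `N u`. Both summands are
        -- nonnegative, hence `N ≥ 0`, against the strict inequality of `reduced-norm`.
        N = + 4 ℤ.* (x ℤ.* x ℤ.+ y ℤ.* y ℤ.+ + ℤ.∣ x ℤ.* y ∣) ℤ.- + 4 ℤ.* (D ℤ.* D)
        ιN≈ : ι N ≈ ι (+ 4) * (ι x * ι x + ι y * ι y + ι (+ ℤ.∣ x ℤ.* y ∣)) - ι (+ 4) * (ι D * ι D)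
        ιN≈ = trans (ι-- (+ 4 ℤ.* (x ℤ.* x ℤ.+ y ℤ.* y ℤ.+ + ℤ.∣ x ℤ.* y ∣)) (+ 4 ℤ.* (D ℤ.* D)))
          (+-cong
            (trans (ι-* (+ 4) _) (*-congˡ (trans (ι-+ (x ℤ.* x ℤ.+ y ℤ.* y) (+ ℤ.∣ x ℤ.* y ∣))
              (+-congʳ (trans (ι-+ (x ℤ.* x) (y ℤ.* y)) (+-cong (ι-* x x) (ι-* y y)))))))
            (-‿cong (trans (ι-* (+ 4) (D ℤ.* D)) (*-congˡ (ι-* D D)))))
        4D²≥0 : NonNeg (ι (+ 4) * (ι D * ι D))
        4D²≥0 = NonNeg-* (NonNeg-ι 4) (NonNeg-resp
          (trans (reflexive (cong ι (≡.sym (i*i≡∣i∣*∣i∣ D)))) (ι-* D D)) (NonNeg-ι (ℤ.∣ D ∣ ℕ.* ℤ.∣ D ∣)))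
        D²w : ι D * ι D * form w₁ w₂ ≈ (ι x * ι x + ι y * ι y) * u + ι x * ι y * G
        D²w = trans (sym (form-scale D w₁ w₂))
          (trans (reflexive (cong₂ form Dw₁ Dw₂)) (combination x y))
        scaled : ι (+ 4) * (ι D * ι D) * (form w₁ w₂ - u)
               + ι (+ 4) * (ι (+ ℤ.∣ x ℤ.* y ∣) * u - ι (x ℤ.* y) * G) ≈ ι N * u
        scaled = trans (+-congˡ (*-congˡ (+-congˡ (-‿cong (*-congʳ (ι-* x y))))))
          (trans (lin (*-congˡ {ι (+ 4)} D²w)
            (solve 7 (λ d w u m x y G →
              con (+ 4) :* (d :* d) :* (w :- u) :+ con (+ 4) :* (m :* u :- x :* y :* G)
                :- (con (+ 4) :* (x :* x :+ y :* y :+ m) :- con (+ 4) :* (d :* d)) :* u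
              := con (+ 4) :* (d :* d :* w)
                :- con (+ 4) :* ((x :* x :+ y :* y) :* u :+ x :* y :* G))
              refl (ι D) (form w₁ w₂) u (ι (+ ℤ.∣ x ℤ.* y ∣)) (ι x) (ι y) G))
            (*-congʳ (sym ιN≈)))
        lower : + 4 ℤ.* (D ℤ.* D) ≡ + (4 ℕ.* (ℤ.∣ D ∣ ℕ.* ℤ.∣ D ∣))
        lower = ≡.trans (cong (+ 4 ℤ.*_) (i*i≡∣i∣*∣i∣ D)) (≡.sym (ℤ.pos-* 4 (ℤ.∣ D ∣ ℕ.* ℤ.∣ D ∣)))
        upper : + 4 ℤ.* (x ℤ.* x ℤ.+ y ℤ.* y ℤ.+ + ℤ.∣ x ℤ.* y ∣)
              ≡ + (4 ℕ.* (ℤ.∣ x ∣ ℕ.* ℤ.∣ x ∣ ℕ.+ ℤ.∣ y ∣ ℕ.* ℤ.∣ y ∣ ℕ.+ ℤ.∣ x ∣ ℕ.* ℤ.∣ y ∣))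
        upper = ≡.trans (cong (+ 4 ℤ.*_) (cong₂ ℤ._+_
          (cong₂ ℤ._+_ (i*i≡∣i∣*∣i∣ x) (i*i≡∣i∣*∣i∣ y)) (cong +_ (ℤ.abs-* x y))))
          (≡.sym (ℤ.pos-* 4 (ℤ.∣ x ∣ ℕ.* ℤ.∣ x ∣ ℕ.+ ℤ.∣ y ∣ ℕ.* ℤ.∣ y ∣ ℕ.+ ℤ.∣ x ∣ ℕ.* ℤ.∣ y ∣)))

      -- By Cramer's rule `D v = X p + Y q`. Rounding `X / D` and `Y / D` to nearby integers `k` and
      -- `l` leaves `w = v - k p - l q` with `D w = x p + y q` and centred remainders `x`, `y`, so
      -- `w` vanishes by `reduced⇒zero`.
      generates : ∀ v₁ v₂ → ∃₂ λ k l →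
        v₁ ≡ k ℤ.* p₁ ℤ.+ l ℤ.* q₁ × v₂ ≡ k ℤ.* p₂ ℤ.+ l ℤ.* q₂
      generates v₁ v₂ =
        let X = v₁ ℤ.* q₂ ℤ.- v₂ ℤ.* q₁
            Y = p₁ ℤ.* v₂ ℤ.- p₂ ℤ.* v₁
            k , x , X≡ , 2x≤D = centred-division D D≢0 X
            l , y , Y≡ , 2y≤D = centred-division D D≢0 Y
            w₁≡0 , w₂≡0 = reduced⇒zero
              (v₁ ℤ.- (k ℤ.* p₁ ℤ.+ l ℤ.* q₁)) (v₂ ℤ.- (k ℤ.* p₂ ℤ.+ l ℤ.* q₂)) x y
              (≡.trans (cramer₁ v₁ v₂ p₁ p₂ q₁ q₂ k l)
                (cong₂ (λ x y → x ℤ.* p₁ ℤ.+ y ℤ.* q₁) (remainder X k x X≡) (remainder Y l y Y≡)))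
              (≡.trans (cramer₂ v₁ v₂ p₁ p₂ q₁ q₂ k l)
                (cong₂ (λ x y → x ℤ.* p₂ ℤ.+ y ℤ.* q₂) (remainder X k x X≡) (remainder Y l y Y≡)))
              2x≤D 2y≤D
        in k , l , ℤ.i-j≡0⇒i≡j v₁ _ w₁≡0 , ℤ.i-j≡0⇒i≡j v₂ _ w₂≡0
        where
        remainder : ∀ X k x → X ≡ k ℤ.* D ℤ.+ x → X ℤ.- k ℤ.* D ≡ x
        remainder X k x eq = ≡.trans (cong (ℤ._- k ℤ.* D) eq) (cancel (k ℤ.* D) x)
          where
          cancel : ∀ a x → (a ℤ.+ x) ℤ.- a ≡ x
          cancel = ℤ-ring-∀
        cramer₁ : ∀ v₁ v₂ p₁ p₂ q₁ q₂ k l →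
          (p₁ ℤ.* q₂ ℤ.- p₂ ℤ.* q₁) ℤ.* (v₁ ℤ.- (k ℤ.* p₁ ℤ.+ l ℤ.* q₁))
          ≡ ((v₁ ℤ.* q₂ ℤ.- v₂ ℤ.* q₁) ℤ.- k ℤ.* (p₁ ℤ.* q₂ ℤ.- p₂ ℤ.* q₁)) ℤ.* p₁
            ℤ.+ ((p₁ ℤ.* v₂ ℤ.- p₂ ℤ.* v₁) ℤ.- l ℤ.* (p₁ ℤ.* q₂ ℤ.- p₂ ℤ.* q₁)) ℤ.* q₁
        cramer₁ = ℤ-ring-∀
        cramer₂ : ∀ v₁ v₂ p₁ p₂ q₁ q₂ k l →
          (p₁ ℤ.* q₂ ℤ.- p₂ ℤ.* q₁) ℤ.* (v₂ ℤ.- (k ℤ.* p₂ ℤ.+ l ℤ.* q₂))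
          ≡ ((v₁ ℤ.* q₂ ℤ.- v₂ ℤ.* q₁) ℤ.- k ℤ.* (p₁ ℤ.* q₂ ℤ.- p₂ ℤ.* q₁)) ℤ.* p₂
            ℤ.+ ((p₁ ℤ.* v₂ ℤ.- p₂ ℤ.* v₁) ℤ.- l ℤ.* (p₁ ℤ.* q₂ ℤ.- p₂ ℤ.* q₁)) ℤ.* q₂
        cramer₂ = ℤ-ring-∀

      -- From `u = (k² + l²)u + klG` and `klG ≥ -|kl|u` follows `k² + l² ≤ |kl| + 1`, the hypothesis
      -- of `short-coefficients`.
      third-coefficients : ∀ k l → form (k ℤ.* p₁ ℤ.+ l ℤ.* q₁) (k ℤ.* p₂ ℤ.+ l ℤ.* q₂) ≈ u →
                           ℤ.∣ k ∣ ℕ.≤ 1 × ℤ.∣ l ∣ ℕ.≤ 1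
      third-coefficients k l form-r = short-coefficients ℤ.∣ k ∣ ℤ.∣ l ∣
        (ℤ.drop‿+≤+ (subst₂ ℤ._≤_ lower upper
          (ℤ.0≤i-j⇒j≤i (ι-0≤ u>0 N (NonNeg-resp bound (∣z∣u+zG≥0 (k ℤ.* l)))))))
        where
        m = + ℤ.∣ k ℤ.* l ∣
        N = m ℤ.+ 1ℤ ℤ.- (k ℤ.* k ℤ.+ l ℤ.* l)
        ιN≈ : ι N ≈ ι m + ι 1ℤ - (ι k * ι k + ι l * ι l)
        ιN≈ = trans (ι-- (m ℤ.+ 1ℤ) (k ℤ.* k ℤ.+ l ℤ.* l)) (+-cong (ι-+ m 1ℤ)
          (-‿cong (trans (ι-+ (k ℤ.* k) (l ℤ.* l)) (+-cong (ι-* k k) (ι-* l l)))))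
        bound : ι m * u + ι (k ℤ.* l) * G ≈ ι N * u
        bound = trans (+-congˡ (*-congʳ (ι-* k l)))
          (trans (lin (trans (sym (combination k l)) form-r)
            (solve 5 (λ k l u m G →
              m :* u :+ k :* l :* G :- (m :+ con 1ℤ :- (k :* k :+ l :* l)) :* u
              := (k :* k :+ l :* l) :* u :+ k :* l :* G :- u)
              refl (ι k) (ι l) u (ι m) G))
            (*-congʳ (sym ιN≈)))
        lower : k ℤ.* k ℤ.+ l ℤ.* l ≡ + (ℤ.∣ k ∣ ℕ.* ℤ.∣ k ∣ ℕ.+ ℤ.∣ l ∣ ℕ.* ℤ.∣ l ∣)
        lower = cong₂ ℤ._+_ (i*i≡∣i∣*∣i∣ k) (i*i≡∣i∣*∣i∣ l)
        upper : m ℤ.+ 1ℤ ≡ + (ℤ.∣ k ∣ ℕ.* ℤ.∣ l ∣ ℕ.+ 1)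
        upper = cong (λ n → + n ℤ.+ 1ℤ) (ℤ.abs-* k l)

      basis⁺ : G ≈ - u → HexagonalBasis u
      basis⁺ G≈-u = record
        { p₁ = p₁ ; p₂ = p₂ ; q₁ = q₁ ; q₂ = q₂ ; form-p = form-p ; form-q = form-q
        ; polar-p-q = G≈-u ; generates = generates }

      -- Replacing `q` by `-q` turns the angle π/3 between the two vectors into 2π/3.
      basis⁻ : G ≈ u → HexagonalBasis u
      basis⁻ G≈u = record
        { p₁ = p₁ ; p₂ = p₂ ; q₁ = -1ℤ ℤ.* q₁ ; q₂ = -1ℤ ℤ.* q₂
        ; form-p = form-p
        ; form-q = trans (form-scale -1ℤ q₁ q₂) (trans (*-congˡ form-q)
            (solve 1 (λ u → con -1ℤ :* con -1ℤ :* u := u) refl u))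
        ; polar-p-q = trans (+-cong (+-cong
              (*-congˡ (*-congˡ (ι-* -1ℤ q₁)))
              (*-congˡ (+-cong (*-congˡ (ι-* -1ℤ q₂)) (*-congˡ (ι-* -1ℤ q₁)))))
              (*-congˡ (*-congˡ (ι-* -1ℤ q₂))))
            (trans (solve 7 (λ A B C p₁ p₂ q₁ q₂ →
              con (+ 2) :* A :* (p₁ :* (con -1ℤ :* q₁))
                :+ B :* (p₁ :* (con -1ℤ :* q₂) :+ p₂ :* (con -1ℤ :* q₁))
                :+ con (+ 2) :* C :* (p₂ :* (con -1ℤ :* q₂))
              := :- (con (+ 2) :* A :* (p₁ :* q₁) :+ B :* (p₁ :* q₂ :+ p₂ :* q₁)
                     :+ con (+ 2) :* C :* (p₂ :* q₂)))
              refl A B C (ι p₁) (ι p₂) (ι q₁) (ι q₂))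
            (-‿cong G≈u))
        ; generates = λ v₁ v₂ → let k , l , e₁ , e₂ = generates v₁ v₂ in
            k , ℤ.- l , ≡.trans e₁ (signs k l p₁ q₁) , ≡.trans e₂ (signs k l p₂ q₂)
        }
        where
        signs : ∀ k l p q → k ℤ.* p ℤ.+ l ℤ.* q ≡ k ℤ.* p ℤ.+ ℤ.- l ℤ.* (-1ℤ ℤ.* q)
        signs = ℤ-ring-∀

      module _ (r₁ r₂ : ℤ) (form-r : form r₁ r₂ ≈ u)
        (p≢r : ¬ (p₁ ≡ r₁ × p₂ ≡ r₂)) (p≢-r : ¬ (p₁ ≡ ℤ.- r₁ × p₂ ≡ ℤ.- r₂))
        (q≢r : ¬ (q₁ ≡ r₁ × q₂ ≡ r₂)) (q≢-r : ¬ (q₁ ≡ ℤ.- r₁ × q₂ ≡ ℤ.- r₂)) where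

        hexagonalBasis : HexagonalBasis u
        hexagonalBasis = fromThird (generates r₁ r₂)
          where
          fromCoefficients : ∀ k l → r₁ ≡ k ℤ.* p₁ ℤ.+ l ℤ.* q₁ → r₂ ≡ k ℤ.* p₂ ℤ.+ l ℤ.* q₂ →
            (ι k * ι k + ι l * ι l) * u + ι k * ι l * G ≈ u →
            ℤ.∣ k ∣ ℕ.≤ 1 → ℤ.∣ l ∣ ℕ.≤ 1 → HexagonalBasis u
          fromCoefficients (+ 0) (+ 0) e₁ e₂ h _ _ = ⊥-elim (Pos-irrefl (trans (sym h) (trans
            (solve 2 (λ u G → (con 0ℤ :* con 0ℤ :+ con 0ℤ :* con 0ℤ) :* u :+ con 0ℤ :* con 0ℤ :* G := con 0ℤ)
              refl u G) ι-0)) u>0)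
          fromCoefficients (+ 0) (+ 1) e₁ e₂ _ _ _ =
            ⊥-elim (q≢r (≡.sym (≡.trans e₁ (eq p₁ q₁)) , ≡.sym (≡.trans e₂ (eq p₂ q₂))))
            where
            eq : ∀ p q → 0ℤ ℤ.* p ℤ.+ 1ℤ ℤ.* q ≡ q
            eq = ℤ-ring-∀
          fromCoefficients (+ 0) -[1+ 0 ] e₁ e₂ _ _ _ =
            ⊥-elim (q≢-r (≡.trans (eq p₁ q₁) (cong ℤ.-_ (≡.sym e₁)) , ≡.trans (eq p₂ q₂) (cong ℤ.-_ (≡.sym e₂))))
            where
            eq : ∀ p q → q ≡ ℤ.- (0ℤ ℤ.* p ℤ.+ -1ℤ ℤ.* q)
            eq = ℤ-ring-∀
          fromCoefficients (+ 1) (+ 0) e₁ e₂ _ _ _ =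
            ⊥-elim (p≢r (≡.sym (≡.trans e₁ (eq p₁ q₁)) , ≡.sym (≡.trans e₂ (eq p₂ q₂))))
            where
            eq : ∀ p q → 1ℤ ℤ.* p ℤ.+ 0ℤ ℤ.* q ≡ p
            eq = ℤ-ring-∀
          fromCoefficients -[1+ 0 ] (+ 0) e₁ e₂ _ _ _ =
            ⊥-elim (p≢-r (≡.trans (eq p₁ q₁) (cong ℤ.-_ (≡.sym e₁)) , ≡.trans (eq p₂ q₂) (cong ℤ.-_ (≡.sym e₂))))
            where
            eq : ∀ p q → p ≡ ℤ.- (-1ℤ ℤ.* p ℤ.+ 0ℤ ℤ.* q)
            eq = ℤ-ring-∀
          fromCoefficients (+ 1) (+ 1) e₁ e₂ h _ _ = basis⁺ (lin h (solve 2 (λ u G → G :- :- u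
            := (con 1ℤ :* con 1ℤ :+ con 1ℤ :* con 1ℤ) :* u :+ con 1ℤ :* con 1ℤ :* G :- u) refl u G))
          fromCoefficients -[1+ 0 ] -[1+ 0 ] e₁ e₂ h _ _ = basis⁺ (lin h (solve 2 (λ u G → G :- :- u
            := (con -1ℤ :* con -1ℤ :+ con -1ℤ :* con -1ℤ) :* u :+ con -1ℤ :* con -1ℤ :* G :- u) refl u G))
          fromCoefficients (+ 1) -[1+ 0 ] e₁ e₂ h _ _ = basis⁻ (lin (sym h) (solve 2 (λ u G → G :- u
            := u :- ((con 1ℤ :* con 1ℤ :+ con -1ℤ :* con -1ℤ) :* u :+ con 1ℤ :* con -1ℤ :* G)) refl u G))
          fromCoefficients -[1+ 0 ] (+ 1) e₁ e₂ h _ _ = basis⁻ (lin (sym h) (solve 2 (λ u G → G :- u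
            := u :- ((con -1ℤ :* con -1ℤ :+ con 1ℤ :* con 1ℤ) :* u :+ con -1ℤ :* con 1ℤ :* G)) refl u G))
          fromCoefficients (+ suc (suc _)) _ _ _ _ (ℕ.s≤s ()) _
          fromCoefficients -[1+ suc _ ] _ _ _ _ (ℕ.s≤s ()) _
          fromCoefficients (+ 0) (+ suc (suc _)) _ _ _ _ (ℕ.s≤s ())
          fromCoefficients (+ 0) -[1+ suc _ ] _ _ _ _ (ℕ.s≤s ())
          fromCoefficients (+ 1) (+ suc (suc _)) _ _ _ _ (ℕ.s≤s ())
          fromCoefficients (+ 1) -[1+ suc _ ] _ _ _ _ (ℕ.s≤s ())
          fromCoefficients -[1+ 0 ] (+ suc (suc _)) _ _ _ _ (ℕ.s≤s ())
          fromCoefficients -[1+ 0 ] -[1+ suc _ ] _ _ _ _ (ℕ.s≤s ())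
          fromThird : ∃₂ (λ k l → r₁ ≡ k ℤ.* p₁ ℤ.+ l ℤ.* q₁ × r₂ ≡ k ℤ.* p₂ ℤ.+ l ℤ.* q₂) → HexagonalBasis u
          fromThird (k , l , e₁ , e₂) =
            let form-r′ = trans (reflexive (cong₂ form (≡.sym e₁) (≡.sym e₂))) form-r
                k≤1 , l≤1 = third-coefficients k l form-r′
            in fromCoefficients k l e₁ e₂ (trans (sym (combination k l)) form-r′) k≤1 l≤1

-- Ideals of ℤ[ω] in integer coordinates

norm : ℤ → ℤ → ℤ
norm a b = a ℤ.* a ℤ.- a ℤ.* b ℤ.+ b ℤ.* b

-- Coordinates with respect to 1 and ω: if α = a + bω and β = c + dω have the norm n and
-- αβ̄ has trace -n, then β = ωα or α = ωβ, since the determinant ad - bc is n or -n.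
rotation : ∀ a b c d n → n ≢ 0ℤ → norm a b ≡ n → norm c d ≡ n →
  + 2 ℤ.* (a ℤ.* c) ℤ.- (a ℤ.* d ℤ.+ b ℤ.* c) ℤ.+ + 2 ℤ.* (b ℤ.* d) ≡ ℤ.- n →
  (c ≡ ℤ.- b × d ≡ a ℤ.- b) ⊎ (a ≡ ℤ.- d × b ≡ c ℤ.- d)
rotation a b c d n n≢0 Nα Nβ tr = sign (ℤ.i*j≡0⇒i≡0∨j≡0 (e ℤ.- n) (ℤ.*-cancelˡ-≡ (+ 3) _ _ e²≡n²))
  where
  instance
    n-nonZero : ℤ.NonZero n
    n-nonZero = ℤ.≢-nonZero n≢0
    2n-nonZero : ℤ.NonZero (+ 2 ℤ.* n)
    2n-nonZero = ℤ.i*j≢0 (+ 2) n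
  e = a ℤ.* d ℤ.- b ℤ.* c
  H = + 2 ℤ.* (a ℤ.* c) ℤ.- (a ℤ.* d ℤ.+ b ℤ.* c) ℤ.+ + 2 ℤ.* (b ℤ.* d)
  -- The Gram identity `4 N(α) N(β) - tr² = 3(ad - bc)²` with `3n²` subtracted; under the hypotheses
  -- the right-hand side becomes `4n² - n² - 3n² = 0`.
  gram : ∀ a b c d n → + 3 ℤ.* ((a ℤ.* d ℤ.- b ℤ.* c ℤ.- n) ℤ.* (a ℤ.* d ℤ.- b ℤ.* c ℤ.+ n))
    ≡ + 4 ℤ.* ((a ℤ.* a ℤ.- a ℤ.* b ℤ.+ b ℤ.* b) ℤ.* (c ℤ.* c ℤ.- c ℤ.* d ℤ.+ d ℤ.* d))
      ℤ.- (+ 2 ℤ.* (a ℤ.* c) ℤ.- (a ℤ.* d ℤ.+ b ℤ.* c) ℤ.+ + 2 ℤ.* (b ℤ.* d))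
          ℤ.* (+ 2 ℤ.* (a ℤ.* c) ℤ.- (a ℤ.* d ℤ.+ b ℤ.* c) ℤ.+ + 2 ℤ.* (b ℤ.* d))
      ℤ.- + 3 ℤ.* (n ℤ.* n)
  gram = ℤ-ring-∀
  vanish : ∀ n → + 4 ℤ.* (n ℤ.* n) ℤ.- (ℤ.- n) ℤ.* (ℤ.- n) ℤ.- + 3 ℤ.* (n ℤ.* n) ≡ + 3 ℤ.* 0ℤ
  vanish = ℤ-ring-∀
  e²≡n² : + 3 ℤ.* ((e ℤ.- n) ℤ.* (e ℤ.+ n)) ≡ + 3 ℤ.* 0ℤ
  e²≡n² = ≡.trans (gram a b c d n) (≡.trans
    (cong₂ (λ N h → + 4 ℤ.* N ℤ.- h ℤ.* h ℤ.- + 3 ℤ.* (n ℤ.* n)) (cong₂ ℤ._*_ Nα Nβ) tr) (vanish n))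
  -- Trace and determinant are two linear equations for `c` and `d`, with coefficient determinant
  -- `2 N(α)`; this is Cramer's rule for them.
  solve-c : ∀ a b c d → + 2 ℤ.* (a ℤ.* a ℤ.- a ℤ.* b ℤ.+ b ℤ.* b) ℤ.* c
    ≡ a ℤ.* (+ 2 ℤ.* (a ℤ.* c) ℤ.- (a ℤ.* d ℤ.+ b ℤ.* c) ℤ.+ + 2 ℤ.* (b ℤ.* d))
      ℤ.- (+ 2 ℤ.* b ℤ.- a) ℤ.* (a ℤ.* d ℤ.- b ℤ.* c)
  solve-c = ℤ-ring-∀
  solve-d : ∀ a b c d → + 2 ℤ.* (a ℤ.* a ℤ.- a ℤ.* b ℤ.+ b ℤ.* b) ℤ.* d
    ≡ b ℤ.* (+ 2 ℤ.* (a ℤ.* c) ℤ.- (a ℤ.* d ℤ.+ b ℤ.* c) ℤ.+ + 2 ℤ.* (b ℤ.* d))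
      ℤ.+ (+ 2 ℤ.* a ℤ.- b) ℤ.* (a ℤ.* d ℤ.- b ℤ.* c)
  solve-d = ℤ-ring-∀
  solved-c : ∀ ε → e ≡ ε → + 2 ℤ.* n ℤ.* c ≡ a ℤ.* (ℤ.- n) ℤ.- (+ 2 ℤ.* b ℤ.- a) ℤ.* ε
  solved-c ε e≡ε = ≡.trans (cong (λ N → + 2 ℤ.* N ℤ.* c) (≡.sym Nα))
    (≡.trans (solve-c a b c d) (cong₂ (λ h e → a ℤ.* h ℤ.- (+ 2 ℤ.* b ℤ.- a) ℤ.* e) tr e≡ε))
  solved-d : ∀ ε → e ≡ ε → + 2 ℤ.* n ℤ.* d ≡ b ℤ.* (ℤ.- n) ℤ.+ (+ 2 ℤ.* a ℤ.- b) ℤ.* ε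
  solved-d ε e≡ε = ≡.trans (cong (λ N → + 2 ℤ.* N ℤ.* d) (≡.sym Nα))
    (≡.trans (solve-d a b c d) (cong₂ (λ h e → b ℤ.* h ℤ.+ (+ 2 ℤ.* a ℤ.- b) ℤ.* e) tr e≡ε))
  c⁺ : ∀ a b n → a ℤ.* (ℤ.- n) ℤ.- (+ 2 ℤ.* b ℤ.- a) ℤ.* n ≡ + 2 ℤ.* n ℤ.* (ℤ.- b)
  c⁺ = ℤ-ring-∀
  d⁺ : ∀ a b n → b ℤ.* (ℤ.- n) ℤ.+ (+ 2 ℤ.* a ℤ.- b) ℤ.* n ≡ + 2 ℤ.* n ℤ.* (a ℤ.- b)
  d⁺ = ℤ-ring-∀
  c⁻ : ∀ a b n → a ℤ.* (ℤ.- n) ℤ.- (+ 2 ℤ.* b ℤ.- a) ℤ.* (ℤ.- n) ≡ + 2 ℤ.* n ℤ.* (b ℤ.- a)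
  c⁻ = ℤ-ring-∀
  d⁻ : ∀ a b n → b ℤ.* (ℤ.- n) ℤ.+ (+ 2 ℤ.* a ℤ.- b) ℤ.* (ℤ.- n) ≡ + 2 ℤ.* n ℤ.* (ℤ.- a)
  d⁻ = ℤ-ring-∀
  swap : ∀ a b → b ≡ b ℤ.- a ℤ.- (ℤ.- a)
  swap = ℤ-ring-∀
  sign : e ℤ.- n ≡ 0ℤ ⊎ e ℤ.+ n ≡ 0ℤ → (c ≡ ℤ.- b × d ≡ a ℤ.- b) ⊎ (a ≡ ℤ.- d × b ≡ c ℤ.- d)
  sign (inj₁ e-n≡0) = inj₁
    ( ℤ.*-cancelˡ-≡ (+ 2 ℤ.* n) c (ℤ.- b) (≡.trans (solved-c n e≡n) (c⁺ a b n))
    , ℤ.*-cancelˡ-≡ (+ 2 ℤ.* n) d (a ℤ.- b) (≡.trans (solved-d n e≡n) (d⁺ a b n)))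
    where e≡n = ℤ.i-j≡0⇒i≡j e n e-n≡0
  sign (inj₂ e+n≡0) = inj₂
    ( ≡.sym (≡.trans (cong ℤ.-_ d≡-a) (ℤ.neg-involutive a))
    , ≡.trans (swap a b) (≡.sym (cong₂ ℤ._-_ c≡b-a d≡-a)))
    where
    e≡-n : e ≡ ℤ.- n
    e≡-n = ℤ.i-j≡0⇒i≡j e (ℤ.- n) (≡.trans (cong (ℤ._+_ e) (ℤ.neg-involutive n)) e+n≡0)
    c≡b-a = ℤ.*-cancelˡ-≡ (+ 2 ℤ.* n) c (b ℤ.- a) (≡.trans (solved-c (ℤ.- n) e≡-n) (c⁻ a b n))
    d≡-a = ℤ.*-cancelˡ-≡ (+ 2 ℤ.* n) d (ℤ.- a) (≡.trans (solved-d (ℤ.- n) e≡-n) (d⁻ a b n))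

-- Ideals of prime index

open Sum ℤ.+-0-commutativeMonoid using (sum; sum-permute; ∑-distrib-+)

sum-const : ∀ n x → sum {n} (λ _ → x) ≡ + n ℤ.* x
sum-const zero    x = ≡.refl
sum-const (suc n) x = ≡.trans (cong (ℤ._+_ x) (sum-const n x)) (≡.sym (ℤ.suc-* (+ n) x))

-- A permutation does not change the sum of all `r i`, so the representatives cancel and only the
-- translation by `x` remains, once for each class.
sum-shift : ∀ {n} (r : Fin n → ℤ) (π : Perm.Permutation n n) x →
  sum (λ i → r i ℤ.+ (x ℤ.- r (π Perm.⟨$⟩ʳ i))) ≡ + n ℤ.* x
sum-shift {n} r π x = begin
  sum (λ i → r i ℤ.+ (x ℤ.- r (π Perm.⟨$⟩ʳ i)))
    ≡⟨ ∑-distrib-+ r (λ i → x ℤ.- r (π Perm.⟨$⟩ʳ i)) ⟩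
  sum r ℤ.+ sum (λ i → x ℤ.- r (π Perm.⟨$⟩ʳ i))
    ≡⟨ cong (ℤ._+_ (sum r)) (∑-distrib-+ (λ _ → x) (λ i → ℤ.- r (π Perm.⟨$⟩ʳ i))) ⟩
  sum r ℤ.+ (sum {n} (λ _ → x) ℤ.+ sum (λ i → ℤ.- r (π Perm.⟨$⟩ʳ i)))
    ≡⟨ cong₂ (λ t s → sum r ℤ.+ (t ℤ.+ s)) (sum-const n x) (≡.sym (sum-permute (λ i → ℤ.- r i) π)) ⟩
  sum r ℤ.+ (+ n ℤ.* x ℤ.+ sum (λ i → ℤ.- r i))
    ≡⟨ cong (λ s → sum r ℤ.+ (+ n ℤ.* x ℤ.+ s)) (sum-neg r) ⟩
  sum r ℤ.+ (+ n ℤ.* x ℤ.- sum r)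
    ≡⟨ cancel (sum r) (+ n ℤ.* x) ⟩
  + n ℤ.* x ∎
  where
  open ≡.≡-Reasoning
  sum-neg : ∀ {n} (r : Fin n → ℤ) → sum (λ i → ℤ.- r i) ≡ ℤ.- sum r
  sum-neg {zero}  r = ≡.refl
  sum-neg {suc n} r = ≡.trans (cong (ℤ._+_ (ℤ.- r Fin.zero)) (sum-neg (r ∘ Fin.suc)))
    (≡.sym (ℤ.neg-distrib-+ (r Fin.zero) (sum (r ∘ Fin.suc))))
  cancel : ∀ s t → s ℤ.+ (t ℤ.- s) ≡ t
  cancel = ℤ-ring-∀

-- In coordinates with respect to 1 and ω, the ideal generated by a + bω.
module PrincipalIdeal (a b : ℤ) where

  -- The equation `x + yω = (s + tω)(a + bω)`, expanded with ω² = -1 - ω.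
  Member : ℤ → ℤ → Set
  Member x y = ∃₂ λ s t → x ≡ s ℤ.* a ℤ.- t ℤ.* b × y ≡ s ℤ.* b ℤ.+ t ℤ.* (a ℤ.- b)

  *-member : ∀ {x y} m n → Member x y → Member (m ℤ.* x ℤ.- n ℤ.* y) (m ℤ.* y ℤ.+ n ℤ.* x ℤ.- n ℤ.* y)
  *-member m n (s , t , ≡.refl , ≡.refl) =
    m ℤ.* s ℤ.- n ℤ.* t , m ℤ.* t ℤ.+ n ℤ.* s ℤ.- n ℤ.* t , re a b m n s t , im a b m n s t
    where
    re : ∀ a b m n s t → m ℤ.* (s ℤ.* a ℤ.- t ℤ.* b) ℤ.- n ℤ.* (s ℤ.* b ℤ.+ t ℤ.* (a ℤ.- b))
      ≡ (m ℤ.* s ℤ.- n ℤ.* t) ℤ.* a ℤ.- (m ℤ.* t ℤ.+ n ℤ.* s ℤ.- n ℤ.* t) ℤ.* b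
    re = ℤ-ring-∀
    im : ∀ a b m n s t → m ℤ.* (s ℤ.* b ℤ.+ t ℤ.* (a ℤ.- b)) ℤ.+ n ℤ.* (s ℤ.* a ℤ.- t ℤ.* b)
        ℤ.- n ℤ.* (s ℤ.* b ℤ.+ t ℤ.* (a ℤ.- b))
      ≡ (m ℤ.* s ℤ.- n ℤ.* t) ℤ.* b ℤ.+ (m ℤ.* t ℤ.+ n ℤ.* s ℤ.- n ℤ.* t) ℤ.* (a ℤ.- b)
    im = ℤ-ring-∀

  +-member : ∀ {x y z w} → Member x y → Member z w → Member (x ℤ.+ z) (y ℤ.+ w)
  +-member (s , t , ≡.refl , ≡.refl) (s′ , t′ , ≡.refl , ≡.refl) =
    s ℤ.+ s′ , t ℤ.+ t′ , re a b s t s′ t′ , im a b s t s′ t′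
    where
    re : ∀ a b s t s′ t′ → s ℤ.* a ℤ.- t ℤ.* b ℤ.+ (s′ ℤ.* a ℤ.- t′ ℤ.* b)
      ≡ (s ℤ.+ s′) ℤ.* a ℤ.- (t ℤ.+ t′) ℤ.* b
    re = ℤ-ring-∀
    im : ∀ a b s t s′ t′ → s ℤ.* b ℤ.+ t ℤ.* (a ℤ.- b) ℤ.+ (s′ ℤ.* b ℤ.+ t′ ℤ.* (a ℤ.- b))
      ≡ (s ℤ.+ s′) ℤ.* b ℤ.+ (t ℤ.+ t′) ℤ.* (a ℤ.- b)
    im = ℤ-ring-∀

  0-member : Member 0ℤ 0ℤ
  0-member = 0ℤ , 0ℤ , ≡.refl , ≡.refl

  member-≡ : ∀ {x y z w} → x ≡ z → y ≡ w → Member x y → Member z w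
  member-≡ ≡.refl ≡.refl h = h

  scale-member : ∀ {x y} m → Member x y → Member (m ℤ.* x) (m ℤ.* y)
  scale-member {x} {y} m h = member-≡ (eq m x y) (eq′ m x y) (*-member m 0ℤ h)
    where
    eq : ∀ m x y → m ℤ.* x ℤ.- 0ℤ ℤ.* y ≡ m ℤ.* x
    eq = ℤ-ring-∀
    eq′ : ∀ m x y → m ℤ.* y ℤ.+ 0ℤ ℤ.* x ℤ.- 0ℤ ℤ.* y ≡ m ℤ.* y
    eq′ = ℤ-ring-∀

  neg-member : ∀ {x y} → Member x y → Member (ℤ.- x) (ℤ.- y)
  neg-member {x} {y} h = member-≡ (ℤ.-1*i≡-i x) (ℤ.-1*i≡-i y) (scale-member -1ℤ h)

  sub-member : ∀ {x y z w} → Member x y → Member z w → Member (x ℤ.- z) (y ℤ.- w)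
  sub-member h k = +-member h (neg-member k)

  -- The cofactor is the conjugate of the generator, `a + bω² = (a - b) - bω`.
  norm-member : Member (norm a b) 0ℤ
  norm-member = a ℤ.- b , ℤ.- b , re a b , im a b
    where
    re : ∀ a b → a ℤ.* a ℤ.- a ℤ.* b ℤ.+ b ℤ.* b ≡ (a ℤ.- b) ℤ.* a ℤ.- (ℤ.- b) ℤ.* b
    re = ℤ-ring-∀
    im : ∀ a b → 0ℤ ≡ (a ℤ.- b) ℤ.* b ℤ.+ (ℤ.- b) ℤ.* (a ℤ.- b)
    im = ℤ-ring-∀

  -- The generator α and ωα have determinant `norm a b`, and the determinant of two of their integer
  -- combinations is a multiple `k` of it.
  norm∣det : ∀ {x y z w} → Member x y → Member z w → norm a b ℤᵘ.∣ (x ℤ.* w ℤ.- y ℤ.* z)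
  norm∣det (s , t , ≡.refl , ≡.refl) (s′ , t′ , ≡.refl , ≡.refl) =
    ℕ.divides ℤ.∣ k ∣ (≡.trans (cong ℤ.∣_∣ (det a b s t s′ t′)) (ℤ.abs-* k (norm a b)))
    where
    k = s ℤ.* t′ ℤ.- t ℤ.* s′
    det : ∀ a b s t s′ t′ →
      (s ℤ.* a ℤ.- t ℤ.* b) ℤ.* (s′ ℤ.* b ℤ.+ t′ ℤ.* (a ℤ.- b))
        ℤ.- (s ℤ.* b ℤ.+ t ℤ.* (a ℤ.- b)) ℤ.* (s′ ℤ.* a ℤ.- t′ ℤ.* b)
      ≡ (s ℤ.* t′ ℤ.- t ℤ.* s′) ℤ.* (a ℤ.* a ℤ.- a ℤ.* b ℤ.+ b ℤ.* b)
    det = ℤ-ring-∀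

  sum-member : ∀ {n} (f g : Fin n → ℤ) → (∀ i → Member (f i) (g i)) → Member (sum f) (sum g)
  sum-member {zero}  f g h = 0-member
  sum-member {suc n} f g h =
    +-member (h Fin.zero) (sum-member (f ∘ Fin.suc) (g ∘ Fin.suc) (h ∘ Fin.suc))

  module PrimeIndex {ℓ : ℕ} (ℓ-prime : Prime ℓ) (r₁ r₂ : Fin ℓ → ℤ)
    (complete : ∀ x y → ∃[ i ] Member (x ℤ.- r₁ i) (y ℤ.- r₂ i))
    (irredundant : ∀ i j → Member (r₁ i ℤ.- r₁ j) (r₂ i ℤ.- r₂ j) → i ≡ j) where

    private
      instance
        ℓ-nonZero = prime⇒nonZero ℓ-prime
        ℓ-nonTrivial = prime⇒nonTrivial ℓ-prime

    class : ℤ → ℤ → Fin ℓ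
    class x y = proj₁ (complete x y)

    class-member : ∀ x y → Member (x ℤ.- r₁ (class x y)) (y ℤ.- r₂ (class x y))
    class-member x y = proj₂ (complete x y)

    class-unique : ∀ x y i → Member (x ℤ.- r₁ i) (y ℤ.- r₂ i) → class x y ≡ i
    class-unique x y i h = irredundant (class x y) i (member-≡
      (cancel x (r₁ (class x y)) (r₁ i)) (cancel y (r₂ (class x y)) (r₂ i))
      (sub-member h (class-member x y)))
      where
      cancel : ∀ x r s → (x ℤ.- s) ℤ.- (x ℤ.- r) ≡ r ℤ.- s
      cancel = ℤ-ring-∀

    same-class : ∀ {x y z w} → class x y ≡ class z w → Member (x ℤ.- z) (y ℤ.- w)
    same-class {x} {y} {z} {w} eq = member-≡
      (cancel x z (r₁ (class z w))) (cancel y w (r₂ (class z w)))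
      (sub-member (subst (λ i → Member (x ℤ.- r₁ i) (y ℤ.- r₂ i)) eq (class-member x y)) (class-member z w))
      where
      cancel : ∀ x z r → (x ℤ.- r) ℤ.- (z ℤ.- r) ≡ x ℤ.- z
      cancel = ℤ-ring-∀

    shift : ℤ → ℤ → Fin ℓ → Fin ℓ
    shift x y i = class (r₁ i ℤ.+ x) (r₂ i ℤ.+ y)

    shift-inverse : ∀ {x y z w} → x ℤ.+ z ≡ 0ℤ → y ℤ.+ w ≡ 0ℤ → ∀ i → shift x y (shift z w i) ≡ i
    shift-inverse {x} {y} {z} {w} x+z≡0 y+w≡0 i = class-unique _ _ i (member-≡
      (cancel (r₁ i) (r₁ (shift z w i)) x+z≡0) (cancel (r₂ i) (r₂ (shift z w i)) y+w≡0)
      (neg-member (class-member (r₁ i ℤ.+ z) (r₂ i ℤ.+ w))))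
      where
      regroup : ∀ r s x z → ℤ.- ((r ℤ.+ z) ℤ.- s) ≡ (s ℤ.+ x) ℤ.- r ℤ.- (x ℤ.+ z)
      regroup = ℤ-ring-∀
      cancel : ∀ r s {x z} → x ℤ.+ z ≡ 0ℤ → ℤ.- ((r ℤ.+ z) ℤ.- s) ≡ (s ℤ.+ x) ℤ.- r
      cancel r s {x} {z} eq = ≡.trans (regroup r s x z)
        (≡.trans (cong (ℤ._-_ ((s ℤ.+ x) ℤ.- r)) eq) (ℤ.+-identityʳ _))

    translation : ℤ → ℤ → Perm.Permutation ℓ ℓ
    translation x y = Perm.permutation (shift x y) (shift (ℤ.- x) (ℤ.- y))
      (shift-inverse (ℤ.+-inverseʳ x) (ℤ.+-inverseʳ y)) (shift-inverse (ℤ.+-inverseˡ x) (ℤ.+-inverseˡ y))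

    -- Lagrange's theorem for the quotient: translation permutes the classes.
    ℓ-multiple : ∀ x y → Member (+ ℓ ℤ.* x) (+ ℓ ℤ.* y)
    ℓ-multiple x y = member-≡ (sum-shift r₁ (translation x y) x) (sum-shift r₂ (translation x y) y)
      (sum-member _ _ λ i → member-≡
        (ℤ.+-assoc (r₁ i) x (ℤ.- r₁ (shift x y i))) (ℤ.+-assoc (r₂ i) y (ℤ.- r₂ (shift x y i)))
        (class-member (r₁ i ℤ.+ x) (r₂ i ℤ.+ y)))

    -- An ideal containing 1 contains every difference of representatives, so all classes would
    -- coincide, although `ℓ > 1`.
    1∉ : ¬ Member 1ℤ 0ℤ
    1∉ h = zero≢one (irredundant zero′ one′ (member-≡
        (re (r₁ zero′ ℤ.- r₁ one′) (r₂ zero′ ℤ.- r₂ one′)) (im (r₁ zero′ ℤ.- r₁ one′) (r₂ zero′ ℤ.- r₂ one′))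
        (*-member (r₁ zero′ ℤ.- r₁ one′) (r₂ zero′ ℤ.- r₂ one′) h)))
      where
      zero′ one′ : Fin ℓ
      zero′ = Fin.fromℕ< (ℕ.<-trans (ℕ.s≤s ℕ.z≤n) (ℕ.nonTrivial⇒n>1 ℓ))
      one′ = Fin.fromℕ< (ℕ.nonTrivial⇒n>1 ℓ)
      zero≢one : zero′ ≢ one′
      zero≢one eq with ≡.trans (≡.sym (Fin.toℕ-fromℕ< _)) (≡.trans (cong toℕ eq) (Fin.toℕ-fromℕ< _))
      ... | ()
      re : ∀ m n → m ℤ.* 1ℤ ℤ.- n ℤ.* 0ℤ ≡ m
      re = ℤ-ring-∀
      im : ∀ m n → m ℤ.* 0ℤ ℤ.+ n ℤ.* 1ℤ ℤ.- n ℤ.* 0ℤ ≡ n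
      im = ℤ-ring-∀

    multiple-member : ∀ k → (+ ℓ) ℤᵘ.∣ k → Member k 0ℤ
    multiple-member k ℓ∣k = let ℤ.divides q eq = ℤ.∣ᵤ⇒∣ {+ ℓ} {k} ℓ∣k in
      member-≡ (≡.trans (ℤ.*-comm (+ ℓ) q) (≡.sym eq)) (ℤ.*-zeroʳ (+ ℓ)) (ℓ-multiple q 0ℤ)

    ℓ-member : Member (+ ℓ) 0ℤ
    ℓ-member = multiple-member (+ ℓ) ℕ.∣-refl

    -- The ideal contains `ℓ`. If `ℓ` did not divide `k`, the two would be coprime, and a Bézout
    -- relation would put 1 into the ideal.
    member-multiple : ∀ k → Member k 0ℤ → (+ ℓ) ℤᵘ.∣ k
    member-multiple k h with ℓ ℕ.∣? ℤ.∣ k ∣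
    ... | yes ℓ∣k = ℓ∣k
    ... | no ℓ∤k = ⊥-elim (1∉ (bézout (ℕ.coprime-Bézout coprime)))
      where
      coprime : ℕ.Coprime ℓ ℤ.∣ k ∣
      coprime (d∣ℓ , d∣k) with prime⇒irreducible ℓ-prime d∣ℓ
      ... | inj₁ d≡1 = d≡1
      ... | inj₂ ≡.refl = ⊥-elim (ℓ∤k d∣k)
      unit : ∀ {m n} x y → Member (+ m) 0ℤ → Member (+ n) 0ℤ → 1 ℕ.+ y ℕ.* n ≡ x ℕ.* m → Member 1ℤ 0ℤ
      unit {m} {n} x y hm hn eq = member-≡
        (≡.trans (cong (ℤ._- + y ℤ.* + n) (≡.trans (≡.sym (ℤ.pos-* x m)) (≡.trans (cong +_ (≡.sym eq))
          (cong (ℤ._+_ 1ℤ) (ℤ.pos-* y n))))) (cancel (+ y ℤ.* + n)))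
        (zeros (+ x) (+ y))
        (sub-member (scale-member (+ x) hm) (scale-member (+ y) hn))
        where
        cancel : ∀ z → 1ℤ ℤ.+ z ℤ.- z ≡ 1ℤ
        cancel = ℤ-ring-∀
        zeros : ∀ x y → x ℤ.* 0ℤ ℤ.- y ℤ.* 0ℤ ≡ 0ℤ
        zeros = ℤ-ring-∀
      ∣k∣-member : Member (+ ℤ.∣ k ∣) 0ℤ
      ∣k∣-member with ℤ.+∣i∣≡i⊎+∣i∣≡-i k
      ... | inj₁ eq = member-≡ (≡.sym eq) ≡.refl h
      ... | inj₂ eq = member-≡ (≡.sym eq) ≡.refl (neg-member h)
      bézout : ℕ.Bézout.Identity 1 ℓ ℤ.∣ k ∣ → Member 1ℤ 0ℤ
      bézout (ℕ.Bézout.+- x y eq) = unit x y ℓ-member ∣k∣-member eq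
      bézout (ℕ.Bézout.-+ x y eq) = unit y x ∣k∣-member ℓ-member eq

    -- Among the classes of ω, 0, …, ℓ - 1 two coincide, and those of 0, …, ℓ - 1 are distinct.
    root : ∃[ t ] Member (ℤ.- t) 1ℤ
    root = collision (Fin.pigeonhole (ℕ.n<1+n ℓ) f)
      where
      f : Fin (suc ℓ) → Fin ℓ
      f Fin.zero    = class 0ℤ 1ℤ
      f (Fin.suc i) = class (+ toℕ i) 0ℤ
      collision : (∃₂ λ i j → i Fin.< j × f i ≡ f j) → ∃[ t ] Member (ℤ.- t) 1ℤ
      collision (Fin.zero , Fin.suc j , _ , eq) = + toℕ j , member-≡ (ℤ.+-identityˡ _) ≡.refl (same-class eq)
      collision (Fin.suc i , Fin.suc j , i<j , eq) = ⊥-elim (ℕ.n≮n ℓ (begin-strict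
        ℓ                       ≤⟨ ℕ.∣⇒≤ {{ℕ.>-nonZero (ℕ.m<n⇒0<n∸m (ℕ.s<s⁻¹ i<j))}} ℓ∣ ⟩
        toℕ j ℕ.∸ toℕ i         ≤⟨ ℕ.m∸n≤m (toℕ j) (toℕ i) ⟩
        toℕ j                   <⟨ Fin.toℕ<n j ⟩
        ℓ                       ∎))
        where
        open ℕ.≤-Reasoning
        ℓ∣ : ℓ ℕ.∣ toℕ j ℕ.∸ toℕ i
        ℓ∣ = subst (ℓ ℕ.∣_) (≡.trans (cong ℤ.∣_∣ (ℤ.m-n≡m⊖n (toℕ i) (toℕ j))) (ℤ.∣⊖∣-≤ (ℕ.<⇒≤ (ℕ.s<s⁻¹ i<j))))
          (member-multiple _ (same-class eq))

    t : ℤ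
    t = proj₁ root

    ω-t-member : Member (ℤ.- t) 1ℤ
    ω-t-member = proj₂ root

    -- In one direction, `ℓ` and `ω - t` are members with determinant `ℓ`, which the norm must
    -- divide. In the other, the norm is an integer in the ideal.
    ∣norm∣≡ℓ : ℤ.∣ norm a b ∣ ≡ ℓ
    ∣norm∣≡ℓ = ℕ.∣-antisym
      (subst (λ d → ℤ.∣ norm a b ∣ ℕ.∣ ℤ.∣ d ∣) (det (+ ℓ) t) (norm∣det ℓ-member ω-t-member))
      (member-multiple (norm a b) norm-member)
      where
      det : ∀ l t → l ℤ.* 1ℤ ℤ.- 0ℤ ℤ.* (ℤ.- t) ≡ l
      det = ℤ-ring-∀

    -- The product of `ω - t` with its conjugate `(-1 - t) - ω`. It makes `t` a root of X² + X + 1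
    -- modulo `ℓ`, as ω is of X² + X + 1 itself.
    root-norm-member : Member (t ℤ.* t ℤ.+ t ℤ.+ 1ℤ) 0ℤ
    root-norm-member = member-≡ (re t) (im t) (*-member (-1ℤ ℤ.- t) -1ℤ ω-t-member)
      where
      re : ∀ t → (-1ℤ ℤ.- t) ℤ.* (ℤ.- t) ℤ.- -1ℤ ℤ.* 1ℤ ≡ t ℤ.* t ℤ.+ t ℤ.+ 1ℤ
      re = ℤ-ring-∀
      im : ∀ t → (-1ℤ ℤ.- t) ℤ.* 1ℤ ℤ.+ -1ℤ ℤ.* (ℤ.- t) ℤ.- -1ℤ ℤ.* 1ℤ ≡ 0ℤ
      im = ℤ-ring-∀

    -- Reduction modulo the ideal sends x + yω to x + y t.
    reduce : ∀ x y → Member x y → Member (x ℤ.+ y ℤ.* t) 0ℤ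
    reduce x y h = member-≡ (re x y t) (im y) (sub-member h (scale-member y ω-t-member))
      where
      re : ∀ x y t → x ℤ.- y ℤ.* (ℤ.- t) ≡ x ℤ.+ y ℤ.* t
      re = ℤ-ring-∀
      im : ∀ y → y ℤ.- y ℤ.* 1ℤ ≡ 0ℤ
      im = ℤ-ring-∀

    unreduce : ∀ x y → Member (x ℤ.+ y ℤ.* t) 0ℤ → Member x y
    unreduce x y h = member-≡ (re x y t) (im y) (+-member h (scale-member y ω-t-member))
      where
      re : ∀ x y t → x ℤ.+ y ℤ.* t ℤ.+ y ℤ.* (ℤ.- t) ≡ x
      re = ℤ-ring-∀
      im : ∀ y → 0ℤ ℤ.+ y ℤ.* 1ℤ ≡ y
      im = ℤ-ring-∀

    -- Under ω ↦ `t` the product becomes a product of two integers, to which Euclid's lemma applies.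
    -- The reduction is multiplicative only modulo `t² + t + 1`, whence the correction by
    -- `root-norm-member`.
    member-prime : ∀ x y z w → Member (x ℤ.* z ℤ.- y ℤ.* w) (x ℤ.* w ℤ.+ y ℤ.* z ℤ.- y ℤ.* w) →
                   Member x y ⊎ Member z w
    member-prime x y z w h = factor (euclidsLemma ℤ.∣ x ℤ.+ y ℤ.* t ∣ ℤ.∣ z ℤ.+ w ℤ.* t ∣ ℓ-prime
        (subst (ℓ ℕ.∣_) (ℤ.abs-* (x ℤ.+ y ℤ.* t) (z ℤ.+ w ℤ.* t)) (member-multiple _ product)))
      where
      eq : ∀ x y z w t → (x ℤ.* z ℤ.- y ℤ.* w) ℤ.+ (x ℤ.* w ℤ.+ y ℤ.* z ℤ.- y ℤ.* w) ℤ.* t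
          ℤ.+ y ℤ.* w ℤ.* (t ℤ.* t ℤ.+ t ℤ.+ 1ℤ)
        ≡ (x ℤ.+ y ℤ.* t) ℤ.* (z ℤ.+ w ℤ.* t)
      eq = ℤ-ring-∀
      product : Member ((x ℤ.+ y ℤ.* t) ℤ.* (z ℤ.+ w ℤ.* t)) 0ℤ
      product = member-≡ (eq x y z w t) (≡.trans (ℤ.+-identityˡ _) (ℤ.*-zeroʳ (y ℤ.* w)))
        (+-member (reduce _ _ h) (scale-member (y ℤ.* w) root-norm-member))
      factor : ℓ ℕ.∣ ℤ.∣ x ℤ.+ y ℤ.* t ∣ ⊎ ℓ ℕ.∣ ℤ.∣ z ℤ.+ w ℤ.* t ∣ → Member x y ⊎ Member z w
      factor (inj₁ ℓ∣) = inj₁ (unreduce x y (multiple-member _ ℓ∣))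
      factor (inj₂ ℓ∣) = inj₂ (unreduce z w (multiple-member _ ℓ∣))

-- Completing the square writes four times the norm as a sum of natural numbers, which settles both
-- its zeros and its residues modulo 3.
4∣norm∣≡ : ∀ a b → 4 ℕ.* ℤ.∣ norm a b ∣ ≡
  ℤ.∣ + 2 ℤ.* a ℤ.- b ∣ ℕ.* ℤ.∣ + 2 ℤ.* a ℤ.- b ∣ ℕ.+ 3 ℕ.* (ℤ.∣ b ∣ ℕ.* ℤ.∣ b ∣)
4∣norm∣≡ a b = begin
  4 ℕ.* ℤ.∣ norm a b ∣               ≡⟨ ≡.sym (ℤ.abs-* (+ 4) (norm a b)) ⟩
  ℤ.∣ + 4 ℤ.* norm a b ∣             ≡⟨ cong ℤ.∣_∣ (≡.trans (four a b) (cong₂ (λ x y → x ℤ.+ + 3 ℤ.* y)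
                                        (i*i≡∣i∣*∣i∣ (+ 2 ℤ.* a ℤ.- b)) (i*i≡∣i∣*∣i∣ b))) ⟩
  ℤ.∣ + (X ℕ.* X) ℤ.+ + 3 ℤ.* + (Y ℕ.* Y) ∣
    ≡⟨ cong (λ z → ℤ.∣ + (X ℕ.* X) ℤ.+ z ∣) (≡.sym (ℤ.pos-* 3 (Y ℕ.* Y))) ⟩
  X ℕ.* X ℕ.+ 3 ℕ.* (Y ℕ.* Y)        ∎
  where
  open ≡.≡-Reasoning
  X = ℤ.∣ + 2 ℤ.* a ℤ.- b ∣
  Y = ℤ.∣ b ∣
  four : ∀ a b → + 4 ℤ.* (a ℤ.* a ℤ.- a ℤ.* b ℤ.+ b ℤ.* b)
    ≡ (+ 2 ℤ.* a ℤ.- b) ℤ.* (+ 2 ℤ.* a ℤ.- b) ℤ.+ + 3 ℤ.* (b ℤ.* b)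
  four = ℤ-ring-∀

norm≡0⇒≡0 : ∀ x y → norm x y ≡ 0ℤ → x ≡ 0ℤ × y ≡ 0ℤ
norm≡0⇒≡0 x y eq = x≡0 , y≡0
  where
  square≡0 : ∀ i → ℤ.∣ i ∣ ℕ.* ℤ.∣ i ∣ ≡ 0 → i ≡ 0ℤ
  square≡0 i i²≡0 with ℕ.m*n≡0⇒m≡0∨n≡0 ℤ.∣ i ∣ i²≡0
  ... | inj₁ h = ℤ.∣i∣≡0⇒i≡0 h
  ... | inj₂ h = ℤ.∣i∣≡0⇒i≡0 h
  sum≡0 : ℤ.∣ + 2 ℤ.* x ℤ.- y ∣ ℕ.* ℤ.∣ + 2 ℤ.* x ℤ.- y ∣ ℕ.+ 3 ℕ.* (ℤ.∣ y ∣ ℕ.* ℤ.∣ y ∣) ≡ 0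
  sum≡0 = ≡.trans (≡.sym (4∣norm∣≡ x y)) (cong (λ n → 4 ℕ.* ℤ.∣ n ∣) eq)
  y≡0 : y ≡ 0ℤ
  y≡0 = square≡0 y (ℕ.m+n≡0⇒m≡0 _ (ℕ.m+n≡0⇒n≡0 (ℤ.∣ + 2 ℤ.* x ℤ.- y ∣ ℕ.* ℤ.∣ + 2 ℤ.* x ℤ.- y ∣) sum≡0))
  x≡0 : x ≡ 0ℤ
  x≡0 = ℤ.*-cancelˡ-≡ (+ 2) x 0ℤ (≡.trans
    (ℤ.i-j≡0⇒i≡j (+ 2 ℤ.* x) y (square≡0 (+ 2 ℤ.* x ℤ.- y) (ℕ.m+n≡0⇒m≡0 _ sum≡0))) y≡0)

-- 4ℓ = (2a - b)² + 3b² is a square modulo 3 and differs from 8.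
prime-norm : ∀ {ℓ} → Prime ℓ → ∀ a b → ℤ.∣ norm a b ∣ ≡ ℓ → ℓ ≡ 3 ⊎ ℓ % 6 ≡ 1
prime-norm {ℓ} ℓ-prime a b ∣norm∣≡ℓ = residue (ℓ % 6) (ℕ.m%n<n ℓ 6) ≡.refl
  where
  X = ℤ.∣ + 2 ℤ.* a ℤ.- b ∣
  Y = ℤ.∣ b ∣
  4ℓ≡ : 4 ℕ.* ℓ ≡ X ℕ.* X ℕ.+ 3 ℕ.* (Y ℕ.* Y)
  4ℓ≡ = ≡.trans (cong (4 ℕ.*_) (≡.sym ∣norm∣≡ℓ)) (4∣norm∣≡ a b)
  square%3 : ∀ x → (x ℕ.* x) % 3 ≢ 2
  square%3 x eq = small (x % 3) (ℕ.m%n<n x 3) (≡.trans (≡.sym (ℕ.%-distribˡ-* x x 3)) eq)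
    where
    small : ∀ r → r ℕ.< 3 → (r ℕ.* r) % 3 ≢ 2
    small 0 _ ()
    small 1 _ ()
    small 2 _ ()
    small (suc (suc (suc _))) (ℕ.s≤s (ℕ.s≤s (ℕ.s≤s ())))
  -- This excludes `ℓ = 2`, where `4ℓ = 8`. Larger `x` or `y` already exceed 8, which leaves `x ≤ 2`
  -- and `y ≤ 1`.
  ≢8 : ∀ x y → 8 ≢ x ℕ.* x ℕ.+ 3 ℕ.* (y ℕ.* y)
  ≢8 0 0 ()
  ≢8 0 1 ()
  ≢8 1 0 ()
  ≢8 1 1 ()
  ≢8 2 0 ()
  ≢8 2 1 ()
  ≢8 x@(suc (suc (suc _))) y eq = ℕ.<⇒≢ (ℕ.≤-trans (ℕ.*-mono-≤ 3≤x 3≤x) (ℕ.m≤m+n (x ℕ.* x) (3 ℕ.* (y ℕ.* y)))) eq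
    where 3≤x = ℕ.s≤s (ℕ.s≤s (ℕ.s≤s ℕ.z≤n))
  ≢8 x y@(suc (suc _)) eq = ℕ.<⇒≢ (ℕ.≤-trans (ℕ.*-monoʳ-≤ 3 (ℕ.≤-trans (ℕ.n≤1+n 3) (ℕ.*-mono-≤ 2≤y 2≤y)))
      (ℕ.m≤n+m (3 ℕ.* (y ℕ.* y)) (x ℕ.* x))) eq
    where 2≤y = ℕ.s≤s (ℕ.s≤s ℕ.z≤n)
  divisor : ∀ d → 1 ℕ.< d → d ℕ.∣ ℓ → ℓ ≡ d
  divisor d 1<d d∣ℓ with prime⇒irreducible ℓ-prime d∣ℓ
  ... | inj₁ ≡.refl = ⊥-elim (ℕ.n≮n 1 1<d)
  ... | inj₂ d≡ℓ = ≡.sym d≡ℓ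
  ℓ≢2 : ℓ ≢ 2
  ℓ≢2 ≡.refl = ≢8 X Y 4ℓ≡
  q = ℓ ℕ./ 6
  common-divisor : ∀ {d r} → ℓ % 6 ≡ r → d ℕ.∣ 6 → d ℕ.∣ r → d ℕ.∣ ℓ
  common-divisor {d} {r} eq d∣6 d∣r = subst (d ℕ.∣_) (≡.sym (ℕ.m≡m%n+[m/n]*n ℓ 6))
    (ℕ.∣m∣n⇒∣m+n (subst (d ℕ.∣_) (≡.sym eq) d∣r) (ℕ.∣n⇒∣m*n q d∣6))
  even : ∀ {r} → ℓ % 6 ≡ r → 2 ℕ.∣ r → ⊥
  even eq 2∣r = ℓ≢2 (divisor 2 (ℕ.s≤s (ℕ.s≤s ℕ.z≤n)) (common-divisor eq (ℕ.divides 3 ≡.refl) 2∣r))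
  residue : ∀ r → r ℕ.< 6 → ℓ % 6 ≡ r → ℓ ≡ 3 ⊎ ℓ % 6 ≡ 1
  residue 0 _ eq = ⊥-elim (even eq (ℕ.divides 0 ≡.refl))
  residue 1 _ eq = inj₂ eq
  residue 2 _ eq = ⊥-elim (even eq (ℕ.divides 1 ≡.refl))
  residue 3 _ eq = inj₁ (divisor 3 (ℕ.s≤s (ℕ.s≤s ℕ.z≤n)) (common-divisor eq (ℕ.divides 2 ≡.refl) (ℕ.divides 1 ≡.refl)))
  residue 4 _ eq = ⊥-elim (even eq (ℕ.divides 2 ≡.refl))
  -- Here `4ℓ = 20 + 24q` leaves the remainder 2 modulo 3, whereas `4ℓ` is congruent to `X²`.
  residue 5 _ eq = ⊥-elim (square%3 X (begin
    (X ℕ.* X) % 3                          ≡⟨ ≡.sym (ℕ.[m+kn]%n≡m%n (X ℕ.* X) (Y ℕ.* Y) 3) ⟩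
    (X ℕ.* X ℕ.+ Y ℕ.* Y ℕ.* 3) % 3        ≡⟨ cong (λ z → (X ℕ.* X ℕ.+ z) % 3) (ℕ.*-comm (Y ℕ.* Y) 3) ⟩
    (X ℕ.* X ℕ.+ 3 ℕ.* (Y ℕ.* Y)) % 3      ≡⟨ cong (_% 3) (≡.sym 4ℓ≡) ⟩
    (4 ℕ.* ℓ) % 3                          ≡⟨ cong (λ z → (4 ℕ.* z) % 3) (≡.trans (ℕ.m≡m%n+[m/n]*n ℓ 6) (cong (ℕ._+ q ℕ.* 6) eq)) ⟩
    (4 ℕ.* (5 ℕ.+ q ℕ.* 6)) % 3            ≡⟨ cong (_% 3) (expand q) ⟩
    (2 ℕ.+ (6 ℕ.+ 8 ℕ.* q) ℕ.* 3) % 3      ≡⟨ ℕ.[m+kn]%n≡m%n 2 (6 ℕ.+ 8 ℕ.* q) 3 ⟩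
    2                                      ∎))
    where
    open ≡.≡-Reasoning
    expand : ∀ q → 4 ℕ.* (5 ℕ.+ q ℕ.* 6) ≡ 2 ℕ.+ (6 ℕ.+ 8 ℕ.* q) ℕ.* 3
    expand = ℕ-ring-∀
  residue (suc (suc (suc (suc (suc (suc _)))))) (ℕ.s≤s (ℕ.s≤s (ℕ.s≤s (ℕ.s≤s (ℕ.s≤s (ℕ.s≤s ())))))) _

open import Defs

-- The operations on reals act termwise on sequences, so polynomial identities of reals are checked
-- by a solver on their rational entries.
ℚ-ring : TacticRing.AlmostCommutativeRing 0ℓ 0ℓ
ℚ-ring = TacticRing.fromCommutativeRing ℚ.+-*-commutativeRing λ q → dec⇒maybe (0ℚ ℚ.≟ q)

-- Rational inequalities

p<q⇒0<q-p : ∀ {p q} → p ℚ.< q → 0ℚ ℚ.< q ℚ.- p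
p<q⇒0<q-p {p} {q} p<q = subst (ℚ._< q ℚ.- p) (ℚ.+-inverseʳ p) (ℚ.+-monoˡ-< (ℚ.- p) p<q)

0<q-p⇒p<q : ∀ {p q} → 0ℚ ℚ.< q ℚ.- p → p ℚ.< q
0<q-p⇒p<q {p} {q} h = subst₂ ℚ._<_ (ℚ.+-identityˡ p) (cancel p q) (ℚ.+-monoˡ-< p h)
  where
  cancel : ∀ p q → q ℚ.- p ℚ.+ p ≡ q
  cancel = ring-∀ ℚ-ring

+-pos : ∀ {p q} → 0ℚ ℚ.< p → 0ℚ ℚ.< q → 0ℚ ℚ.< p ℚ.+ q
+-pos {p} {q} p>0 q>0 = subst (ℚ._< p ℚ.+ q) (ℚ.+-identityˡ 0ℚ) (ℚ.+-mono-< p>0 q>0)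

*-pos : ∀ {p q} → 0ℚ ℚ.< p → 0ℚ ℚ.< q → 0ℚ ℚ.< p ℚ.* q
*-pos {p} {q} p>0 q>0 =
  ℚ.positive⁻¹ (p ℚ.* q) {{ℚ.pos*pos⇒pos p {{ℚ.positive p>0}} q {{ℚ.positive q>0}}}}

½*-pos : ∀ {p} → 0ℚ ℚ.< p → 0ℚ ℚ.< ½ ℚ.* p
½*-pos = *-pos (ℚ.positive⁻¹ ½)

<-from-pos : ∀ {p q r} → 0ℚ ℚ.< r → r ≡ q ℚ.- p → p ℚ.< q
<-from-pos r>0 eq = 0<q-p⇒p<q (subst (0ℚ ℚ.<_) eq r>0)

∣p∣<q⇒p<q : ∀ {p q} → ∣ p ∣ ℚ.< q → p ℚ.< q
∣p∣<q⇒p<q {p} with ℚ.≤-total 0ℚ p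
... | inj₁ 0≤p = subst (ℚ._< _) (ℚ.0≤p⇒∣p∣≡p 0≤p)
... | inj₂ p≤0 = ℚ.≤-<-trans (ℚ.≤-trans p≤0 (ℚ.0≤∣p∣ p))

∣∣-< : ∀ {p q} → p ℚ.< q → ℚ.- p ℚ.< q → ∣ p ∣ ℚ.< q
∣∣-< {p} p<q -p<q with ℚ.∣p∣≡p∨∣p∣≡-p p
... | inj₁ eq = subst (ℚ._< _) (≡.sym eq) p<q
... | inj₂ eq = subst (ℚ._< _) (≡.sym eq) -p<q

-- Equality of reals

≡⇒≈ : ∀ {x y} → (∀ n → seq x n ≡ seq y n) → x ≈ y
≡⇒≈ {x} {y} h ε ε>0 = 0 , λ n _ → subst (ℚ._< ε)
  (cong ∣_∣ (≡.sym (≡.trans (cong (ℚ._- seq y n) (h n)) (ℚ.+-inverseʳ (seq y n))))) ε>0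

lin : ∀ {a b x y} → a ≈ b →
      (∀ n → seq a n ℚ.- seq b n ≡ seq x n ℚ.- seq y n) → x ≈ y
lin h eq ε ε>0 = let N , p = h ε ε>0 in
  N , λ n n≥ → subst (λ t → ∣ t ∣ ℚ.< ε) (eq n) (p n n≥)

≈-refl : ∀ {x} → x ≈ x
≈-refl {x} = ≡⇒≈ {x} {x} λ _ → ≡.refl

≈-sym : ∀ {x y} → x ≈ y → y ≈ x
≈-sym {x} {y} h ε ε>0 = let N , p = h ε ε>0 in N , λ n n≥ →
  subst (ℚ._< ε) (≡.trans (≡.sym (ℚ.∣-p∣≡∣p∣ (seq x n ℚ.- seq y n)))
                        (cong ∣_∣ (flip (seq x n) (seq y n)))) (p n n≥)
  where
  flip : ∀ a b → ℚ.- (a ℚ.- b) ≡ b ℚ.- a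
  flip = ring-∀ ℚ-ring

+-cong : ∀ {x y z w} → x ≈ y → z ≈ w → x + z ≈ y + w
+-cong {x} {y} {z} {w} h k ε ε>0 =
  let N , p = h (½ ℚ.* ε) (½*-pos ε>0)
      M , q = k (½ ℚ.* ε) (½*-pos ε>0)
  in N ℕ.⊔ M , λ n n≥ → begin-strict
  ∣ (seq x n ℚ.+ seq z n) ℚ.- (seq y n ℚ.+ seq w n) ∣
    ≡⟨ cong ∣_∣ (regroup (seq x n) (seq z n) (seq y n) (seq w n)) ⟩
  ∣ (seq x n ℚ.- seq y n) ℚ.+ (seq z n ℚ.- seq w n) ∣
    ≤⟨ ℚ.∣p+q∣≤∣p∣+∣q∣ (seq x n ℚ.- seq y n) (seq z n ℚ.- seq w n) ⟩
  ∣ seq x n ℚ.- seq y n ∣ ℚ.+ ∣ seq z n ℚ.- seq w n ∣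
    <⟨ ℚ.+-mono-< (p n (ℕ.m⊔n≤o⇒m≤o N M n≥)) (q n (ℕ.m⊔n≤o⇒n≤o N M n≥)) ⟩
  ½ ℚ.* ε ℚ.+ ½ ℚ.* ε
    ≡⟨ halves ε ⟩
  ε ∎
  where
  open ℚ.≤-Reasoning
  regroup : ∀ a b c d → (a ℚ.+ b) ℚ.- (c ℚ.+ d) ≡ (a ℚ.- c) ℚ.+ (b ℚ.- d)
  regroup = ring-∀ ℚ-ring
  halves : ∀ e → ½ ℚ.* e ℚ.+ ½ ℚ.* e ≡ e
  halves = ring-∀ ℚ-ring

≈-trans : ∀ {x y z} → x ≈ y → y ≈ z → x ≈ z
≈-trans {x} {y} {z} h k = lin {x + y} {y + z} {x} {z} (+-cong {x} {y} {y} {z} h k)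
  λ n → cancel (seq x n) (seq y n) (seq z n)
  where
  cancel : ∀ a b c → (a ℚ.+ b) ℚ.- (b ℚ.+ c) ≡ a ℚ.- c
  cancel = ring-∀ ℚ-ring

bounded : ∀ x → Σ[ K ∈ ℚ ] 0ℚ ℚ.< K × ∃[ N ] ∀ n → N ℕ.≤ n → ∣ seq x n ∣ ℚ.< K
bounded x =
  let N , p = isCauchy x 1ℚ (ℚ.positive⁻¹ 1ℚ) in
  1ℚ ℚ.+ ∣ seq x N ∣ , ℚ.+-mono-<-≤ (ℚ.positive⁻¹ 1ℚ) (ℚ.0≤∣p∣ (seq x N)) , N , λ n n≥ →
  begin-strict
  ∣ seq x n ∣
    ≡⟨ cong ∣_∣ (split (seq x n) (seq x N)) ⟩
  ∣ (seq x n ℚ.- seq x N) ℚ.+ seq x N ∣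
    ≤⟨ ℚ.∣p+q∣≤∣p∣+∣q∣ (seq x n ℚ.- seq x N) (seq x N) ⟩
  ∣ seq x n ℚ.- seq x N ∣ ℚ.+ ∣ seq x N ∣
    <⟨ ℚ.+-monoˡ-< ∣ seq x N ∣ (p n N n≥ ℕ.≤-refl) ⟩
  1ℚ ℚ.+ ∣ seq x N ∣ ∎
  where
  open ℚ.≤-Reasoning
  split : ∀ a b → a ≡ (a ℚ.- b) ℚ.+ b
  split = ring-∀ ℚ-ring

*-congˡ : ∀ c {x y} → x ≈ y → c * x ≈ c * y
*-congˡ c {x} {y} h ε ε>0 = bounds (bounded c)
  where
  open ℚ.≤-Reasoning
  distrib : ∀ a b d → a ℚ.* b ℚ.- a ℚ.* d ≡ a ℚ.* (b ℚ.- d)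
  distrib = ring-∀ ℚ-ring
  bounds : (Σ[ K ∈ ℚ ] 0ℚ ℚ.< K × ∃[ N ] ∀ n → N ℕ.≤ n → ∣ seq c n ∣ ℚ.< K) →
           ∃[ N ] ∀ n → N ℕ.≤ n → ∣ seq c n ℚ.* seq x n ℚ.- seq c n ℚ.* seq y n ∣ ℚ.< ε
  bounds (K , K>0 , N , b) =
    let M , p = h (K⁻¹ ℚ.* ε) (*-pos (ℚ.positive⁻¹ K⁻¹) ε>0)
    in N ℕ.⊔ M , λ n n≥ → begin-strict
    ∣ seq c n ℚ.* seq x n ℚ.- seq c n ℚ.* seq y n ∣
      ≡⟨ cong ∣_∣ (distrib (seq c n) (seq x n) (seq y n)) ⟩
    ∣ seq c n ℚ.* (seq x n ℚ.- seq y n) ∣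
      ≡⟨ ℚ.∣p*q∣≡∣p∣*∣q∣ (seq c n) (seq x n ℚ.- seq y n) ⟩
    ∣ seq c n ∣ ℚ.* ∣ seq x n ℚ.- seq y n ∣
      ≤⟨ ℚ.*-monoʳ-≤-nonNeg ∣ seq x n ℚ.- seq y n ∣ {{ℚ.∣-∣-nonNeg (seq x n ℚ.- seq y n)}}
           (ℚ.<⇒≤ (b n (ℕ.m⊔n≤o⇒m≤o N M n≥))) ⟩
    K ℚ.* ∣ seq x n ℚ.- seq y n ∣
      <⟨ ℚ.*-monoʳ-<-pos K (p n (ℕ.m⊔n≤o⇒n≤o N M n≥)) ⟩
    K ℚ.* (K⁻¹ ℚ.* ε)
      ≡⟨ ≡.trans (≡.sym (ℚ.*-assoc K K⁻¹ ε))
           (≡.trans (cong (ℚ._* ε) (ℚ.*-inverseʳ K)) (ℚ.*-identityˡ ε)) ⟩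
    ε ∎
    where
    instance
      K-pos : ℚ.Positive K
      K-pos = ℚ.positive K>0
      K-nonZero : ℚ.NonZero K
      K-nonZero = ℚ.pos⇒nonZero K
    K⁻¹ = ℚ.1/ K
    instance
      K⁻¹-pos : ℚ.Positive K⁻¹
      K⁻¹-pos = ℚ.1/pos⇒pos K

-- Signs of reals

Pos : ℝ → Set
Pos x = 0ℝ < x

<⇒Pos : ∀ {x y} → x < y → Pos (y - x)
<⇒Pos {x} {y} (ε , ε>0 , N , p) = ε , ε>0 , N , λ n n≥ →
  <-from-pos (p<q⇒0<q-p (p n n≥)) (shift (seq x n) (seq y n) ε)
  where
  shift : ∀ a b e → b ℚ.- (a ℚ.+ e) ≡ (b ℚ.- a) ℚ.- (0ℚ ℚ.+ e)
  shift = ring-∀ ℚ-ring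

Pos⇒< : ∀ {x y} → Pos (y - x) → x < y
Pos⇒< {x} {y} (ε , ε>0 , N , p) = ε , ε>0 , N , λ n n≥ →
  <-from-pos (p<q⇒0<q-p (p n n≥)) (shift (seq x n) (seq y n) ε)
  where
  shift : ∀ a b e → (b ℚ.- a) ℚ.- (0ℚ ℚ.+ e) ≡ b ℚ.- (a ℚ.+ e)
  shift = ring-∀ ℚ-ring

Pos-resp : ∀ {x y} → x ≈ y → Pos x → Pos y
Pos-resp {x} {y} h (ε , ε>0 , N , p) =
  let M , q = h (½ ℚ.* ε) (½*-pos ε>0)
  in ½ ℚ.* ε , ½*-pos ε>0 , N ℕ.⊔ M , λ n n≥ →
  <-from-pos (+-pos (p<q⇒0<q-p (p n (ℕ.m⊔n≤o⇒m≤o N M n≥)))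
                    (p<q⇒0<q-p (∣p∣<q⇒p<q (q n (ℕ.m⊔n≤o⇒n≤o N M n≥)))))
             (combine (seq x n) (seq y n) ε)
  where
  combine : ∀ a b e → a ℚ.- (0ℚ ℚ.+ e) ℚ.+ (½ ℚ.* e ℚ.- (a ℚ.- b)) ≡ b ℚ.- (0ℚ ℚ.+ ½ ℚ.* e)
  combine = ring-∀ ℚ-ring

Pos-+ : ∀ {x y} → Pos x → Pos y → Pos (x + y)
Pos-+ {x} {y} (ε , ε>0 , N , p) (δ , δ>0 , M , q) =
  ε ℚ.+ δ , +-pos ε>0 δ>0 , N ℕ.⊔ M , λ n n≥ →
  <-from-pos (+-pos (p<q⇒0<q-p (p n (ℕ.m⊔n≤o⇒m≤o N M n≥)))
                    (p<q⇒0<q-p (q n (ℕ.m⊔n≤o⇒n≤o N M n≥))))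
             (combine (seq x n) (seq y n) ε δ)
  where
  combine : ∀ a b e d → a ℚ.- (0ℚ ℚ.+ e) ℚ.+ (b ℚ.- (0ℚ ℚ.+ d)) ≡ a ℚ.+ b ℚ.- (0ℚ ℚ.+ (e ℚ.+ d))
  combine = ring-∀ ℚ-ring

Pos-* : ∀ {x y} → Pos x → Pos y → Pos (x * y)
Pos-* {x} {y} (ε , ε>0 , N , p) (δ , δ>0 , M , q) =
  ε ℚ.* δ , *-pos ε>0 δ>0 , N ℕ.⊔ M , λ n n≥ →
  let a = p<q⇒0<q-p (p n (ℕ.m⊔n≤o⇒m≤o N M n≥))
      b = p<q⇒0<q-p (q n (ℕ.m⊔n≤o⇒n≤o N M n≥))
  in <-from-pos (+-pos (*-pos a b) (+-pos (*-pos ε>0 b) (*-pos δ>0 a)))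
                (combine (seq x n) (seq y n) ε δ)
  where
  combine : ∀ a b e d →
    (a ℚ.- (0ℚ ℚ.+ e)) ℚ.* (b ℚ.- (0ℚ ℚ.+ d))
      ℚ.+ (e ℚ.* (b ℚ.- (0ℚ ℚ.+ d)) ℚ.+ d ℚ.* (a ℚ.- (0ℚ ℚ.+ e)))
    ≡ a ℚ.* b ℚ.- (0ℚ ℚ.+ e ℚ.* d)
  combine = ring-∀ ℚ-ring

Pos-irrefl : ∀ {x} → x ≈ 0ℝ → ¬ Pos x
Pos-irrefl {x} h pos =
  let ε , ε>0 , N , p = Pos-resp {x} {0ℝ} h pos
  in ℚ.<-asym ε>0 (subst (ℚ._< 0ℚ) (ℚ.+-identityˡ ε) (p N ℕ.≤-refl))

module _ {x : ℝ} (x≯0 : ¬ Pos x) {ε : ℚ} (ε>0 : 0ℚ ℚ.< ε) where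

  -- A single rational comparison suffices, at an index `N` beyond which the entries differ by less
  -- than `ε/2`: either the entry at `N` is at most `ε/2` and the tail stays below `ε`, or its
  -- excess over `ε/2` witnesses that `x` is positive.
  upper-tail : ∃[ N ] ∀ n → N ℕ.≤ n → seq x n ℚ.< ε
  upper-tail with isCauchy x (½ ℚ.* ε) (½*-pos ε>0)
  ... | N , p with seq x N ℚ.≤? ½ ℚ.* ε
  ... | yes x≤ = N , λ n n≥ → begin-strict
      seq x n                               ≡⟨ split (seq x n) (seq x N) ⟩
      (seq x n ℚ.- seq x N) ℚ.+ seq x N     <⟨ ℚ.+-mono-<-≤ (∣p∣<q⇒p<q (p n N n≥ ℕ.≤-refl)) x≤ ⟩
      ½ ℚ.* ε ℚ.+ ½ ℚ.* ε                   ≡⟨ halves ε ⟩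
      ε                                     ∎
    where
    open ℚ.≤-Reasoning
    split : ∀ a b → a ≡ (a ℚ.- b) ℚ.+ b
    split = ring-∀ ℚ-ring
    halves : ∀ e → ½ ℚ.* e ℚ.+ ½ ℚ.* e ≡ e
    halves = ring-∀ ℚ-ring
  ... | no x≰ = ⊥-elim (x≯0 (seq x N ℚ.- ½ ℚ.* ε , p<q⇒0<q-p (ℚ.≰⇒> x≰) , N , λ n n≥ →
      <-from-pos (p<q⇒0<q-p (∣p∣<q⇒p<q (p N n ℕ.≤-refl n≥))) (combine (seq x N) (seq x n) ε)))
    where
    combine : ∀ a b e → ½ ℚ.* e ℚ.- (a ℚ.- b) ≡ b ℚ.- (0ℚ ℚ.+ (a ℚ.- ½ ℚ.* e))
    combine = ring-∀ ℚ-ring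

≯0∧≮0⇒≈0 : ∀ {x} → ¬ Pos x → ¬ Pos (- x) → x ≈ 0ℝ
≯0∧≮0⇒≈0 {x} x≯0 x≮0 ε ε>0 =
  let N , p = upper-tail {x} x≯0 ε>0
      M , q = upper-tail {x = - x} x≮0 ε>0
  in N ℕ.⊔ M , λ n n≥ → ∣∣-<
    (subst (ℚ._< ε) (≡.sym (ℚ.+-identityʳ (seq x n))) (p n (ℕ.m⊔n≤o⇒m≤o N M n≥)))
    (subst (ℚ._< ε) (cong ℚ.-_ (≡.sym (ℚ.+-identityʳ (seq x n)))) (q n (ℕ.m⊔n≤o⇒n≤o N M n≥)))

x≈y⇒x-y≈0 : ∀ {x y} → x ≈ y → x - y ≈ 0ℝ
x≈y⇒x-y≈0 {x} {y} h = lin {x} {y} {x - y} {0ℝ} h λ n → eq (seq x n) (seq y n)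
  where
  eq : ∀ a b → a ℚ.- b ≡ (a ℚ.- b) ℚ.- 0ℚ
  eq = ring-∀ ℚ-ring

x-y≈0⇒x≈y : ∀ {x y} → x - y ≈ 0ℝ → x ≈ y
x-y≈0⇒x≈y {x} {y} h = lin {x - y} {0ℝ} {x} {y} h λ n → eq (seq x n) (seq y n)
  where
  eq : ∀ a b → (a ℚ.- b) ℚ.- 0ℚ ≡ a ℚ.- b
  eq = ring-∀ ℚ-ring

-cong : ∀ {x y} → x ≈ y → - x ≈ - y
-cong {x} {y} h = lin {y} {x} {x = - x} {y = - y} (≈-sym {x} {y} h) λ n → eq (seq x n) (seq y n)
  where
  eq : ∀ a b → b ℚ.- a ≡ ℚ.- a ℚ.- ℚ.- b
  eq = ring-∀ ℚ-ring

-- The hypothesis is only a negation, yet a positive witness results from the gap between 0 and 1: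
-- `1 - x` is eventually below ½, so `x` stays above ½.
1≤⇒Pos : ∀ {x} → 1ℝ ≤ x → Pos x
1≤⇒Pos {x} 1≤x =
  let N , p = upper-tail {x = 1ℝ - x} (λ h → 1≤x (Pos⇒< {x} {1ℝ} h)) (ℚ.positive⁻¹ ½)
  in ½ , ℚ.positive⁻¹ ½ , N , λ n n≥ → <-from-pos (p<q⇒0<q-p (p n n≥)) (eq (seq x n))
  where
  eq : ∀ a → ½ ℚ.- (1ℚ ℚ.- a) ≡ a ℚ.- (0ℚ ℚ.+ ½)
  eq = ring-∀ ℚ-ring

-- The ordered ring of reals

*-cong : ∀ {x y z w} → x ≈ y → z ≈ w → x * z ≈ y * w
*-cong {x} {y} {z} {w} h k = lin {z * x + y * z} {z * y + y * w} {x * z} {y * w}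
  (+-cong {z * x} {z * y} {y * z} {y * w} (*-congˡ z {x} {y} h) (*-congˡ y {z} {w} k))
  λ n → eq (seq x n) (seq y n) (seq z n) (seq w n)
  where
  eq : ∀ x y z w → (z ℚ.* x ℚ.+ y ℚ.* z) ℚ.- (z ℚ.* y ℚ.+ y ℚ.* w) ≡ x ℚ.* z ℚ.- y ℚ.* w
  eq = ring-∀ ℚ-ring

ℝ-isCommutativeRing : IsCommutativeRing _≈_ _+_ _*_ -_ 0ℝ 1ℝ
ℝ-isCommutativeRing = record
  { isRing = record
    { +-isAbelianGroup = record
      { isGroup = record
        { isMonoid = record
          { isSemigroup = record
            { isMagma = record
              { isEquivalence = record
                { refl  = λ {x} → ≈-refl {x}
                ; sym   = λ {x} {y} → ≈-sym {x} {y}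
                ; trans = λ {x} {y} {z} → ≈-trans {x} {y} {z}
                }
              ; ∙-cong = λ {x} {y} {z} {w} → +-cong {x} {y} {z} {w}
              }
            ; assoc = λ x y z → ≡⇒≈ {x + y + z} {x + (y + z)} λ n →
                ℚ.+-assoc (seq x n) (seq y n) (seq z n)
            }
          ; identity = (λ x → ≡⇒≈ {0ℝ + x} {x} λ n → ℚ.+-identityˡ (seq x n))
                     , (λ x → ≡⇒≈ {x + 0ℝ} {x} λ n → ℚ.+-identityʳ (seq x n))
          }
        ; inverse = (λ x → ≡⇒≈ {x = - x + x} {y = 0ℝ} λ n → ℚ.+-inverseˡ (seq x n))
                  , (λ x → ≡⇒≈ {x = x - x} {y = 0ℝ} λ n → ℚ.+-inverseʳ (seq x n))
        ; ⁻¹-cong = λ {x} {y} → -cong {x} {y}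
        }
      ; comm = λ x y → ≡⇒≈ {x + y} {y + x} λ n → ℚ.+-comm (seq x n) (seq y n)
      }
    ; *-cong = λ {x} {y} {z} {w} → *-cong {x} {y} {z} {w}
    ; *-assoc = λ x y z → ≡⇒≈ {x * y * z} {x * (y * z)} λ n →
        ℚ.*-assoc (seq x n) (seq y n) (seq z n)
    ; *-identity = (λ x → ≡⇒≈ {1ℝ * x} {x} λ n → ℚ.*-identityˡ (seq x n))
                 , (λ x → ≡⇒≈ {x * 1ℝ} {x} λ n → ℚ.*-identityʳ (seq x n))
    ; distrib = (λ x y z → ≡⇒≈ {x * (y + z)} {x * y + x * z} λ n →
                  ℚ.*-distribˡ-+ (seq x n) (seq y n) (seq z n))
              , (λ x y z → ≡⇒≈ {(y + z) * x} {y * x + z * x} λ n →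
                  ℚ.*-distribʳ-+ (seq x n) (seq y n) (seq z n))
    }
  ; *-comm = λ x y → ≡⇒≈ {x * y} {y * x} λ n → ℚ.*-comm (seq x n) (seq y n)
  }

ℤ→ℚ-+ : ∀ a b → ℤ→ℚ (a ℤ.+ b) ≡ ℤ→ℚ a ℚ.+ ℤ→ℚ b
ℤ→ℚ-+ a b = ℚ.toℚᵘ-injective (ℚᵘ.≃-trans (ℚᵘ.*≡* (eq a b))
  (ℚᵘ.≃-sym (ℚ.toℚᵘ-homo-+ (ℤ→ℚ a) (ℤ→ℚ b))))
  where
  eq : ∀ a b → (a ℤ.+ b) ℤ.* ℤ.1ℤ ≡ (a ℤ.* ℤ.1ℤ ℤ.+ b ℤ.* ℤ.1ℤ) ℤ.* ℤ.1ℤ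
  eq = ℤ-ring-∀

ℤ→ℚ-* : ∀ a b → ℤ→ℚ (a ℤ.* b) ≡ ℤ→ℚ a ℚ.* ℤ→ℚ b
ℤ→ℚ-* a b = ℚ.toℚᵘ-injective (ℚᵘ.≃-trans (ℚᵘ.*≡* ≡.refl)
  (ℚᵘ.≃-sym (ℚ.toℚᵘ-homo-* (ℤ→ℚ a) (ℤ→ℚ b))))

ℤ→ℚ-neg : ∀ a → ℤ→ℚ (ℤ.- a) ≡ ℚ.- ℤ→ℚ a
ℤ→ℚ-neg (+ zero)  = ≡.refl
ℤ→ℚ-neg (+ suc n) = ≡.refl
ℤ→ℚ-neg -[1+ n ]  = ≡.refl

Pos-fromℤ : ∀ n → Pos (fromℤ (+ suc n))
Pos-fromℤ n = ½ , ℚ.positive⁻¹ ½ , 0 , λ _ _ → ℚ.<-≤-trans {j = 1ℚ}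
  (ℚ.*<* (ℤ.+<+ (ℕ.s≤s (ℕ.s≤s ℕ.z≤n)))) (ℚ.*≤* (ℤ.+≤+ (ℕ.s≤s ℕ.z≤n)))

ℝ-orderedRing : OrderedRing
ℝ-orderedRing = record
  { commutativeRing = record { isCommutativeRing = ℝ-isCommutativeRing }
  ; Pos        = Pos
  ; Pos-resp   = λ {x} {y} → Pos-resp {x} {y}
  ; Pos-+      = λ {x} {y} → Pos-+ {x} {y}
  ; Pos-*      = λ {x} {y} → Pos-* {x} {y}
  ; Pos-irrefl = λ {x} → Pos-irrefl {x}
  ; ≯0∧≮0⇒≈0   = λ {x} → ≯0∧≮0⇒≈0 {x}
  ; ι          = fromℤ
  ; ι-+        = λ i j → ≡⇒≈ {fromℤ (i ℤ.+ j)} {fromℤ i + fromℤ j} λ _ → ℤ→ℚ-+ i j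
  ; ι-*        = λ i j → ≡⇒≈ {fromℤ (i ℤ.* j)} {fromℤ i * fromℤ j} λ _ → ℤ→ℚ-* i j
  ; ι-neg      = λ i → ≡⇒≈ {fromℤ (ℤ.- i)} {y = - fromℤ i} λ _ → ℤ→ℚ-neg i
  ; ι-0        = ≈-refl {0ℝ}
  ; ι-1        = ≈-refl {1ℝ}
  ; Pos-ι      = Pos-fromℤ
  }

private
  module O = OrderedRingProperties ℝ-orderedRing

-- Real equations from linear combinations

record Equation : Set where
  constructor equation
  field
    lhs rhs coefficient : ℝ
    holds : lhs ≈ rhs

combined : List Equation → ℕ → ℚ
combined []                       n = 0ℚ
combined (equation a b c _ ∷ eqs) n = seq c n ℚ.* (seq a n ℚ.- seq b n) ℚ.+ combined eqs n

-- A certificate of ideal membership: `x - y` is a combination of the differences `lhs - rhs` of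
-- known equations with the given coefficients, and what remains is a rational identity in each
-- term.
linear-combination : ∀ x y (eqs : List Equation) →
  (∀ n → combined eqs n ≡ seq x n ℚ.- seq y n) → x ≈ y
linear-combination x y eqs eq = x-y≈0⇒x≈y {x} {y} (≈-trans {x - y} {total eqs} {0ℝ}
  (≡⇒≈ {x - y} {total eqs} λ n → ≡.trans (≡.sym (eq n)) (seq-total eqs n)) (total≈0 eqs))
  where
  total : List Equation → ℝ
  total []                       = 0ℝ
  total (equation a b c _ ∷ eqs) = c * (a - b) + total eqs
  seq-total : ∀ eqs n → combined eqs n ≡ seq (total eqs) n
  seq-total []                       n = ≡.refl
  seq-total (equation a b c _ ∷ eqs) n = cong (ℚ._+_ (seq c n ℚ.* (seq a n ℚ.- seq b n))) (seq-total eqs n)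
  total≈0 : ∀ eqs → total eqs ≈ 0ℝ
  total≈0 []                       = ≈-refl {0ℝ}
  total≈0 (equation a b c h ∷ eqs) = lin {c * a + total eqs} {c * b + 0ℝ} {c * (a - b) + total eqs} {0ℝ}
    (+-cong {c * a} {c * b} {total eqs} {0ℝ} (*-congˡ c {a} {b} h) (total≈0 eqs))
    λ n → rearrange (seq a n) (seq b n) (seq c n) (seq (total eqs) n)
    where
    rearrange : ∀ a b c t → (c ℚ.* a ℚ.+ t) ℚ.- (c ℚ.* b ℚ.+ 0ℚ) ≡ (c ℚ.* (a ℚ.- b) ℚ.+ t) ℚ.- 0ℚ
    rearrange = ring-∀ ℚ-ring

-- Vectors

≡⇒≋ : ∀ v w → (∀ n → seq (re v) n ≡ seq (re w) n) → (∀ n → seq (im v) n ≡ seq (im w) n) → v ≋ w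
≡⇒≋ v w h k = ≡⇒≈ {re v} {re w} h , ≡⇒≈ {im v} {im w} k

≋-refl : ∀ v → v ≋ v
≋-refl v = ≈-refl {re v} , ≈-refl {im v}

≋-sym : ∀ v w → v ≋ w → w ≋ v
≋-sym v w (h , k) = ≈-sym {re v} {re w} h , ≈-sym {im v} {im w} k

≋-trans : ∀ u v w → u ≋ v → v ≋ w → u ≋ w
≋-trans u v w (h , k) (h′ , k′) = ≈-trans {re u} {re v} {re w} h h′ , ≈-trans {im u} {im v} {im w} k k′

⊕-cong : ∀ u v w z → u ≋ v → w ≋ z → u ⊕ w ≋ v ⊕ z
⊕-cong u v w z (h , k) (h′ , k′) =
  +-cong {re u} {re v} {re w} {re z} h h′ , +-cong {im u} {im v} {im w} {im z} k k′

·-cong : ∀ c v w → v ≋ w → c · v ≋ c · w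
·-cong c v w (h , k) = *-congˡ c {re v} {re w} h , *-congˡ c {im v} {im w} k

⊖-cong : ∀ v w → v ≋ w → ⊖ v ≋ ⊖ w
⊖-cong v w (h , k) = -cong {re v} {re w} h , -cong {im v} {im w} k

⟨⟩-cong : ∀ u v w z → u ≋ v → w ≋ z → ⟨ u , w ⟩ ≈ ⟨ v , z ⟩
⟨⟩-cong u v w z (h , k) (h′ , k′) =
  +-cong {re u * re w} {re v * re z} {im u * im w} {im v * im z}
    (*-cong {re u} {re v} {re w} {re z} h h′) (*-cong {im u} {im v} {im w} {im z} k k′)

⊗-cong : ∀ u v w z → u ≋ v → w ≋ z → u ⊗ w ≋ v ⊗ z
⊗-cong u v w z (h , k) (h′ , k′) =
    +-cong {re u * re w} {re v * re z} {z = - (im u * im w)} {w = - (im v * im z)}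
      (*-cong {re u} {re v} {re w} {re z} h h′)
      (-cong {im u * im w} {im v * im z} (*-cong {im u} {im v} {im w} {im z} k k′))
  , +-cong {re u * im w} {re v * im z} {im u * re w} {im v * re z}
      (*-cong {re u} {re v} {im w} {im z} h k′) (*-cong {im u} {im v} {re w} {re z} k h′)

·-cancel : ∀ c → 0ℝ < c → ∀ v w → c · v ≋ c · w → v ≋ w
·-cancel c c>0 v w (h , k) =
  O.*-cancelˡ-Pos {c} c>0 (re v) (re w) h , O.*-cancelˡ-Pos {c} c>0 (im v) (im w) k

-- Integer combinations of two vectors

comb : ℤ → ℤ → ℂ → ℂ → ℂ
comb x y v w = fromℤ x · v ⊕ fromℤ y · w

comb-cong : ∀ x y v v′ w w′ → v ≋ v′ → w ≋ w′ → comb x y v w ≋ comb x y v′ w′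
comb-cong x y v v′ w w′ h k =
  ⊕-cong (fromℤ x · v) (fromℤ x · v′) (fromℤ y · w) (fromℤ y · w′)
    (·-cong (fromℤ x) v v′ h) (·-cong (fromℤ y) w w′ k)

comb-· : ∀ c x y v w → c · comb x y v w ≋ comb x y (c · v) (c · w)
comb-· c x y v w = ≡⇒≋ (c · comb x y v w) (comb x y (c · v) (c · w))
  (λ n → eq (seq c n) (ℤ→ℚ x) (ℤ→ℚ y) (seq (re v) n) (seq (re w) n))
  (λ n → eq (seq c n) (ℤ→ℚ x) (ℤ→ℚ y) (seq (im v) n) (seq (im w) n))
  where
  eq : ∀ c x y v w → c ℚ.* (x ℚ.* v ℚ.+ y ℚ.* w) ≡ x ℚ.* (c ℚ.* v) ℚ.+ y ℚ.* (c ℚ.* w)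
  eq = ring-∀ ℚ-ring

ℤ→ℚ-combination : ∀ k p l q → ℤ→ℚ (k ℤ.* p ℤ.+ l ℤ.* q) ≡ ℤ→ℚ k ℚ.* ℤ→ℚ p ℚ.+ ℤ→ℚ l ℚ.* ℤ→ℚ q
ℤ→ℚ-combination k p l q = ≡.trans (ℤ→ℚ-+ (k ℤ.* p) (l ℤ.* q)) (cong₂ ℚ._+_ (ℤ→ℚ-* k p) (ℤ→ℚ-* l q))

comb-comb : ∀ k l p₁ p₂ q₁ q₂ v w →
  comb k l (comb p₁ p₂ v w) (comb q₁ q₂ v w)
  ≋ comb (k ℤ.* p₁ ℤ.+ l ℤ.* q₁) (k ℤ.* p₂ ℤ.+ l ℤ.* q₂) v w
comb-comb k l p₁ p₂ q₁ q₂ v w = ≡⇒≋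
  (comb k l (comb p₁ p₂ v w) (comb q₁ q₂ v w))
  (comb (k ℤ.* p₁ ℤ.+ l ℤ.* q₁) (k ℤ.* p₂ ℤ.+ l ℤ.* q₂) v w)
  (λ n → component (seq (re v) n) (seq (re w) n)) (λ n → component (seq (im v) n) (seq (im w) n))
  where
  eq : ∀ k l p₁ p₂ q₁ q₂ v w →
    k ℚ.* (p₁ ℚ.* v ℚ.+ p₂ ℚ.* w) ℚ.+ l ℚ.* (q₁ ℚ.* v ℚ.+ q₂ ℚ.* w)
    ≡ (k ℚ.* p₁ ℚ.+ l ℚ.* q₁) ℚ.* v ℚ.+ (k ℚ.* p₂ ℚ.+ l ℚ.* q₂) ℚ.* w
  eq = ring-∀ ℚ-ring
  component : ∀ v w →
    ℤ→ℚ k ℚ.* (ℤ→ℚ p₁ ℚ.* v ℚ.+ ℤ→ℚ p₂ ℚ.* w) ℚ.+ ℤ→ℚ l ℚ.* (ℤ→ℚ q₁ ℚ.* v ℚ.+ ℤ→ℚ q₂ ℚ.* w)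
    ≡ ℤ→ℚ (k ℤ.* p₁ ℤ.+ l ℤ.* q₁) ℚ.* v ℚ.+ ℤ→ℚ (k ℤ.* p₂ ℤ.+ l ℤ.* q₂) ℚ.* w
  component v w = ≡.trans (eq (ℤ→ℚ k) (ℤ→ℚ l) (ℤ→ℚ p₁) (ℤ→ℚ p₂) (ℤ→ℚ q₁) (ℤ→ℚ q₂) v w)
    (cong₂ (λ s t → s ℚ.* v ℚ.+ t ℚ.* w)
      (≡.sym (ℤ→ℚ-combination k p₁ l q₁)) (≡.sym (ℤ→ℚ-combination k p₂ l q₂)))

comb-neg : ∀ x y v w → comb (ℤ.- x) (ℤ.- y) v w ≋ ⊖ comb x y v w
comb-neg x y v w = ≡⇒≋ (comb (ℤ.- x) (ℤ.- y) v w) (⊖ comb x y v w)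
  (λ n → component (seq (re v) n) (seq (re w) n)) (λ n → component (seq (im v) n) (seq (im w) n))
  where
  eq : ∀ x y v w → (ℚ.- x) ℚ.* v ℚ.+ (ℚ.- y) ℚ.* w ≡ ℚ.- (x ℚ.* v ℚ.+ y ℚ.* w)
  eq = ring-∀ ℚ-ring
  component : ∀ v w → ℤ→ℚ (ℤ.- x) ℚ.* v ℚ.+ ℤ→ℚ (ℤ.- y) ℚ.* w ≡ ℚ.- (ℤ→ℚ x ℚ.* v ℚ.+ ℤ→ℚ y ℚ.* w)
  component v w = ≡.trans (cong₂ (λ s t → s ℚ.* v ℚ.+ t ℚ.* w) (ℤ→ℚ-neg x) (ℤ→ℚ-neg y))
    (eq (ℤ→ℚ x) (ℤ→ℚ y) v w)

comb-- : ∀ x y z t v w → comb x y v w ⊖ comb z t v w ≋ comb (x ℤ.- z) (y ℤ.- t) v w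
comb-- x y z t v w = ≡⇒≋ (comb x y v w ⊖ comb z t v w) (comb (x ℤ.- z) (y ℤ.- t) v w)
  (λ n → component (seq (re v) n) (seq (re w) n)) (λ n → component (seq (im v) n) (seq (im w) n))
  where
  eq : ∀ x y z t v w → x ℚ.* v ℚ.+ y ℚ.* w ℚ.- (z ℚ.* v ℚ.+ t ℚ.* w) ≡ (x ℚ.+ ℚ.- z) ℚ.* v ℚ.+ (y ℚ.+ ℚ.- t) ℚ.* w
  eq = ring-∀ ℚ-ring
  difference : ∀ i j → ℤ→ℚ i ℚ.+ ℚ.- ℤ→ℚ j ≡ ℤ→ℚ (i ℤ.- j)
  difference i j = ≡.trans (cong (ℚ._+_ (ℤ→ℚ i)) (≡.sym (ℤ→ℚ-neg j))) (≡.sym (ℤ→ℚ-+ i (ℤ.- j)))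
  component : ∀ v w → ℤ→ℚ x ℚ.* v ℚ.+ ℤ→ℚ y ℚ.* w ℚ.- (ℤ→ℚ z ℚ.* v ℚ.+ ℤ→ℚ t ℚ.* w)
    ≡ ℤ→ℚ (x ℤ.- z) ℚ.* v ℚ.+ ℤ→ℚ (y ℤ.- t) ℚ.* w
  component v w = ≡.trans (eq (ℤ→ℚ x) (ℤ→ℚ y) (ℤ→ℚ z) (ℤ→ℚ t) v w)
    (cong₂ (λ s r → s ℚ.* v ℚ.+ r ℚ.* w) (difference x z) (difference y t))

Independent : ℂ → ℂ → Set
Independent v w = ∀ x y → comb x y v w ≋ 0ℂ → x ≡ 0ℤ × y ≡ 0ℤ

comb-injective : ∀ v w → Independent v w → ∀ x y z t → comb x y v w ≋ comb z t v w → x ≡ z × y ≡ t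
comb-injective v w indep x y z t h =
  let e , e′ = indep (x ℤ.- z) (y ℤ.- t) (≋-trans (comb (x ℤ.- z) (y ℤ.- t) v w)
        (comb x y v w ⊖ comb z t v w) 0ℂ
        (≋-sym (comb x y v w ⊖ comb z t v w) (comb (x ℤ.- z) (y ℤ.- t) v w) (comb-- x y z t v w))
        ( x≈y⇒x-y≈0 {re (comb x y v w)} {re (comb z t v w)} (proj₁ h)
        , x≈y⇒x-y≈0 {im (comb x y v w)} {im (comb z t v w)} (proj₂ h)))
  in ℤ.i-j≡0⇒i≡j x z e , ℤ.i-j≡0⇒i≡j y t e′

-- Hexagonal lattices

module Gram (v w : ℂ) where

  open O.Form ⟨ v , v ⟩ (⟨ v , w ⟩ + ⟨ v , w ⟩) ⟨ w , w ⟩ public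

  ⟨comb⟩ : ∀ x y → ⟨ comb x y v w , comb x y v w ⟩ ≈ form x y
  ⟨comb⟩ x y = ≡⇒≈ {⟨ comb x y v w , comb x y v w ⟩} {form x y} λ n →
    eq (ℤ→ℚ x) (ℤ→ℚ y) (seq (re v) n) (seq (im v) n) (seq (re w) n) (seq (im w) n)
    where
    eq : ∀ x y v₁ v₂ w₁ w₂ →
      (x ℚ.* v₁ ℚ.+ y ℚ.* w₁) ℚ.* (x ℚ.* v₁ ℚ.+ y ℚ.* w₁)
        ℚ.+ (x ℚ.* v₂ ℚ.+ y ℚ.* w₂) ℚ.* (x ℚ.* v₂ ℚ.+ y ℚ.* w₂)
      ≡ (v₁ ℚ.* v₁ ℚ.+ v₂ ℚ.* v₂) ℚ.* (x ℚ.* x)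
        ℚ.+ (v₁ ℚ.* w₁ ℚ.+ v₂ ℚ.* w₂ ℚ.+ (v₁ ℚ.* w₁ ℚ.+ v₂ ℚ.* w₂)) ℚ.* (x ℚ.* y)
        ℚ.+ (w₁ ℚ.* w₁ ℚ.+ w₂ ℚ.* w₂) ℚ.* (y ℚ.* y)
    eq = ring-∀ ℚ-ring

  ⟨comb,comb⟩ : ∀ p₁ p₂ q₁ q₂ →
    ⟨ comb p₁ p₂ v w , comb q₁ q₂ v w ⟩ + ⟨ comb p₁ p₂ v w , comb q₁ q₂ v w ⟩ ≈ polar p₁ p₂ q₁ q₂
  ⟨comb,comb⟩ p₁ p₂ q₁ q₂ = ≡⇒≈
    {⟨ comb p₁ p₂ v w , comb q₁ q₂ v w ⟩ + ⟨ comb p₁ p₂ v w , comb q₁ q₂ v w ⟩} {polar p₁ p₂ q₁ q₂} λ n →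
    eq (ℤ→ℚ p₁) (ℤ→ℚ p₂) (ℤ→ℚ q₁) (ℤ→ℚ q₂) (seq (re v) n) (seq (im v) n) (seq (re w) n) (seq (im w) n)
    where
    eq : ∀ p₁ p₂ q₁ q₂ v₁ v₂ w₁ w₂ →
      (p₁ ℚ.* v₁ ℚ.+ p₂ ℚ.* w₁) ℚ.* (q₁ ℚ.* v₁ ℚ.+ q₂ ℚ.* w₁)
        ℚ.+ (p₁ ℚ.* v₂ ℚ.+ p₂ ℚ.* w₂) ℚ.* (q₁ ℚ.* v₂ ℚ.+ q₂ ℚ.* w₂)
      ℚ.+ ((p₁ ℚ.* v₁ ℚ.+ p₂ ℚ.* w₁) ℚ.* (q₁ ℚ.* v₁ ℚ.+ q₂ ℚ.* w₁)
        ℚ.+ (p₁ ℚ.* v₂ ℚ.+ p₂ ℚ.* w₂) ℚ.* (q₁ ℚ.* v₂ ℚ.+ q₂ ℚ.* w₂))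
      ≡ ℤ→ℚ (+ 2) ℚ.* (v₁ ℚ.* v₁ ℚ.+ v₂ ℚ.* v₂) ℚ.* (p₁ ℚ.* q₁)
        ℚ.+ (v₁ ℚ.* w₁ ℚ.+ v₂ ℚ.* w₂ ℚ.+ (v₁ ℚ.* w₁ ℚ.+ v₂ ℚ.* w₂)) ℚ.* (p₁ ℚ.* q₂ ℚ.+ p₂ ℚ.* q₁)
        ℚ.+ ℤ→ℚ (+ 2) ℚ.* (w₁ ℚ.* w₁ ℚ.+ w₂ ℚ.* w₂) ℚ.* (p₂ ℚ.* q₂)
    eq = ring-∀ ℚ-ring

record IsHexagonal (N : Pred ℂ 0ℓ) (u : ℝ) (p q : ℂ) : Set where
  field
    norm-p : ⟨ p , p ⟩ ≈ u
    norm-q : ⟨ q , q ⟩ ≈ u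
    trace  : ⟨ p , q ⟩ + ⟨ p , q ⟩ ≈ - u
    spans  : N ≐ ℤ-span p q

module _ (N : Pred ℂ 0ℓ) (v w : ℂ) (u : ℝ) (N≐span : N ≐ ℤ-span v w) (indep : Independent v w) (u>0 : 0ℝ < u)
  (minimal : ∀ z → z ∈ N → ¬ (z ≋ 0ℂ) → ¬ (⟨ z , z ⟩ < u))
  (r : Fin 3 → ℂ) (r∈N : ∀ i → r i ∈ N) (norm-r : ∀ i → ⟨ r i , r i ⟩ ≈ u)
  (distinct : ∀ i j → r i ≋ r j ⊎ r i ≋ ⊖ r j → i ≡ j) where

  private
    module G = Gram v w

    r₁ r₂ : Fin 3 → ℤ
    r₁ i = proj₁ (proj₁ N≐span (r∈N i))
    r₂ i = proj₁ (proj₂ (proj₁ N≐span (r∈N i)))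

    r≋ : ∀ i → r i ≋ comb (r₁ i) (r₂ i) v w
    r≋ i = proj₂ (proj₂ (proj₁ N≐span (r∈N i)))

    form-r : ∀ i → G.form (r₁ i) (r₂ i) ≈ u
    form-r i = ≈-trans {G.form (r₁ i) (r₂ i)} {⟨ r i , r i ⟩} {u}
      (≈-sym {⟨ r i , r i ⟩} {G.form (r₁ i) (r₂ i)}
        (≈-trans {⟨ r i , r i ⟩} {⟨ c , c ⟩} {G.form (r₁ i) (r₂ i)}
          (⟨⟩-cong (r i) c (r i) c (r≋ i) (r≋ i)) (G.⟨comb⟩ (r₁ i) (r₂ i))))
      (norm-r i)
      where c = comb (r₁ i) (r₂ i) v w

    r≢ : ∀ i j → i ≢ j → ¬ (r₁ i ≡ r₁ j × r₂ i ≡ r₂ j)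
    r≢ i j i≢j (e₁ , e₂) = i≢j (distinct i j (inj₁ (≋-trans (r i) (comb (r₁ j) (r₂ j) v w) (r j)
      (subst (r i ≋_) (cong₂ (λ x y → comb x y v w) e₁ e₂) (r≋ i))
      (≋-sym (r j) (comb (r₁ j) (r₂ j) v w) (r≋ j)))))

    r≢- : ∀ i j → i ≢ j → ¬ (r₁ i ≡ ℤ.- r₁ j × r₂ i ≡ ℤ.- r₂ j)
    r≢- i j i≢j (e₁ , e₂) = i≢j (distinct i j (inj₂ (≋-trans (r i) (comb (ℤ.- r₁ j) (ℤ.- r₂ j) v w) (⊖ r j)
      (subst (r i ≋_) (cong₂ (λ x y → comb x y v w) e₁ e₂) (r≋ i))
      (≋-trans (comb (ℤ.- r₁ j) (ℤ.- r₂ j) v w) (⊖ comb (r₁ j) (r₂ j) v w) (⊖ r j)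
        (comb-neg (r₁ j) (r₂ j) v w)
        (⊖-cong (comb (r₁ j) (r₂ j) v w) (r j) (≋-sym (r j) (comb (r₁ j) (r₂ j) v w) (r≋ j)))))))

    form-minimal : ∀ x y → ¬ (x ≡ 0ℤ × y ≡ 0ℤ) → O.NonNeg (G.form x y - u)
    form-minimal x y ≢0 F<u = minimal c (proj₂ N≐span (x , y , ≋-refl c)) (λ c≋0 → ≢0 (indep x y c≋0))
      (Pos⇒< {⟨ c , c ⟩} {u} (Pos-resp {x = - (G.form x y - u)} {y = u - ⟨ c , c ⟩}
        (linear-combination (- (G.form x y - u)) (u - ⟨ c , c ⟩)
          (equation ⟨ c , c ⟩ (G.form x y) 1ℝ (G.⟨comb⟩ x y) ∷ [])
          λ n → eq (seq ⟨ c , c ⟩ n) (seq (G.form x y) n) (seq u n)) F<u))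
      where
      c = comb x y v w
      eq : ∀ c f u → 1ℚ ℚ.* (c ℚ.- f) ℚ.+ 0ℚ ≡ ℚ.- (f ℚ.- u) ℚ.- (u ℚ.- c)
      eq = ring-∀ ℚ-ring

    i₀ i₁ i₂ : Fin 3
    i₀ = Fin.zero
    i₁ = Fin.suc Fin.zero
    i₂ = Fin.suc (Fin.suc Fin.zero)

    module B = G.HexagonalBasis (G.MinimalPair.hexagonalBasis {u} u>0 form-minimal
      (r₁ i₀) (r₂ i₀) (r₁ i₁) (r₂ i₁) (form-r i₀) (form-r i₁) (r≢ i₀ i₁ λ ()) (r≢- i₀ i₁ λ ())
      (r₁ i₂) (r₂ i₂) (form-r i₂)
      (r≢ i₀ i₂ λ ()) (r≢- i₀ i₂ λ ()) (r≢ i₁ i₂ λ ()) (r≢- i₁ i₂ λ ()))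

  hexagonal : ∃₂ (IsHexagonal N u)
  hexagonal = p , q , record
    { norm-p = ≈-trans {⟨ p , p ⟩} {G.form B.p₁ B.p₂} {u} (G.⟨comb⟩ B.p₁ B.p₂) B.form-p
    ; norm-q = ≈-trans {⟨ q , q ⟩} {G.form B.q₁ B.q₂} {u} (G.⟨comb⟩ B.q₁ B.q₂) B.form-q
    ; trace  = ≈-trans {⟨ p , q ⟩ + ⟨ p , q ⟩} {G.polar B.p₁ B.p₂ B.q₁ B.q₂} {z = - u}
                 (G.⟨comb,comb⟩ B.p₁ B.p₂ B.q₁ B.q₂) B.polar-p-q
    ; spans  = to , from
    }
    where
    p = comb B.p₁ B.p₂ v w
    q = comb B.q₁ B.q₂ v w
    to : ∀ {z} → z ∈ N → ℤ-span p q z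
    to {z} z∈N =
      let x , y , z≋ = proj₁ N≐span z∈N
          k , l , e₁ , e₂ = B.generates x y
          x′ = k ℤ.* B.p₁ ℤ.+ l ℤ.* B.q₁
          y′ = k ℤ.* B.p₂ ℤ.+ l ℤ.* B.q₂
      in k , l , ≋-trans z (comb x′ y′ v w) (comb k l p q)
           (subst (z ≋_) (cong₂ (λ x y → comb x y v w) e₁ e₂) z≋)
           (≋-sym (comb k l p q) (comb x′ y′ v w) (comb-comb k l B.p₁ B.p₂ B.q₁ B.q₂ v w))
    from : ∀ {z} → ℤ-span p q z → z ∈ N
    from {z} (k , l , z≋) = proj₂ N≐span (x′ , y′ , ≋-trans z (comb k l p q) (comb x′ y′ v w) z≋
      (comb-comb k l B.p₁ B.p₂ B.q₁ B.q₂ v w))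
      where
      x′ = k ℤ.* B.p₁ ℤ.+ l ℤ.* B.q₁
      y′ = k ℤ.* B.p₂ ℤ.+ l ℤ.* B.q₂

ℤ→ℚ-norm : ∀ x y → ℤ→ℚ (norm x y) ≡ ℤ→ℚ x ℚ.* ℤ→ℚ x ℚ.+ ℚ.- (ℤ→ℚ x ℚ.* ℤ→ℚ y) ℚ.+ ℤ→ℚ y ℚ.* ℤ→ℚ y
ℤ→ℚ-norm x y = ≡.trans (ℤ→ℚ-+ (x ℤ.* x ℤ.- x ℤ.* y) (y ℤ.* y)) (cong₂ ℚ._+_
  (≡.trans (ℤ→ℚ-+ (x ℤ.* x) (ℤ.- (x ℤ.* y))) (cong₂ ℚ._+_ (ℤ→ℚ-* x x)
    (≡.trans (ℤ→ℚ-neg (x ℤ.* y)) (cong ℚ.-_ (ℤ→ℚ-* x y))))) (ℤ→ℚ-* y y))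

trace-form : ℤ → ℤ → ℤ → ℤ → ℤ
trace-form a b c d = + 2 ℤ.* (a ℤ.* c) ℤ.- (a ℤ.* d ℤ.+ b ℤ.* c) ℤ.+ + 2 ℤ.* (b ℤ.* d)

ℤ→ℚ-trace-form : ∀ a b c d → ℤ→ℚ (trace-form a b c d)
  ≡ ℤ→ℚ (+ 2) ℚ.* (ℤ→ℚ a ℚ.* ℤ→ℚ c) ℚ.+ ℚ.- (ℤ→ℚ a ℚ.* ℤ→ℚ d ℚ.+ ℤ→ℚ b ℚ.* ℤ→ℚ c)
    ℚ.+ ℤ→ℚ (+ 2) ℚ.* (ℤ→ℚ b ℚ.* ℤ→ℚ d)
ℤ→ℚ-trace-form a b c d = ≡.trans
  (ℤ→ℚ-+ (+ 2 ℤ.* (a ℤ.* c) ℤ.- (a ℤ.* d ℤ.+ b ℤ.* c)) (+ 2 ℤ.* (b ℤ.* d)))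
  (cong₂ ℚ._+_
    (≡.trans (ℤ→ℚ-+ (+ 2 ℤ.* (a ℤ.* c)) (ℤ.- (a ℤ.* d ℤ.+ b ℤ.* c))) (cong₂ ℚ._+_ (double a c)
      (≡.trans (ℤ→ℚ-neg (a ℤ.* d ℤ.+ b ℤ.* c)) (cong ℚ.-_ (ℤ→ℚ-combination a d b c)))))
    (double b d))
  where
  double : ∀ i j → ℤ→ℚ (+ 2 ℤ.* (i ℤ.* j)) ≡ ℤ→ℚ (+ 2) ℚ.* (ℤ→ℚ i ℚ.* ℤ→ℚ j)
  double i j = ≡.trans (ℤ→ℚ-* (+ 2) (i ℤ.* j)) (cong (ℚ._*_ (ℤ→ℚ (+ 2))) (ℤ→ℚ-* i j))

-- p and q correspond to 1 and ω.
module UnitBasis (p q : ℂ) (norm-p : ⟨ p , p ⟩ ≈ 1ℝ) (norm-q : ⟨ q , q ⟩ ≈ 1ℝ)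
  (trace : ⟨ p , q ⟩ + ⟨ p , q ⟩ ≈ - 1ℝ) where

  private
    module G = Gram p q

  ⟨comb⟩≈norm : ∀ x y → ⟨ comb x y p q , comb x y p q ⟩ ≈ fromℤ (norm x y)
  ⟨comb⟩≈norm x y = ≈-trans {⟨ comb x y p q , comb x y p q ⟩} {G.form x y} {fromℤ (norm x y)} (G.⟨comb⟩ x y)
    (linear-combination (G.form x y) (fromℤ (norm x y))
      ( equation ⟨ p , p ⟩ 1ℝ (fromℤ x * fromℤ x) norm-p
      ∷ equation (⟨ p , q ⟩ + ⟨ p , q ⟩) (- 1ℝ) (fromℤ x * fromℤ y) trace
      ∷ equation ⟨ q , q ⟩ 1ℝ (fromℤ y * fromℤ y) norm-q ∷ [])
      λ n → ≡.trans (eq (ℤ→ℚ x) (ℤ→ℚ y) (seq ⟨ p , p ⟩ n) (seq (⟨ p , q ⟩ + ⟨ p , q ⟩) n) (seq ⟨ q , q ⟩ n))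
        (cong (ℚ._-_ (seq (G.form x y) n)) (≡.sym (ℤ→ℚ-norm x y))))
    where
    eq : ∀ x y A B C → x ℚ.* x ℚ.* (A ℚ.- 1ℚ) ℚ.+ (x ℚ.* y ℚ.* (B ℚ.- ℚ.- 1ℚ) ℚ.+ (y ℚ.* y ℚ.* (C ℚ.- 1ℚ) ℚ.+ 0ℚ))
      ≡ A ℚ.* (x ℚ.* x) ℚ.+ B ℚ.* (x ℚ.* y) ℚ.+ C ℚ.* (y ℚ.* y) ℚ.- (x ℚ.* x ℚ.+ ℚ.- (x ℚ.* y) ℚ.+ y ℚ.* y)
    eq = ring-∀ ℚ-ring

  ⟨comb,comb⟩≈trace : ∀ a b c d →
    ⟨ comb a b p q , comb c d p q ⟩ + ⟨ comb a b p q , comb c d p q ⟩ ≈ fromℤ (trace-form a b c d)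
  ⟨comb,comb⟩≈trace a b c d = ≈-trans
    {⟨ comb a b p q , comb c d p q ⟩ + ⟨ comb a b p q , comb c d p q ⟩} {G.polar a b c d} {fromℤ (trace-form a b c d)}
    (G.⟨comb,comb⟩ a b c d)
    (linear-combination (G.polar a b c d) (fromℤ (trace-form a b c d))
      ( equation ⟨ p , p ⟩ 1ℝ (fromℤ (+ 2) * (fromℤ a * fromℤ c)) norm-p
      ∷ equation (⟨ p , q ⟩ + ⟨ p , q ⟩) (- 1ℝ) (fromℤ a * fromℤ d + fromℤ b * fromℤ c) trace
      ∷ equation ⟨ q , q ⟩ 1ℝ (fromℤ (+ 2) * (fromℤ b * fromℤ d)) norm-q ∷ [])
      λ n → ≡.trans (eq (ℤ→ℚ a) (ℤ→ℚ b) (ℤ→ℚ c) (ℤ→ℚ d) (ℤ→ℚ (+ 2))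
          (seq ⟨ p , p ⟩ n) (seq (⟨ p , q ⟩ + ⟨ p , q ⟩) n) (seq ⟨ q , q ⟩ n))
        (cong (ℚ._-_ (seq (G.polar a b c d) n)) (≡.sym (ℤ→ℚ-trace-form a b c d))))
    where
    eq : ∀ a b c d t A B C → t ℚ.* (a ℚ.* c) ℚ.* (A ℚ.- 1ℚ)
        ℚ.+ ((a ℚ.* d ℚ.+ b ℚ.* c) ℚ.* (B ℚ.- ℚ.- 1ℚ) ℚ.+ (t ℚ.* (b ℚ.* d) ℚ.* (C ℚ.- 1ℚ) ℚ.+ 0ℚ))
      ≡ t ℚ.* A ℚ.* (a ℚ.* c) ℚ.+ B ℚ.* (a ℚ.* d ℚ.+ b ℚ.* c) ℚ.+ t ℚ.* C ℚ.* (b ℚ.* d)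
        ℚ.- (t ℚ.* (a ℚ.* c) ℚ.+ ℚ.- (a ℚ.* d ℚ.+ b ℚ.* c) ℚ.+ t ℚ.* (b ℚ.* d))
    eq = ring-∀ ℚ-ring

  -- A vanishing combination has squared length 0, which is an integer norm, and the norm form
  -- vanishes only at the origin.
  independent : Independent p q
  independent x y h = norm≡0⇒≡0 x y (O.ι-≡0 (norm x y) (≈-trans {fromℤ (norm x y)} {⟨ c , c ⟩} {0ℝ}
    (≈-sym {⟨ c , c ⟩} {fromℤ (norm x y)} (⟨comb⟩≈norm x y))
    (≈-trans {⟨ c , c ⟩} {⟨ 0ℂ , 0ℂ ⟩} {0ℝ} (⟨⟩-cong c 0ℂ c 0ℂ h h) (≡⇒≈ {⟨ 0ℂ , 0ℂ ⟩} {0ℝ} λ _ → ≡.refl))))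
    where c = comb x y p q

  d : ℝ
  d = re p * im q - im p * re q

  -- Lagrange's identity gives `d² = |p|²|q|² - ⟨p,q⟩²`, here `1 - 1/4`. The last coefficient comes
  -- from `⟨p,q⟩² = g²/4` and `g² - 1 = (g - 1)(g + 1)`.
  d²≈¾ : d * d ≈ fromℚ (+ 3 ℚ./ 4)
  d²≈¾ = linear-combination (d * d) (fromℚ (+ 3 ℚ./ 4))
    ( equation ⟨ p , p ⟩ 1ℝ ⟨ q , q ⟩ norm-p
    ∷ equation ⟨ q , q ⟩ 1ℝ 1ℝ norm-q
    ∷ equation g (- 1ℝ) (fromℚ (ℚ.- (+ 1 ℚ./ 4)) * (g - 1ℝ)) trace ∷ [])
    λ n → eq (seq (re p) n) (seq (im p) n) (seq (re q) n) (seq (im q) n)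
    where
    g = ⟨ p , q ⟩ + ⟨ p , q ⟩
    eq : ∀ p₁ p₂ q₁ q₂ →
      (q₁ ℚ.* q₁ ℚ.+ q₂ ℚ.* q₂) ℚ.* (p₁ ℚ.* p₁ ℚ.+ p₂ ℚ.* p₂ ℚ.- 1ℚ)
      ℚ.+ (1ℚ ℚ.* (q₁ ℚ.* q₁ ℚ.+ q₂ ℚ.* q₂ ℚ.- 1ℚ)
      ℚ.+ (ℚ.- (+ 1 ℚ./ 4) ℚ.* (p₁ ℚ.* q₁ ℚ.+ p₂ ℚ.* q₂ ℚ.+ (p₁ ℚ.* q₁ ℚ.+ p₂ ℚ.* q₂) ℚ.- 1ℚ)
          ℚ.* (p₁ ℚ.* q₁ ℚ.+ p₂ ℚ.* q₂ ℚ.+ (p₁ ℚ.* q₁ ℚ.+ p₂ ℚ.* q₂) ℚ.- ℚ.- 1ℚ) ℚ.+ 0ℚ))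
      ≡ (p₁ ℚ.* q₂ ℚ.- p₂ ℚ.* q₁) ℚ.* (p₁ ℚ.* q₂ ℚ.- p₂ ℚ.* q₁) ℚ.- + 3 ℚ./ 4
    eq = ring-∀ ℚ-ring

  -- σ is the sign of the determinant d = ±√3/2.
  σ : ℝ
  σ = fromℚ (+ 2 ℚ./ 3) * √3 * d

  σ²≈1 : σ * σ ≈ 1ℝ
  σ²≈1 = linear-combination (σ * σ) 1ℝ
    ( equation (√3 * √3) (fromℤ (+ 3)) (fromℚ (+ 4 ℚ./ 9) * (d * d)) √3-square
    ∷ equation (d * d) (fromℚ (+ 3 ℚ./ 4)) (fromℚ (+ 4 ℚ./ 3)) d²≈¾ ∷ [])
    λ n → eq (√3-seq n) (seq d n)
    where
    eq : ∀ s d → + 4 ℚ./ 9 ℚ.* (d ℚ.* d) ℚ.* (s ℚ.* s ℚ.- ℤ→ℚ (+ 3)) ℚ.+ (+ 4 ℚ./ 3 ℚ.* (d ℚ.* d ℚ.- + 3 ℚ./ 4) ℚ.+ 0ℚ)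
      ≡ (+ 2 ℚ./ 3 ℚ.* s ℚ.* d) ℚ.* (+ 2 ℚ./ 3 ℚ.* s ℚ.* d) ℚ.- 1ℚ
    eq = ring-∀ ℚ-ring

  -- Multiplication by the conjugate of `p`, which takes `p` to 1, with the imaginary part
  -- multiplied by `σ`. The factor `σ` reflects a negatively oriented pair without a case
  -- distinction on the orientation.
  isometry : ℂ → ℂ
  isometry v = ⟨ p , v ⟩ +i (σ * (re p * im v - im p * re v))

  -- With det(v) = `re p * im v - im p * re v`, Lagrange's identity reads
  -- `⟨p,v⟩⟨p,w⟩ + det(v) det(w) = |p|²⟨v,w⟩`; the conditions `σ² = 1` and `|p|² = 1` do the rest.
  isometry-preserves : ∀ v w → ⟨ isometry v , isometry w ⟩ ≈ ⟨ v , w ⟩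
  isometry-preserves v w = linear-combination ⟨ isometry v , isometry w ⟩ ⟨ v , w ⟩
    ( equation (σ * σ) 1ℝ (det v * det w) σ²≈1
    ∷ equation ⟨ p , p ⟩ 1ℝ ⟨ v , w ⟩ norm-p ∷ [])
    λ n → eq (seq (re p) n) (seq (im p) n) (seq (re v) n) (seq (im v) n) (seq (re w) n) (seq (im w) n) (seq σ n)
    where
    det : ℂ → ℝ
    det v = re p * im v - im p * re v
    eq : ∀ p₁ p₂ v₁ v₂ w₁ w₂ σ →
      (p₁ ℚ.* v₂ ℚ.- p₂ ℚ.* v₁) ℚ.* (p₁ ℚ.* w₂ ℚ.- p₂ ℚ.* w₁) ℚ.* (σ ℚ.* σ ℚ.- 1ℚ)
      ℚ.+ ((v₁ ℚ.* w₁ ℚ.+ v₂ ℚ.* w₂) ℚ.* (p₁ ℚ.* p₁ ℚ.+ p₂ ℚ.* p₂ ℚ.- 1ℚ) ℚ.+ 0ℚ)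
      ≡ (p₁ ℚ.* v₁ ℚ.+ p₂ ℚ.* v₂) ℚ.* (p₁ ℚ.* w₁ ℚ.+ p₂ ℚ.* w₂)
        ℚ.+ σ ℚ.* (p₁ ℚ.* v₂ ℚ.- p₂ ℚ.* v₁) ℚ.* (σ ℚ.* (p₁ ℚ.* w₂ ℚ.- p₂ ℚ.* w₁))
        ℚ.- (v₁ ℚ.* w₁ ℚ.+ v₂ ℚ.* w₂)
    eq = ring-∀ ℚ-ring

  τ : OrthogonalTransformation
  τ = record
    { T = isometry
    ; T-cong = λ v w h → ⟨⟩-cong p p v w (≋-refl p) h
        , *-congˡ σ {det v} {det w} (+-cong {re p * im v} {re p * im w} {z = - (im p * re v)} {w = - (im p * re w)}
            (*-congˡ (re p) {im v} {im w} (proj₂ h))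
            (-cong {im p * re v} {im p * re w} (*-congˡ (im p) {re v} {re w} (proj₁ h))))
    ; T-⊕ = λ v w → ≡⇒≋ (isometry (v ⊕ w)) (isometry v ⊕ isometry w)
        (λ n → +-re (seq (re p) n) (seq (im p) n) (seq (re v) n) (seq (im v) n) (seq (re w) n) (seq (im w) n))
        (λ n → +-im (seq (re p) n) (seq (im p) n) (seq (re v) n) (seq (im v) n) (seq (re w) n) (seq (im w) n) (seq σ n))
    ; T-· = λ c v → ≡⇒≋ (isometry (c · v)) (c · isometry v)
        (λ n → ·-re (seq (re p) n) (seq (im p) n) (seq (re v) n) (seq (im v) n) (seq c n))
        (λ n → ·-im (seq (re p) n) (seq (im p) n) (seq (re v) n) (seq (im v) n) (seq c n) (seq σ n))
    ; T-preserves = isometry-preserves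
    }
    where
    det : ℂ → ℝ
    det v = re p * im v - im p * re v
    +-re : ∀ p₁ p₂ v₁ v₂ w₁ w₂ → p₁ ℚ.* (v₁ ℚ.+ w₁) ℚ.+ p₂ ℚ.* (v₂ ℚ.+ w₂)
      ≡ p₁ ℚ.* v₁ ℚ.+ p₂ ℚ.* v₂ ℚ.+ (p₁ ℚ.* w₁ ℚ.+ p₂ ℚ.* w₂)
    +-re = ring-∀ ℚ-ring
    +-im : ∀ p₁ p₂ v₁ v₂ w₁ w₂ σ → σ ℚ.* (p₁ ℚ.* (v₂ ℚ.+ w₂) ℚ.- p₂ ℚ.* (v₁ ℚ.+ w₁))
      ≡ σ ℚ.* (p₁ ℚ.* v₂ ℚ.- p₂ ℚ.* v₁) ℚ.+ σ ℚ.* (p₁ ℚ.* w₂ ℚ.- p₂ ℚ.* w₁)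
    +-im = ring-∀ ℚ-ring
    ·-re : ∀ p₁ p₂ v₁ v₂ c → p₁ ℚ.* (c ℚ.* v₁) ℚ.+ p₂ ℚ.* (c ℚ.* v₂) ≡ c ℚ.* (p₁ ℚ.* v₁ ℚ.+ p₂ ℚ.* v₂)
    ·-re = ring-∀ ℚ-ring
    ·-im : ∀ p₁ p₂ v₁ v₂ c σ → σ ℚ.* (p₁ ℚ.* (c ℚ.* v₂) ℚ.- p₂ ℚ.* (c ℚ.* v₁))
      ≡ c ℚ.* (σ ℚ.* (p₁ ℚ.* v₂ ℚ.- p₂ ℚ.* v₁))
    ·-im = ring-∀ ℚ-ring

  isometry-p : isometry p ≋ 1ℂ
  isometry-p = norm-p , ≡⇒≈ {σ * (re p * im p - im p * re p)} {0ℝ}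
    λ n → eq (seq σ n) (seq (re p) n) (seq (im p) n)
    where
    eq : ∀ σ p₁ p₂ → σ ℚ.* (p₁ ℚ.* p₂ ℚ.- p₂ ℚ.* p₁) ≡ 0ℚ
    eq = ring-∀ ℚ-ring

  isometry-q : isometry q ≋ ω
  isometry-q =
      linear-combination ⟨ p , q ⟩ (fromℚ ℚ.-½)
        (equation (⟨ p , q ⟩ + ⟨ p , q ⟩) (- 1ℝ) (fromℚ ½) trace ∷ [])
        (λ n → halve (seq ⟨ p , q ⟩ n))
    -- The imaginary part is `σ d = (2/3)√3 d²`, and `d² = 3/4`.
    , linear-combination (σ * d) (fromℚ ½ * √3)
        (equation (d * d) (fromℚ (+ 3 ℚ./ 4)) (fromℚ (+ 2 ℚ./ 3) * √3) d²≈¾ ∷ [])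
        (λ n → eq (√3-seq n) (seq d n))
    where
    halve : ∀ g → ½ ℚ.* (g ℚ.+ g ℚ.- ℚ.- 1ℚ) ℚ.+ 0ℚ ≡ g ℚ.- ℚ.-½
    halve = ring-∀ ℚ-ring
    eq : ∀ s d → + 2 ℚ./ 3 ℚ.* s ℚ.* (d ℚ.* d ℚ.- + 3 ℚ./ 4) ℚ.+ 0ℚ ≡ + 2 ℚ./ 3 ℚ.* s ℚ.* d ℚ.* d ℚ.- ½ ℚ.* s
    eq = ring-∀ ℚ-ring

  isometry-comb : ∀ x y → isometry (comb x y p q) ≋ comb x y 1ℂ ω
  isometry-comb x y = ≋-trans (isometry (comb x y p q)) (comb x y (isometry p) (isometry q)) (comb x y 1ℂ ω)
    (≋-trans (isometry (comb x y p q)) (isometry (fromℤ x · p) ⊕ isometry (fromℤ y · q)) (comb x y (isometry p) (isometry q))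
      (T-⊕ (fromℤ x · p) (fromℤ y · q))
      (⊕-cong (isometry (fromℤ x · p)) (fromℤ x · isometry p) (isometry (fromℤ y · q)) (fromℤ y · isometry q)
        (T-· (fromℤ x) p) (T-· (fromℤ y) q)))
    (comb-cong x y (isometry p) 1ℂ (isometry q) ω isometry-p isometry-q)
    where open OrthogonalTransformation τ using (T-⊕; T-·)

-- The Eisenstein integers

eisenstein : ℤ → ℤ → ℂ
eisenstein x y = comb x y 1ℂ ω

⟨1,1⟩≈1 : ⟨ 1ℂ , 1ℂ ⟩ ≈ 1ℝ
⟨1,1⟩≈1 = ≡⇒≈ {⟨ 1ℂ , 1ℂ ⟩} {1ℝ} λ _ → ≡.refl

⟨ω,ω⟩≈1 : ⟨ ω , ω ⟩ ≈ 1ℝ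
⟨ω,ω⟩≈1 = linear-combination ⟨ ω , ω ⟩ 1ℝ
  (equation (√3 * √3) (fromℤ (+ 3)) (fromℚ (+ 1 ℚ./ 4)) √3-square ∷ []) λ n → eq (√3-seq n)
  where
  eq : ∀ s → + 1 ℚ./ 4 ℚ.* (s ℚ.* s ℚ.- ℤ→ℚ (+ 3)) ℚ.+ 0ℚ
    ≡ ℚ.-½ ℚ.* ℚ.-½ ℚ.+ ½ ℚ.* s ℚ.* (½ ℚ.* s) ℚ.- 1ℚ
  eq = ring-∀ ℚ-ring

⟨1,ω⟩-trace : ⟨ 1ℂ , ω ⟩ + ⟨ 1ℂ , ω ⟩ ≈ - 1ℝ
⟨1,ω⟩-trace = ≡⇒≈ {⟨ 1ℂ , ω ⟩ + ⟨ 1ℂ , ω ⟩} {y = - 1ℝ} λ n → eq (√3-seq n)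
  where
  eq : ∀ s → 1ℚ ℚ.* ℚ.-½ ℚ.+ 0ℚ ℚ.* (½ ℚ.* s) ℚ.+ (1ℚ ℚ.* ℚ.-½ ℚ.+ 0ℚ ℚ.* (½ ℚ.* s)) ≡ ℚ.- 1ℚ
  eq = ring-∀ ℚ-ring

eisenstein-injective : ∀ x y z t → eisenstein x y ≋ eisenstein z t → x ≡ z × y ≡ t
eisenstein-injective = comb-injective 1ℂ ω
  (UnitBasis.independent 1ℂ ω ⟨1,1⟩≈1 ⟨ω,ω⟩≈1 ⟨1,ω⟩-trace)

eisenstein-⊕ : ∀ x y z t → eisenstein x y ⊕ eisenstein z t ≋ eisenstein (x ℤ.+ z) (y ℤ.+ t)
eisenstein-⊕ x y z t = ≡⇒≋ (eisenstein x y ⊕ eisenstein z t) (eisenstein (x ℤ.+ z) (y ℤ.+ t))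
  (λ n → component 1ℚ ℚ.-½) (λ n → component 0ℚ (½ ℚ.* √3-seq n))
  where
  eq : ∀ x y z t v w → x ℚ.* v ℚ.+ y ℚ.* w ℚ.+ (z ℚ.* v ℚ.+ t ℚ.* w) ≡ (x ℚ.+ z) ℚ.* v ℚ.+ (y ℚ.+ t) ℚ.* w
  eq = ring-∀ ℚ-ring
  component : ∀ v w → ℤ→ℚ x ℚ.* v ℚ.+ ℤ→ℚ y ℚ.* w ℚ.+ (ℤ→ℚ z ℚ.* v ℚ.+ ℤ→ℚ t ℚ.* w)
    ≡ ℤ→ℚ (x ℤ.+ z) ℚ.* v ℚ.+ ℤ→ℚ (y ℤ.+ t) ℚ.* w
  component v w = ≡.trans (eq (ℤ→ℚ x) (ℤ→ℚ y) (ℤ→ℚ z) (ℤ→ℚ t) v w)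
    (cong₂ (λ s r → s ℚ.* v ℚ.+ r ℚ.* w) (≡.sym (ℤ→ℚ-+ x z)) (≡.sym (ℤ→ℚ-+ y t)))

-- The multiplication table is ω² = -1 - ω; `√3² = 3` enters only in the real part, through the
-- product of the two imaginary parts.
eisenstein-⊗ : ∀ m n x y →
  eisenstein m n ⊗ eisenstein x y ≋ eisenstein (m ℤ.* x ℤ.- n ℤ.* y) (m ℤ.* y ℤ.+ n ℤ.* x ℤ.- n ℤ.* y)
eisenstein-⊗ m n x y =
    linear-combination (re (eisenstein m n ⊗ eisenstein x y)) (re (eisenstein s r))
      (equation (√3 * √3) (fromℤ (+ 3)) (fromℚ (ℚ.- (+ 1 ℚ./ 4)) * (fromℤ n * fromℤ y)) √3-square ∷ [])
      (λ k → ≡.trans (real (ℤ→ℚ m) (ℤ→ℚ n) (ℤ→ℚ x) (ℤ→ℚ y) (√3-seq k))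
        (cong₂ (λ s r → seq (re (eisenstein m n ⊗ eisenstein x y)) k ℚ.- (s ℚ.* 1ℚ ℚ.+ r ℚ.* ℚ.-½))
          (≡.sym ℤ→ℚ-s) (≡.sym ℤ→ℚ-r)))
  , ≡⇒≈ {im (eisenstein m n ⊗ eisenstein x y)} {im (eisenstein s r)}
      (λ k → ≡.trans (imaginary (ℤ→ℚ m) (ℤ→ℚ n) (ℤ→ℚ x) (ℤ→ℚ y) (√3-seq k))
        (cong₂ (λ s r → s ℚ.* 0ℚ ℚ.+ r ℚ.* (½ ℚ.* √3-seq k)) (≡.sym ℤ→ℚ-s) (≡.sym ℤ→ℚ-r)))
  where
  s = m ℤ.* x ℤ.- n ℤ.* y
  r = m ℤ.* y ℤ.+ n ℤ.* x ℤ.- n ℤ.* y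
  neg-product : ℤ→ℚ (ℤ.- (n ℤ.* y)) ≡ ℚ.- (ℤ→ℚ n ℚ.* ℤ→ℚ y)
  neg-product = ≡.trans (ℤ→ℚ-neg (n ℤ.* y)) (cong ℚ.-_ (ℤ→ℚ-* n y))
  ℤ→ℚ-s : ℤ→ℚ s ≡ ℤ→ℚ m ℚ.* ℤ→ℚ x ℚ.- ℤ→ℚ n ℚ.* ℤ→ℚ y
  ℤ→ℚ-s = ≡.trans (ℤ→ℚ-+ (m ℤ.* x) (ℤ.- (n ℤ.* y))) (cong₂ ℚ._+_ (ℤ→ℚ-* m x) neg-product)
  ℤ→ℚ-r : ℤ→ℚ r ≡ ℤ→ℚ m ℚ.* ℤ→ℚ y ℚ.+ ℤ→ℚ n ℚ.* ℤ→ℚ x ℚ.- ℤ→ℚ n ℚ.* ℤ→ℚ y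
  ℤ→ℚ-r = ≡.trans (ℤ→ℚ-+ (m ℤ.* y ℤ.+ n ℤ.* x) (ℤ.- (n ℤ.* y))) (cong₂ ℚ._+_ (ℤ→ℚ-combination m y n x) neg-product)
  real : ∀ m n x y h → ℚ.- (+ 1 ℚ./ 4) ℚ.* (n ℚ.* y) ℚ.* (h ℚ.* h ℚ.- ℤ→ℚ (+ 3)) ℚ.+ 0ℚ
    ≡ (m ℚ.* 1ℚ ℚ.+ n ℚ.* ℚ.-½) ℚ.* (x ℚ.* 1ℚ ℚ.+ y ℚ.* ℚ.-½)
      ℚ.- (m ℚ.* 0ℚ ℚ.+ n ℚ.* (½ ℚ.* h)) ℚ.* (x ℚ.* 0ℚ ℚ.+ y ℚ.* (½ ℚ.* h))
      ℚ.- ((m ℚ.* x ℚ.- n ℚ.* y) ℚ.* 1ℚ ℚ.+ (m ℚ.* y ℚ.+ n ℚ.* x ℚ.- n ℚ.* y) ℚ.* ℚ.-½)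
  real = ring-∀ ℚ-ring
  imaginary : ∀ m n x y h →
    (m ℚ.* 1ℚ ℚ.+ n ℚ.* ℚ.-½) ℚ.* (x ℚ.* 0ℚ ℚ.+ y ℚ.* (½ ℚ.* h))
      ℚ.+ (m ℚ.* 0ℚ ℚ.+ n ℚ.* (½ ℚ.* h)) ℚ.* (x ℚ.* 1ℚ ℚ.+ y ℚ.* ℚ.-½)
    ≡ (m ℚ.* x ℚ.- n ℚ.* y) ℚ.* 0ℚ ℚ.+ (m ℚ.* y ℚ.+ n ℚ.* x ℚ.- n ℚ.* y) ℚ.* (½ ℚ.* h)
  imaginary = ring-∀ ℚ-ring

fromℤ·1 : ∀ k → fromℤ k · 1ℂ ≋ eisenstein k 0ℤ
fromℤ·1 k = ≡⇒≋ (fromℤ k · 1ℂ) (eisenstein k 0ℤ)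
  (λ n → eq (ℤ→ℚ k ℚ.* 1ℚ) ℚ.-½) (λ n → eq (ℤ→ℚ k ℚ.* 0ℚ) (½ ℚ.* √3-seq n))
  where
  eq : ∀ v w → v ≡ v ℚ.+ 0ℚ ℚ.* w
  eq = ring-∀ ℚ-ring

1≋eisenstein : 1ℂ ≋ eisenstein 1ℤ 0ℤ
1≋eisenstein = ≋-trans 1ℂ (fromℤ 1ℤ · 1ℂ) (eisenstein 1ℤ 0ℤ)
  (≡⇒≋ 1ℂ (fromℤ 1ℤ · 1ℂ) (λ _ → ≡.refl) (λ _ → ≡.refl)) (fromℤ·1 1ℤ)

0≋eisenstein : 0ℂ ≋ eisenstein 0ℤ 0ℤ
0≋eisenstein = ≋-trans 0ℂ (fromℤ 0ℤ · 1ℂ) (eisenstein 0ℤ 0ℤ)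
  (≡⇒≋ 0ℂ (fromℤ 0ℤ · 1ℂ) (λ _ → ≡.refl) (λ _ → ≡.refl)) (fromℤ·1 0ℤ)

-- Scaled lattices

·ₛ-span : ∀ c X v w → X ≐ ℤ-span v w → c ·ₛ X ≐ ℤ-span (c · v) (c · w)
·ₛ-span c X v w X≐ =
    (λ {z} (t , t∈X , z≋) → let x , y , t≋ = proj₁ X≐ t∈X in
      x , y , ≋-trans z (c · t) (comb x y (c · v) (c · w)) z≋
        (≋-trans (c · t) (c · comb x y v w) (comb x y (c · v) (c · w))
          (·-cong c t (comb x y v w) t≋) (comb-· c x y v w)))
  , (λ {z} (x , y , z≋) → comb x y v w , proj₂ X≐ (x , y , ≋-refl (comb x y v w)) ,
      ≋-trans z (comb x y (c · v) (c · w)) (c · comb x y v w) z≋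
        (≋-sym (c · comb x y v w) (comb x y (c · v) (c · w)) (comb-· c x y v w)))

scaled-basis-independent : ∀ c → 0ℝ < c → ∀ v w → IsBasis v w → Independent (c · v) (c · w)
scaled-basis-independent c c>0 v w basis x y h =
  let e , e′ = IsBasis.independent basis (fromℤ x) (fromℤ y)
        (·-cancel c c>0 (comb x y v w) 0ℂ (≋-trans (c · comb x y v w) (comb x y (c · v) (c · w)) (c · 0ℂ)
          (comb-· c x y v w) (≋-trans (comb x y (c · v) (c · w)) 0ℂ (c · 0ℂ) h
            (≡⇒≋ 0ℂ (c · 0ℂ) (λ n → ≡.sym (ℚ.*-zeroʳ (seq c n))) (λ n → ≡.sym (ℚ.*-zeroʳ (seq c n)))))))
  in O.ι-≡0 x e , O.ι-≡0 y e′

comb-1-0 : ∀ v w → v ≋ comb 1ℤ 0ℤ v w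
comb-1-0 v w = ≡⇒≋ v (comb 1ℤ 0ℤ v w)
  (λ n → eq (seq (re v) n) (seq (re w) n)) (λ n → eq (seq (im v) n) (seq (im w) n))
  where
  eq : ∀ v w → v ≡ 1ℚ ℚ.* v ℚ.+ 0ℚ ℚ.* w
  eq = ring-∀ ℚ-ring

comb-swap : ∀ x y v w → comb x y v w ≋ comb y x w v
comb-swap x y v w = ≡⇒≋ (comb x y v w) (comb y x w v)
  (λ n → ℚ.+-comm (ℤ→ℚ x ℚ.* seq (re v) n) (ℤ→ℚ y ℚ.* seq (re w) n))
  (λ n → ℚ.+-comm (ℤ→ℚ x ℚ.* seq (im v) n) (ℤ→ℚ y ℚ.* seq (im w) n))

span-swap : ∀ (N : Pred ℂ 0ℓ) v w → N ≐ ℤ-span v w → N ≐ ℤ-span w v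
span-swap N v w (to , from) =
    (λ {z} z∈N → let x , y , z≋ = to z∈N in
      y , x , ≋-trans z (comb x y v w) (comb y x w v) z≋ (comb-swap x y v w))
  , (λ {z} (y , x , z≋) → from (x , y , ≋-trans z (comb y x w v) (comb x y v w) z≋ (comb-swap y x w v)))

≈⇒≮ : ∀ x y → x ≈ y → ¬ x < y
≈⇒≮ x y x≈y x<y = Pos-irrefl {y - x} (x≈y⇒x-y≈0 {y} {x} (≈-sym {x} {y} x≈y)) (<⇒Pos {x} {y} x<y)

<-asym : ∀ x y → x < y → ¬ y < x
<-asym x y x<y y<x = Pos-irrefl {y - x + (x - y)}
  (≡⇒≈ {y - x + (x - y)} {0ℝ} λ n → cancel (seq x n) (seq y n))
  (Pos-+ {y - x} {x - y} (<⇒Pos {x} {y} x<y) (<⇒Pos {y} {x} y<x))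
  where
  cancel : ∀ a b → b ℚ.- a ℚ.+ (a ℚ.- b) ≡ 0ℚ
  cancel = ring-∀ ℚ-ring

≤-trans : ∀ x y z → x ≤ y → y ≤ z → x ≤ z
≤-trans x y z x≤y y≤z z<x = O.NonNeg-trans z y x (nonNeg z y y≤z) (nonNeg y x x≤y)
  (Pos-resp {x - z} {y = - (z - x)} (≡⇒≈ {x - z} {y = - (z - x)} λ n → flip (seq z n) (seq x n))
    (<⇒Pos {z} {x} z<x))
  where
  flip : ∀ a b → b ℚ.- a ≡ ℚ.- (a ℚ.- b)
  flip = ring-∀ ℚ-ring
  nonNeg : ∀ a b → b ≤ a → O.NonNeg (a - b)
  nonNeg a b b≤a h = b≤a (Pos⇒< {a} {b} (Pos-resp {x = - (a - b)} {b - a}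
    (≡⇒≈ {x = - (a - b)} {b - a} λ n → ≡.sym (flip (seq a n) (seq b n))) h))

-- Minimal lengths in a tempered pair

module _ {L M S S′ : Pred ℂ 0ℓ} (tempered : Tempered L M S S′) where

  open Tempered tempered
  open Tempers tempers

  -- Membership in `S′` need not be decided: a vector shorter than the minimum cannot lie in `S′`,
  -- where the value is `u`, so `off-S′` applies and contradicts the assumption.
  minimal-M : ∀ z → z ∈ M → ¬ (z ≋ 0ℂ) → ¬ (⟨ z , z ⟩ < u)
  minimal-M z z∈M z≢0 Q<u = <-asym ⟨ z , z ⟩ u Q<u
    (off-S′ z z∈M z≢0 λ z∈S′ → ≈⇒≮ ⟨ z , z ⟩ u (on-S′ z z∈S′) Q<u)

  -- A vector with value below 1 cannot lie in M, whose nonzero vectors have value at least `u ≥ 1`,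
  -- nor in `S`; thus `off-S` applies to it.
  minimal-L : ∀ z → z ∈ L → ¬ (z ≋ 0ℂ) → ¬ (⟨ z , z ⟩ < 1ℝ)
  minimal-L z z∈L z≢0 Q<1 = <-asym ⟨ z , z ⟩ 1ℝ Q<1
    (off-S z z∈L (λ z∈M → ≤-trans 1ℝ u ⟨ z , z ⟩ 1≤u (minimal-M z z∈M z≢0) Q<1)
      λ z∈S → ≈⇒≮ ⟨ z , z ⟩ 1ℝ (on-S z z∈S) Q<1)

pair∈ : ∀ {s} {S : Pred ℂ 0ℓ} (pairs : ConsistsOfPairs s S) → ∀ i → proj₁ pairs i ∈ S
pair∈ (p , p-pairs , _) i = Equivalence.from (p-pairs (p i)) (i , inj₁ (≋-refl (p i)))

-- The sublattice as a principal ideal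

record IdealGenerator (M : Pred ℂ 0ℓ) (p q : ℂ) : Set where
  field
    a b       : ℤ
    member    : ∀ x y → PrincipalIdeal.Member a b x y → comb x y p q ∈ M
    memberOf  : ∀ x y → comb x y p q ∈ M → PrincipalIdeal.Member a b x y

module Sublattice {L M : Pred ℂ 0ℓ} (M⊆L : M ⊆ L) {u : ℝ} (u>0 : 0ℝ < u) {p q α β : ℂ}
  (L-hexagonal : IsHexagonal L 1ℝ p q) (M-hexagonal : IsHexagonal M u α β) where

  private
    module L = IsHexagonal L-hexagonal
    module M = IsHexagonal M-hexagonal

  open UnitBasis p q L.norm-p L.norm-q L.trace public

  -- In coordinates `w` is ω times `v`, since ω(a + bω) = -b + (a - b)ω. Hence `s v + t w`
  -- corresponds to (s + tω)(a + bω), and the lattice spanned is closed under multiplication by ω.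
  generator-from : ∀ a b v w → M ≐ ℤ-span v w → v ≋ comb a b p q →
                   w ≋ comb (ℤ.- b) (a ℤ.- b) p q → IdealGenerator M p q
  generator-from a b v w M≐ v≋ w≋ = record { a = a ; b = b ; member = to ; memberOf = from }
    where
    eq : ∀ s t → s ℤ.* a ℤ.- t ℤ.* b ≡ s ℤ.* a ℤ.+ t ℤ.* (ℤ.- b)
    eq s t = cong (ℤ._+_ (s ℤ.* a)) (ℤ.neg-distribʳ-* t b)
    expand : ∀ s t → comb s t v w ≋ comb (s ℤ.* a ℤ.+ t ℤ.* (ℤ.- b)) (s ℤ.* b ℤ.+ t ℤ.* (a ℤ.- b)) p q
    expand s t = ≋-trans (comb s t v w) (comb s t (comb a b p q) (comb (ℤ.- b) (a ℤ.- b) p q))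
      (comb (s ℤ.* a ℤ.+ t ℤ.* (ℤ.- b)) (s ℤ.* b ℤ.+ t ℤ.* (a ℤ.- b)) p q)
      (comb-cong s t v (comb a b p q) w (comb (ℤ.- b) (a ℤ.- b) p q) v≋ w≋)
      (comb-comb s t a b (ℤ.- b) (a ℤ.- b) p q)
    to : ∀ x y → PrincipalIdeal.Member a b x y → comb x y p q ∈ M
    to x y (s , t , e₁ , e₂) = proj₂ M≐ (s , t , ≋-sym (comb s t v w) (comb x y p q)
      (subst (comb s t v w ≋_)
        (cong₂ (λ x y → comb x y p q) (≡.sym (≡.trans e₁ (eq s t))) (≡.sym e₂)) (expand s t)))
    from : ∀ x y → comb x y p q ∈ M → PrincipalIdeal.Member a b x y
    from x y h =
      let s , t , h≋ = proj₁ M≐ h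
          x′ = s ℤ.* a ℤ.+ t ℤ.* (ℤ.- b)
          y′ = s ℤ.* b ℤ.+ t ℤ.* (a ℤ.- b)
          e₁ , e₂ = comb-injective p q independent x y x′ y′
            (≋-trans (comb x y p q) (comb s t v w) (comb x′ y′ p q) h≋ (expand s t))
      in s , t , ≡.trans e₁ (≡.sym (eq s t)) , e₂

  private
    α∈L : α ∈ L
    α∈L = M⊆L (proj₂ M.spans (1ℤ , 0ℤ , comb-1-0 α β))
    β∈L : β ∈ L
    β∈L = M⊆L (proj₂ M.spans (0ℤ , 1ℤ , ≋-trans β (comb 1ℤ 0ℤ β α) (comb 0ℤ 1ℤ α β)
      (comb-1-0 β α) (comb-swap 1ℤ 0ℤ β α)))
    a b c d′ : ℤ
    a = proj₁ (proj₁ L.spans α∈L)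
    b = proj₁ (proj₂ (proj₁ L.spans α∈L))
    c = proj₁ (proj₁ L.spans β∈L)
    d′ = proj₁ (proj₂ (proj₁ L.spans β∈L))
    α≋ : α ≋ comb a b p q
    α≋ = proj₂ (proj₂ (proj₁ L.spans α∈L))
    β≋ : β ≋ comb c d′ p q
    β≋ = proj₂ (proj₂ (proj₁ L.spans β∈L))

    norm≈u : ∀ x y v → v ≋ comb x y p q → ⟨ v , v ⟩ ≈ u → fromℤ (norm x y) ≈ u
    norm≈u x y v v≋ norm-v = ≈-trans {fromℤ (norm x y)} {⟨ v , v ⟩} {u}
      (≈-sym {⟨ v , v ⟩} {fromℤ (norm x y)} (≈-trans {⟨ v , v ⟩} {⟨ comb x y p q , comb x y p q ⟩} {fromℤ (norm x y)}
        (⟨⟩-cong v (comb x y p q) v (comb x y p q) v≋ v≋) (⟨comb⟩≈norm x y))) norm-v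

    n : ℤ
    n = norm a b
    -- The real number `u` is thereby an integer, so the remaining equations between lengths and
    -- inner products hold in ℤ by injectivity.
    n≈u : fromℤ n ≈ u
    n≈u = norm≈u a b α α≋ M.norm-p
    n≢0 : n ≢ 0ℤ
    n≢0 n≡0 = Pos-irrefl {u} (≈-trans {u} {fromℤ n} {0ℝ} (≈-sym {fromℤ n} {u} n≈u)
      (subst (λ k → fromℤ k ≈ 0ℝ) (≡.sym n≡0) (≈-refl {0ℝ}))) u>0
    norm-β : norm c d′ ≡ n
    norm-β = O.ι-injective (norm c d′) n (≈-trans {fromℤ (norm c d′)} {u} {fromℤ n}
      (norm≈u c d′ β β≋ M.norm-q) (≈-sym {fromℤ n} {u} n≈u))
    trace-αβ : trace-form a b c d′ ≡ ℤ.- n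
    trace-αβ = O.ι-injective (trace-form a b c d′) (ℤ.- n)
      (linear-combination (fromℤ (trace-form a b c d′)) (fromℤ (ℤ.- n))
        ( equation g′ (fromℤ (trace-form a b c d′)) (- 1ℝ) (⟨comb,comb⟩≈trace a b c d′)
        ∷ equation g g′ (- 1ℝ) (+-cong {⟨ α , β ⟩} {⟨ α′ , β′ ⟩} {⟨ α , β ⟩} {⟨ α′ , β′ ⟩} αβ αβ)
        ∷ equation g (- u) 1ℝ M.trace
        ∷ equation (fromℤ n) u 1ℝ n≈u ∷ [])
        λ k → ≡.trans (eq (seq g k) (seq g′ k) (ℤ→ℚ (trace-form a b c d′)) (seq u k) (ℤ→ℚ n))
          (cong (ℚ._-_ (ℤ→ℚ (trace-form a b c d′))) (≡.sym (ℤ→ℚ-neg n))))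
      where
      α′ = comb a b p q
      β′ = comb c d′ p q
      g = ⟨ α , β ⟩ + ⟨ α , β ⟩
      g′ = ⟨ α′ , β′ ⟩ + ⟨ α′ , β′ ⟩
      αβ : ⟨ α , β ⟩ ≈ ⟨ α′ , β′ ⟩
      αβ = ⟨⟩-cong α α′ β β′ α≋ β≋
      eq : ∀ g g′ t u n → ℚ.- 1ℚ ℚ.* (g′ ℚ.- t) ℚ.+ (ℚ.- 1ℚ ℚ.* (g ℚ.- g′)
        ℚ.+ (1ℚ ℚ.* (g ℚ.- ℚ.- u) ℚ.+ (1ℚ ℚ.* (n ℚ.- u) ℚ.+ 0ℚ))) ≡ t ℚ.- ℚ.- n
      eq = ring-∀ ℚ-ring

  generator : IdealGenerator M p q
  generator = choose (rotation a b c d′ n n≢0 ≡.refl norm-β trace-αβ)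
    where
    choose : (c ≡ ℤ.- b × d′ ≡ a ℤ.- b) ⊎ (a ≡ ℤ.- d′ × b ≡ c ℤ.- d′) → IdealGenerator M p q
    choose (inj₁ (e₁ , e₂)) = generator-from a b α β M.spans α≋
      (subst (β ≋_) (cong₂ (λ x y → comb x y p q) e₁ e₂) β≋)
    choose (inj₂ (e₁ , e₂)) = generator-from c d′ β α (span-swap M α β M.spans) β≋
      (subst (α ≋_) (cong₂ (λ x y → comb x y p q) e₁ e₂) α≋)

-- Prime ideals of ℤ[ω]

eisensteinSet : (ℤ → ℤ → Set) → Pred ℂ 0ℓ
eisensteinSet X v = ∃₂ λ x y → X x y × v ≋ eisenstein x y

module CoordinateIdeal (a b : ℤ) where

  open PrincipalIdeal a b

  𝔭 : Pred ℂ 0ℓ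
  𝔭 = eisensteinSet Member

  𝔭-coordinates : ∀ x y v → v ∈ 𝔭 → v ≋ eisenstein x y → Member x y
  𝔭-coordinates x y v (z , t , h , v≋) v≋′ =
    let e₁ , e₂ = eisenstein-injective z t x y (≋-trans (eisenstein z t) v (eisenstein x y)
          (≋-sym v (eisenstein z t) v≋) v≋′)
    in member-≡ e₁ e₂ h

  isIdeal : IsIdeal 𝔭
  isIdeal = record
    { respects = λ {v} {w} v≋w (x , y , h , v≋) →
        x , y , h , ≋-trans w v (eisenstein x y) (≋-sym v w v≋w) v≋
    ; ⊆ℤ[ω]    = λ (x , y , _ , v≋) → x , y , v≋
    ; 0-closed = 0ℤ , 0ℤ , 0-member , 0≋eisenstein
    ; +-closed = λ v w (x , y , h , v≋) (z , t , k , w≋) →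
        x ℤ.+ z , y ℤ.+ t , +-member h k ,
        ≋-trans (v ⊕ w) (eisenstein x y ⊕ eisenstein z t) (eisenstein (x ℤ.+ z) (y ℤ.+ t))
          (⊕-cong v (eisenstein x y) w (eisenstein z t) v≋ w≋) (eisenstein-⊕ x y z t)
    ; *-closed = λ v w (m , n , v≋) (x , y , h , w≋) →
        _ , _ , *-member m n h ,
        ≋-trans (v ⊗ w) (eisenstein m n ⊗ eisenstein x y)
          (eisenstein (m ℤ.* x ℤ.- n ℤ.* y) (m ℤ.* y ℤ.+ n ℤ.* x ℤ.- n ℤ.* y))
          (⊗-cong v (eisenstein m n) w (eisenstein x y) v≋ w≋) (eisenstein-⊗ m n x y)
    }

  module _ {ℓ : ℕ} (ℓ-prime : Prime ℓ) (r₁ r₂ : Fin ℓ → ℤ)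
    (complete : ∀ x y → ∃[ i ] Member (x ℤ.- r₁ i) (y ℤ.- r₂ i))
    (irredundant : ∀ i j → Member (r₁ i ℤ.- r₁ j) (r₂ i ℤ.- r₂ j) → i ≡ j) where

    open PrimeIndex ℓ-prime r₁ r₂ complete irredundant

    isPrimeIdeal : IsPrimeIdeal 𝔭
    isPrimeIdeal = record
      { isIdeal = isIdeal
      ; proper  = λ h → 1∉ (𝔭-coordinates 1ℤ 0ℤ 1ℂ h 1≋eisenstein)
      ; prime   = λ v w (x , y , v≋) (z , t , w≋) h → factor v w x y z t v≋ w≋
          (member-prime x y z t (𝔭-coordinates (x ℤ.* z ℤ.- y ℤ.* t) (x ℤ.* t ℤ.+ y ℤ.* z ℤ.- y ℤ.* t) (v ⊗ w) h
            (≋-trans (v ⊗ w) (eisenstein x y ⊗ eisenstein z t)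
              (eisenstein (x ℤ.* z ℤ.- y ℤ.* t) (x ℤ.* t ℤ.+ y ℤ.* z ℤ.- y ℤ.* t))
              (⊗-cong v (eisenstein x y) w (eisenstein z t) v≋ w≋) (eisenstein-⊗ x y z t))))
      }
      where
      factor : ∀ v w x y z t → v ≋ eisenstein x y → w ≋ eisenstein z t →
               Member x y ⊎ Member z t → v ∈ 𝔭 ⊎ w ∈ 𝔭
      factor v w x y z t v≋ w≋ (inj₁ h) = inj₁ (x , y , h , v≋)
      factor v w x y z t v≋ w≋ (inj₂ h) = inj₂ (z , t , h , w≋)

    liesOver : LiesOver 𝔭 ℓ
    liesOver k = mk⇔
      (λ h → member-multiple k (𝔭-coordinates k 0ℤ (fromℤ k · 1ℂ) h (fromℤ·1 k)))
      (λ ℓ∣k → k , 0ℤ , multiple-member k ℓ∣k , fromℤ·1 k)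

-- Equivalence with the Eisenstein integers

module Coordinates {c : ℝ} (c>0 : 0ℝ < c) {L M : Pred ℂ 0ℓ} (M⊆L : M ⊆ L) (M-resp : M Respects _≋_)
  (p q : ℂ) (norm-p : ⟨ p , p ⟩ ≈ 1ℝ) (norm-q : ⟨ q , q ⟩ ≈ 1ℝ) (trace : ⟨ p , q ⟩ + ⟨ p , q ⟩ ≈ - 1ℝ)
  (cL-spans : c ·ₛ L ≐ ℤ-span p q) (a b : ℤ)
  (member   : ∀ x y → PrincipalIdeal.Member a b x y → comb x y p q ∈ c ·ₛ M)
  (memberOf : ∀ x y → comb x y p q ∈ c ·ₛ M → PrincipalIdeal.Member a b x y) where

  open PrincipalIdeal a b using (Member)
  open CoordinateIdeal a b using (𝔭; isPrimeIdeal; liesOver)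
  open UnitBasis p q norm-p norm-q trace using (τ; isometry; isometry-comb)

  scaled-difference : ∀ v w x y z t → c · v ≋ comb x y p q → c · w ≋ comb z t p q →
    c · (v ⊖ w) ≋ comb (x ℤ.- z) (y ℤ.- t) p q
  scaled-difference v w x y z t v≋ w≋ = ≋-trans (c · (v ⊖ w)) (c · v ⊖ c · w) (comb (x ℤ.- z) (y ℤ.- t) p q)
    (≡⇒≋ (c · (v ⊖ w)) (c · v ⊖ c · w)
      (λ n → eq (seq c n) (seq (re v) n) (seq (re w) n)) (λ n → eq (seq c n) (seq (im v) n) (seq (im w) n)))
    (≋-trans (c · v ⊖ c · w) (comb x y p q ⊖ comb z t p q) (comb (x ℤ.- z) (y ℤ.- t) p q)
      (⊕-cong (c · v) (comb x y p q) (⊖ (c · w)) (⊖ comb z t p q) v≋ (⊖-cong (c · w) (comb z t p q) w≋))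
      (comb-- x y z t p q))
    where
    eq : ∀ c v w → c ℚ.* (v ℚ.+ ℚ.- w) ≡ c ℚ.* v ℚ.+ ℚ.- (c ℚ.* w)
    eq = ring-∀ ℚ-ring

  -- cT(w) corresponds to x + yω if cw = xp + yq.
  transport : ∀ x y w → c · w ≋ comb x y p q → c · isometry w ≋ eisenstein x y
  transport x y w cw≋ = ≋-trans (c · isometry w) (isometry (c · w)) (eisenstein x y)
    (≋-sym (isometry (c · w)) (c · isometry w) (OrthogonalTransformation.T-· τ c w))
    (≋-trans (isometry (c · w)) (isometry (comb x y p q)) (eisenstein x y)
      (OrthogonalTransformation.T-cong τ (c · w) (comb x y p q) cw≋) (isometry-comb x y))

  -- The condition `D` on coordinates lets L, with the trivial condition, and M, with `Member`,
  -- share one argument.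
  image≐ : ∀ (X : Pred ℂ 0ℓ) (D : ℤ → ℤ → Set) →
    (∀ w → w ∈ X → ∃₂ λ x y → D x y × c · w ≋ comb x y p q) →
    (∀ x y → D x y → comb x y p q ∈ c ·ₛ X) →
    c ·ₛ image τ X ≐ eisensteinSet D
  image≐ X D to from =
      (λ {v} (w , (w′ , w′∈X , w≋) , v≋) → let x , y , d , cw≋ = to w′ w′∈X in
        x , y , d , ≋-trans v (c · w) (eisenstein x y) v≋
          (≋-trans (c · w) (c · isometry w′) (eisenstein x y) (·-cong c w (isometry w′) w≋)
            (transport x y w′ cw≋)))
    , (λ {v} (x , y , d , v≋) → let w , w∈X , ≋cw = from x y d in
        isometry w , (w , w∈X , ≋-refl (isometry w)) , ≋-trans v (eisenstein x y) (c · isometry w) v≋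
          (≋-sym (c · isometry w) (eisenstein x y)
            (transport x y w (≋-sym (comb x y p q) (c · w) ≋cw))))

  L-image : c ·ₛ image τ L ≐ ℤ[ω]
  L-image =
      (λ {v} v∈ → let x , y , _ , v≋ = proj₁ all {v} v∈ in x , y , v≋)
    , (λ {v} (x , y , v≋) → proj₂ all {v} (x , y , tt , v≋))
    where
    all = image≐ L (λ _ _ → ⊤)
      (λ w w∈L → let x , y , w≋ = proj₁ cL-spans {c · w} (w , w∈L , ≋-refl (c · w)) in x , y , tt , w≋)
      (λ x y _ → proj₂ cL-spans {comb x y p q} (x , y , ≋-refl (comb x y p q)))

  M-image : c ·ₛ image τ M ≐ 𝔭
  M-image = image≐ M Member
    (λ w w∈M →
      let x , y , w≋ = proj₁ cL-spans {c · w} (w , M⊆L {w} w∈M , ≋-refl (c · w)) in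
      x , y , memberOf x y (w , w∈M , ≋-sym (c · w) (comb x y p q) w≋) , w≋)
    member

  module Cosets {ℓ : ℕ} (ℓ-prime : Prime ℓ) (coset : Fin ℓ → ℂ)
    (cosets-complete : ∀ v → v ∈ L → ∃[ i ] (v ⊖ coset i) ∈ M)
    (cosets-irredundant : ∀ i j → (coset i ⊖ coset j) ∈ M → i ≡ j)
    (r₁ r₂ : Fin ℓ → ℤ) (coset≋ : ∀ i → c · coset i ≋ comb (r₁ i) (r₂ i) p q) where

    complete : ∀ x y → ∃[ i ] Member (x ℤ.- r₁ i) (y ℤ.- r₂ i)
    complete x y =
      let w , w∈L , ≋w = proj₂ cL-spans {comb x y p q} (x , y , ≋-refl (comb x y p q))
          i , w-r∈M = cosets-complete w w∈L
          z = comb (x ℤ.- r₁ i) (y ℤ.- r₂ i) p q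
      in i , memberOf (x ℤ.- r₁ i) (y ℤ.- r₂ i) (w ⊖ coset i , w-r∈M ,
        ≋-sym (c · (w ⊖ coset i)) z (scaled-difference w (coset i) x y (r₁ i) (r₂ i)
          (≋-sym (comb x y p q) (c · w) ≋w) (coset≋ i)))

    -- Membership supplies some `w` in M with the same multiple by `c` as the difference of
    -- representatives; cancelling `c` identifies the two.
    irredundant : ∀ i j → Member (r₁ i ℤ.- r₁ j) (r₂ i ℤ.- r₂ j) → i ≡ j
    irredundant i j h =
      let w , w∈M , ≋w = member (r₁ i ℤ.- r₁ j) (r₂ i ℤ.- r₂ j) h
          v = coset i ⊖ coset j
          z = comb (r₁ i ℤ.- r₁ j) (r₂ i ℤ.- r₂ j) p q
      in cosets-irredundant i j (M-resp
        (≋-sym v w (·-cancel c c>0 v w (≋-trans (c · v) z (c · w)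
          (scaled-difference (coset i) (coset j) (r₁ i) (r₂ i) (r₁ j) (r₂ j)
            (coset≋ i) (coset≋ j)) ≋w)))
        w∈M)

    classification : (ℓ ≡ 3 ⊎ ℓ % 6 ≡ 1) ×
      (Σ[ 𝔭 ∈ Pred ℂ 0ℓ ] IsPrimeIdeal 𝔭 × LiesOver 𝔭 ℓ × Equivalent L M ℤ[ω] 𝔭)
    classification =
        prime-norm ℓ-prime a b (PrincipalIdeal.PrimeIndex.∣norm∣≡ℓ a b ℓ-prime r₁ r₂ complete irredundant)
      , 𝔭 , isPrimeIdeal ℓ-prime r₁ r₂ complete irredundant , liesOver ℓ-prime r₁ r₂ complete irredundant
      -- The scale that normalises the minimum of L to 1 is also the homothety of the equivalence,
      -- because 1 is the minimal length in ℤ[ω].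
      , τ , c , c>0 , L-image , M-image

-- Classification of 3-and-3 forms

module _ {ℓ : ℕ} {L M : Pred ℂ 0ℓ} (form : IsForm 3 3 ℓ L M) where

  open IsForm form
  open Tempered tempered using (u; S⊆L-M; S′⊆M-0) renaming (tempers to t)
  open Tempers t using (1≤u; on-S; on-S′)

  scaled-M⊆L : scale ·ₛ M ⊆ scale ·ₛ L
  scaled-M⊆L (w , w∈M , v≋) = w , M⊆L {w} w∈M , v≋

  M-resp : M Respects _≋_
  M-resp {v} {w} v≋w v∈M =
    let b₁ , b₂ , _ , M≐ = M-lattice
        x , y , v≋ = proj₁ M≐ v∈M
    in proj₂ M≐ (x , y , ≋-trans w v (comb x y b₁ b₂) (≋-sym v w v≋w) v≋)

  L-hexagonal : ∃₂ (IsHexagonal (scale ·ₛ L) 1ℝ)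
  L-hexagonal =
    let b₁ , b₂ , basis , L≐ = L-lattice in
    hexagonal (scale ·ₛ L) (scale · b₁) (scale · b₂) 1ℝ (·ₛ-span scale L b₁ b₂ L≐)
      (scaled-basis-independent scale scale>0 b₁ b₂ basis) (Pos-fromℤ 0) (minimal-L tempered)
      (proj₁ S-pairs) (λ i → proj₁ (S⊆L-M (proj₁ S-pairs i) (pair∈ S-pairs i)))
      (λ i → on-S (proj₁ S-pairs i) (pair∈ S-pairs i)) (proj₂ (proj₂ (proj₂ S-pairs)))

  M-hexagonal : ∃₂ (IsHexagonal (scale ·ₛ M) u)
  M-hexagonal =
    let b₁ , b₂ , basis , M≐ = M-lattice in
    hexagonal (scale ·ₛ M) (scale · b₁) (scale · b₂) u (·ₛ-span scale M b₁ b₂ M≐)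
      (scaled-basis-independent scale scale>0 b₁ b₂ basis) (1≤⇒Pos {u} 1≤u) (minimal-M tempered)
      (proj₁ S′-pairs) (λ i → proj₁ (S′⊆M-0 (proj₁ S′-pairs i) (pair∈ S′-pairs i)))
      (λ i → on-S′ (proj₁ S′-pairs i) (pair∈ S′-pairs i)) (proj₂ (proj₂ (proj₂ S′-pairs)))

corollary7 : (ℓ : ℕ) → Prime ℓ → (L M : Pred ℂ 0ℓ) →
    IsForm 3 3 ℓ L M →
    (ℓ ≡ 3 ⊎ ℓ % 6 ≡ 1) ×
    (Σ[ 𝔭 ∈ Pred ℂ 0ℓ ] IsPrimeIdeal 𝔭 × LiesOver 𝔭 ℓ × Equivalent L M ℤ[ω] 𝔭)
corollary7 ℓ ℓ-prime L M form = assemble (L-hexagonal form) (M-hexagonal form)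
  where
  open IsForm form
  u = Tempered.u tempered
  assemble : ∃₂ (IsHexagonal (scale ·ₛ L) 1ℝ) → ∃₂ (IsHexagonal (scale ·ₛ M) u) →
    (ℓ ≡ 3 ⊎ ℓ % 6 ≡ 1) ×
    (Σ[ 𝔭 ∈ Pred ℂ 0ℓ ] IsPrimeIdeal 𝔭 × LiesOver 𝔭 ℓ × Equivalent L M ℤ[ω] 𝔭)
  assemble (p , q , hex-L) (α , β , hex-M) = fromGenerator
    (Sublattice.generator {scale ·ₛ L} {scale ·ₛ M} (λ {v} → scaled-M⊆L form {v}) {u}
      (1≤⇒Pos {u} (Tempers.1≤u (Tempered.tempers tempered))) {p} {q} {α} {β} hex-L hex-M)
    where
    module H = IsHexagonal hex-L
    coset-coordinates : ∀ i → ∃₂ λ x y → scale · proj₁ hasIndex i ≋ comb x y p q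
    coset-coordinates i = proj₁ H.spans {scale · proj₁ hasIndex i}
      (proj₁ hasIndex i , proj₁ (proj₂ hasIndex) i , ≋-refl (scale · proj₁ hasIndex i))
    fromGenerator : IdealGenerator (scale ·ₛ M) p q → 
      (ℓ ≡ 3 ⊎ ℓ % 6 ≡ 1) ×
      (Σ[ 𝔭 ∈ Pred ℂ 0ℓ ] IsPrimeIdeal 𝔭 × LiesOver 𝔭 ℓ × Equivalent L M ℤ[ω] 𝔭)
    fromGenerator g = Coordinates.Cosets.classification {scale} scale>0 {L} {M} M⊆L
      (λ {v} {w} → M-resp form {v} {w}) p q H.norm-p H.norm-q H.trace H.spans a b member memberOf
      ℓ-prime (proj₁ hasIndex) (proj₁ (proj₂ (proj₂ hasIndex))) (proj₂ (proj₂ (proj₂ hasIndex)))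
      (λ i → proj₁ (coset-coordinates i)) (λ i → proj₁ (proj₂ (coset-coordinates i)))
      (λ i → proj₂ (proj₂ (coset-coordinates i)))
      where open IdealGenerator g
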